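{- Let $m\ge r\ge 2$ be integers. Let $F$ be an $r$-graph that either has at most $m$ vertices, or has exactly $m+1$ vertices one of which has degree $1$. If $\mathcal{K}^F_{m+1}$ is $m$-stable, then there exists an integer $n_2$ such that for all $n\ge n_2$, $\mathrm{ex}(n,H^F_{m+1})=|T_r(n,m)|$.
   Context: An $r$-graph is a finite $r$-uniform hypergraph; $|G|$ denotes the number of edges and $n(G)$ the number of vertices of $G$. $F\subseteq G$ means $G$ contains a (not necessarily induced) copy of $F$ as a subgraph; $G$ is $F$-free if $F\not\subseteq G$, and is free of a family if it contains no member of the family. The Turán number $\mathrm{ex}(n,F)$ is the maximum number of edges in an $F$-free $r$-graph on $n$ vertices. The degree of a vertex is the number of edges containing it. $[m]_r=m(m-1)\cdots(m-r+1)$ is the falling factorial. $T_r(n,m)$ is the complete $m$-partite $r$-graph on $n$ vertices in which no two parts differ in size by more than one (its edges are all $r$-sets meeting each part in at most one vertex). A pair of vertices is covered in a hypergraph if some edge contains both vertices. For an $r$-graph $F$ and an integer $p\ge n(F)$, $\mathcal{K}^F_p$ is the family of all $r$-graphs $H$ that contain a set $C$ of $p$ vertices (called the core) such that the subgraph $H[C]$ induced by $C$ contains a copy of $F$ and every pair of vertices in $C$ is covered in $H$. $H^F_p$ is the following member of $\mathcal{K}^F_p$: label the vertices of $F$ as $v_1,\dots,v_{n(F)}$, add new vertices $v_{n(F)+1},\dots,v_p$, and for each pair $v_i,v_j$ ($1\le i<j\le p$) not covered in $F$ add a set $B_{i,j}$ of $r-2$ new vertices and the edge $\{v_i,v_j\}\cup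 B_{i,j}$, where the sets $B_{i,j}$ are pairwise disjoint. For an $r$-graph $G$ on $[t]=\{1,\dots,t\}$, let $p_G(x_1,\dots,x_t)=r!\sum_{e\in E(G)}\prod_{i\in e}x_i$. The Lagrangian of $G$ is $\lambda(G)=\max\{p_G(x): x_i\ge 0\ \forall i,\ \sum_i x_i=1\}$. The Lagrangian density of an $r$-graph $F$ is $\pi_\lambda(F)=\sup\{\lambda(G): G \text{ an } r\text{ -graph with } F\not\subseteq G\}$. An $r$-graph is $m$-partite if its vertex set can be partitioned into $m$ parts (possibly empty) such that every edge contains at most one vertex of each part. For an $r$-graph $F$ on at most $m+1$ vertices with $\pi_\lambda(F)\le\frac{[m]_r}{m^r}$ (this inequality is part of the meaning of the term), the family $\mathcal{K}^F_{m+1}$ is called $m$-stable if for every real $\varepsilon>0$ there are a real $\delta_1>0$ and an integer $n_1$ such that every $\mathcal{K}^F_{m+1}$-free $r$-graph $G$ with $n\ge n_1$ vertices and more than $\left(\frac{[m]_r}{m^r}-\delta_1\right)\binom{n}{r}$ edges can be made $m$-partite by deleting at most $\varepsilon n$ vertices. -}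

module Defs where

open import Data.Bool.Base using (Bool; T; _∧_)
import Data.Bool.Properties as Bool
open import Data.Fin.Base as Fin using (Fin; zero; suc; toℕ)
import Data.Fin.Properties as Fin
open import Data.Fin.Subset
  using (Subset; inside; outside; _∈_; ∣_∣; ⁅_⁆; _∪_; ∁; ⊥)
open import Data.Fin.Subset.Properties
  using (_∈?_; _⊆?_; anySubset?; ∣⁅x⁆∣≡1; ∣⊥∣≡0; ∪-identityˡ; ∪-identityʳ)
open import Data.Integer.Base using (+_)
open import Data.List.Base as List
  using (List; []; _∷_; map; _++_; filter; length; foldr; allFin; cartesianProduct)
import Data.List.Membership.DecPropositional as DecMembership
open import Data.List.Membership.Propositional.Properties using (∈-lookup; ∈-filter⁻)
open import Data.List.Relation.Unary.All as All using (All)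
import Data.List.Relation.Unary.All.Properties as All
open import Data.Nat.Base as ℕ using (ℕ; zero; suc; NonZero; _^_; _∸_; _!; z≤n; s≤s)
open import Data.Nat.Combinatorics using (_P_; _C_)
open import Data.Nat.DivMod using (_mod_)
import Data.Nat.Properties as ℕ
open import Data.Product.Base using (∃-syntax; Σ-syntax; _×_; _,_; proj₁; proj₂)
open import Data.Rational.Base as ℚ using (ℚ; 0ℚ; 1ℚ; ½)
import Data.Rational.Properties as ℚ
open import Data.Rational.Solver using (module +-*-Solver)
open import Data.Vec.Base as Vec using (Vec; []; _∷_; padRight; replicate; tabulate)
import Data.Vec.Properties as Vec
open import Function.Definitions using (Injective)
open import Relation.Binary.PropositionalEquality
  using (_≡_; _≢_; refl; sym; trans; cong; cong₂; subst)
open import Relation.Nullary.Decidable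
  using (Dec; isYes; toWitness; ¬?; _×-dec_; _→-dec_)
open import Relation.Nullary.Negation using (¬_; contradiction)

-- A real number is a Cauchy sequence of rationals, and equality of reals is _≈ℝ_.

Cauchy : (ℕ → ℚ) → Set
Cauchy a = ∀ ε → 0ℚ ℚ.< ε →
  ∃[ N ] (∀ i j → N ℕ.≤ i → N ℕ.≤ j → ℚ.∣ a i ℚ.- a j ∣ ℚ.≤ ε)

record ℝ : Set where
  constructor mkℝ
  field
    seq    : ℕ → ℚ
    cauchy : Cauchy seq

open ℝ public

module CauchyProperties where

  open +-*-Solver
  open ℚ.≤-Reasoning

  half-pos : ∀ {ε} → 0ℚ ℚ.< ε → 0ℚ ℚ.< ½ ℚ.* ε
  half-pos {ε} 0<ε = subst (ℚ._< ½ ℚ.* ε) (ℚ.*-zeroʳ ½) (ℚ.*-monoʳ-<-pos ½ 0<ε)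

  const-cauchy : ∀ q → Cauchy (λ _ → q)
  const-cauchy q ε 0<ε = 0 , λ _ _ _ _ →
    subst (ℚ._≤ ε) (sym (cong ℚ.∣_∣ (ℚ.+-inverseʳ q))) (ℚ.<⇒≤ 0<ε)

  +-cauchy : ∀ a b → Cauchy a → Cauchy b → Cauchy (λ i → a i ℚ.+ b i)
  +-cauchy a b ca cb ε 0<ε
    with ca (½ ℚ.* ε) (half-pos 0<ε) | cb (½ ℚ.* ε) (half-pos 0<ε)
  ... | M , hM | N , hN = M ℕ.⊔ N , λ i j p q → begin
    ℚ.∣ (a i ℚ.+ b i) ℚ.- (a j ℚ.+ b j) ∣
      ≡⟨ cong ℚ.∣_∣ (solve 4 (λ x y z w →
           (x :+ y) :- (z :+ w) := (x :- z) :+ (y :- w)) refl (a i) (b i) (a j) (b j)) ⟩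
    ℚ.∣ (a i ℚ.- a j) ℚ.+ (b i ℚ.- b j) ∣
      ≤⟨ ℚ.∣p+q∣≤∣p∣+∣q∣ (a i ℚ.- a j) (b i ℚ.- b j) ⟩
    ℚ.∣ a i ℚ.- a j ∣ ℚ.+ ℚ.∣ b i ℚ.- b j ∣
      ≤⟨ ℚ.+-mono-≤ (hM i j (ℕ.m⊔n≤o⇒m≤o M N p) (ℕ.m⊔n≤o⇒m≤o M N q))
                    (hN i j (ℕ.m⊔n≤o⇒n≤o M N p) (ℕ.m⊔n≤o⇒n≤o M N q)) ⟩
    ½ ℚ.* ε ℚ.+ ½ ℚ.* ε
      ≡⟨ sym (ℚ.*-distribʳ-+ ε ½ ½) ⟩
    (½ ℚ.+ ½) ℚ.* ε
      ≡⟨ ℚ.*-identityˡ ε ⟩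
    ε ∎

  neg-cauchy : ∀ a → Cauchy a → Cauchy (λ i → ℚ.- a i)
  neg-cauchy a ca ε 0<ε with ca ε 0<ε
  ... | N , hN = N , λ i j p q → begin
    ℚ.∣ ℚ.- a i ℚ.- ℚ.- a j ∣
      ≡⟨ cong ℚ.∣_∣ (solve 2 (λ x y → :- x :- :- y := y :- x) refl (a i) (a j)) ⟩
    ℚ.∣ a j ℚ.- a i ∣
      ≤⟨ hN j i q p ⟩
    ε ∎

  bounded : ∀ a → Cauchy a →
    ∃[ B ] 0ℚ ℚ.< B × ∃[ N ] (∀ i → N ℕ.≤ i → ℚ.∣ a i ∣ ℚ.≤ B)
  bounded a ca with ca 1ℚ (ℚ.positive⁻¹ 1ℚ)
  ... | N , hN = 1ℚ ℚ.+ ℚ.∣ a N ∣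
    , ℚ.+-mono-<-≤ (ℚ.positive⁻¹ 1ℚ) (ℚ.0≤∣p∣ (a N))
    , N , λ i p → begin
    ℚ.∣ a i ∣
      ≡⟨ cong ℚ.∣_∣ (solve 2 (λ x y → x := (x :- y) :+ y) refl (a i) (a N)) ⟩
    ℚ.∣ (a i ℚ.- a N) ℚ.+ a N ∣
      ≤⟨ ℚ.∣p+q∣≤∣p∣+∣q∣ (a i ℚ.- a N) (a N) ⟩
    ℚ.∣ a i ℚ.- a N ∣ ℚ.+ ℚ.∣ a N ∣
      ≤⟨ ℚ.+-monoˡ-≤ ℚ.∣ a N ∣ (hN i N p ℕ.≤-refl) ⟩
    1ℚ ℚ.+ ℚ.∣ a N ∣ ∎

  *-mono-≤-abs : ∀ {p q B δ} → 0ℚ ℚ.< B → ℚ.∣ p ∣ ℚ.≤ B → ℚ.∣ q ∣ ℚ.≤ δ →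
    ℚ.∣ p ℚ.* q ∣ ℚ.≤ B ℚ.* δ
  *-mono-≤-abs {p} {q} {B} {δ} 0<B p≤B q≤δ = begin
    ℚ.∣ p ℚ.* q ∣
      ≡⟨ ℚ.∣p*q∣≡∣p∣*∣q∣ p q ⟩
    ℚ.∣ p ∣ ℚ.* ℚ.∣ q ∣
      ≤⟨ ℚ.*-monoʳ-≤-nonNeg ℚ.∣ q ∣ {{ℚ.∣-∣-nonNeg q}} p≤B ⟩
    B ℚ.* ℚ.∣ q ∣
      ≤⟨ ℚ.*-monoˡ-≤-nonNeg B {{ℚ.nonNegative (ℚ.<⇒≤ 0<B)}} q≤δ ⟩
    B ℚ.* δ ∎

  *-cauchy : ∀ a b → Cauchy a → Cauchy b → Cauchy (λ i → a i ℚ.* b i)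
  *-cauchy a b ca cb ε 0<ε = N , bound
    where
    A = proj₁ (bounded a ca)
    B = proj₁ (bounded b cb)
    0<A = proj₁ (proj₂ (bounded a ca))
    0<B = proj₁ (proj₂ (bounded b cb))
    Nᵃ = proj₁ (proj₂ (proj₂ (bounded a ca)))
    Nᵇ = proj₁ (proj₂ (proj₂ (bounded b cb)))
    0<A+B : 0ℚ ℚ.< A ℚ.+ B
    0<A+B = ℚ.+-mono-< 0<A 0<B
    instance
      A+B-pos : ℚ.Positive (A ℚ.+ B)
      A+B-pos = ℚ.positive 0<A+B
      A+B≢0 : ℚ.NonZero (A ℚ.+ B)
      A+B≢0 = ℚ.pos⇒nonZero (A ℚ.+ B)
      1/-pos : ℚ.Positive (ℚ.1/ (A ℚ.+ B))
      1/-pos = ℚ.1/pos⇒pos (A ℚ.+ B)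
    δ = ℚ.1/ (A ℚ.+ B) ℚ.* ε
    0<δ : 0ℚ ℚ.< δ
    0<δ = subst (ℚ._< δ) (ℚ.*-zeroʳ (ℚ.1/ (A ℚ.+ B)))
                (ℚ.*-monoʳ-<-pos (ℚ.1/ (A ℚ.+ B)) 0<ε)
    Mᵃ = proj₁ (ca δ 0<δ)
    Mᵇ = proj₁ (cb δ 0<δ)
    N = (Nᵃ ℕ.⊔ Nᵇ) ℕ.⊔ (Mᵃ ℕ.⊔ Mᵇ)
    bound : ∀ i j → N ℕ.≤ i → N ℕ.≤ j →
      ℚ.∣ a i ℚ.* b i ℚ.- a j ℚ.* b j ∣ ℚ.≤ ε
    bound i j p q = begin
      ℚ.∣ a i ℚ.* b i ℚ.- a j ℚ.* b j ∣
        ≡⟨ cong ℚ.∣_∣ (solve 4 (λ x y z w →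
             x :* y :- z :* w := x :* (y :- w) :+ w :* (x :- z))
             refl (a i) (b i) (a j) (b j)) ⟩
      ℚ.∣ a i ℚ.* (b i ℚ.- b j) ℚ.+ b j ℚ.* (a i ℚ.- a j) ∣
        ≤⟨ ℚ.∣p+q∣≤∣p∣+∣q∣ (a i ℚ.* (b i ℚ.- b j)) (b j ℚ.* (a i ℚ.- a j)) ⟩
      ℚ.∣ a i ℚ.* (b i ℚ.- b j) ∣ ℚ.+ ℚ.∣ b j ℚ.* (a i ℚ.- a j) ∣
        ≤⟨ ℚ.+-mono-≤
             (*-mono-≤-abs {a i} {b i ℚ.- b j} 0<A
               (proj₂ (proj₂ (proj₂ (bounded a ca))) i (N≥Nᵃ p))
               (proj₂ (cb δ 0<δ) i j (N≥Mᵇ p) (N≥Mᵇ q)))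
             (*-mono-≤-abs {b j} {a i ℚ.- a j} 0<B
               (proj₂ (proj₂ (proj₂ (bounded b cb))) j (N≥Nᵇ q))
               (proj₂ (ca δ 0<δ) i j (N≥Mᵃ p) (N≥Mᵃ q))) ⟩
      A ℚ.* δ ℚ.+ B ℚ.* δ
        ≡⟨ sym (ℚ.*-distribʳ-+ δ A B) ⟩
      (A ℚ.+ B) ℚ.* δ
        ≡⟨ sym (ℚ.*-assoc (A ℚ.+ B) (ℚ.1/ (A ℚ.+ B)) ε) ⟩
      (A ℚ.+ B) ℚ.* ℚ.1/ (A ℚ.+ B) ℚ.* ε
        ≡⟨ cong (ℚ._* ε) (ℚ.*-inverseʳ (A ℚ.+ B)) ⟩
      1ℚ ℚ.* ε
        ≡⟨ ℚ.*-identityˡ ε ⟩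
      ε ∎
      where
      N≥Nᵃ : ∀ {k} → N ℕ.≤ k → Nᵃ ℕ.≤ k
      N≥Nᵃ h = ℕ.m⊔n≤o⇒m≤o Nᵃ Nᵇ (ℕ.m⊔n≤o⇒m≤o (Nᵃ ℕ.⊔ Nᵇ) (Mᵃ ℕ.⊔ Mᵇ) h)
      N≥Nᵇ : ∀ {k} → N ℕ.≤ k → Nᵇ ℕ.≤ k
      N≥Nᵇ h = ℕ.m⊔n≤o⇒n≤o Nᵃ Nᵇ (ℕ.m⊔n≤o⇒m≤o (Nᵃ ℕ.⊔ Nᵇ) (Mᵃ ℕ.⊔ Mᵇ) h)
      N≥Mᵃ : ∀ {k} → N ℕ.≤ k → Mᵃ ℕ.≤ k
      N≥Mᵃ h = ℕ.m⊔n≤o⇒m≤o Mᵃ Mᵇ (ℕ.m⊔n≤o⇒n≤o (Nᵃ ℕ.⊔ Nᵇ) (Mᵃ ℕ.⊔ Mᵇ) h)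
      N≥Mᵇ : ∀ {k} → N ℕ.≤ k → Mᵇ ℕ.≤ k
      N≥Mᵇ h = ℕ.m⊔n≤o⇒n≤o Mᵃ Mᵇ (ℕ.m⊔n≤o⇒n≤o (Nᵃ ℕ.⊔ Nᵇ) (Mᵃ ℕ.⊔ Mᵇ) h)

open CauchyProperties using (const-cauchy; +-cauchy; neg-cauchy; *-cauchy)

infixl 6 _+ℝ_ _-ℝ_
infixl 7 _*ℝ_
infix  4 _<ℝ_ _≤ℝ_ _≈ℝ_

fromℚ : ℚ → ℝ
fromℚ q = mkℝ (λ _ → q) (const-cauchy q)

fromℕ : ℕ → ℝ
fromℕ n = fromℚ (+ n ℚ./ 1)

0ℝ 1ℝ : ℝ
0ℝ = fromℚ 0ℚ
1ℝ = fromℚ 1ℚ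

_+ℝ_ _-ℝ_ _*ℝ_ : ℝ → ℝ → ℝ
mkℝ a ca +ℝ mkℝ b cb = mkℝ (λ i → a i ℚ.+ b i) (+-cauchy a b ca cb)
mkℝ a ca -ℝ mkℝ b cb = mkℝ (λ i → a i ℚ.- b i) (+-cauchy a (λ i → ℚ.- b i) ca (neg-cauchy b cb))
mkℝ a ca *ℝ mkℝ b cb = mkℝ (λ i → a i ℚ.* b i) (*-cauchy a b ca cb)

_<ℝ_ _≤ℝ_ _≈ℝ_ : ℝ → ℝ → Set
x <ℝ y = ∃[ ε ] 0ℚ ℚ.< ε × ∃[ N ] (∀ i → N ℕ.≤ i → seq x i ℚ.+ ε ℚ.≤ seq y i)
x ≤ℝ y = ¬ (y <ℝ x)
x ≈ℝ y = x ≤ℝ y × y ≤ℝ x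

sumℝ productℝ : List ℝ → ℝ
sumℝ     = foldr _+ℝ_ 0ℝ
productℝ = foldr _*ℝ_ 1ℝ

record RGraph (r n : ℕ) : Set where
  field
    edgeᵇ   : Subset n → Bool
    uniform : ∀ {e} → T (edgeᵇ e) → ∣ e ∣ ≡ r

  Edge : Subset n → Set
  Edge e = T (edgeᵇ e)

open RGraph public

private
  variable
    r m n p v : ℕ

subsets : ∀ n → List (Subset n)
subsets zero    = [] ∷ []
subsets (suc n) = map (inside ∷_) (subsets n) ++ map (outside ∷_) (subsets n)

elements : Subset n → List (Fin n)
elements e = filter (_∈? e) (allFin _)

edges : RGraph r n → List (Subset n)
edges G = filter (λ e → Bool.T? (edgeᵇ G e)) (subsets _)

size : RGraph r n → ℕ
size G = length (edges G)

degree : RGraph r n → Fin n → ℕ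
degree G u = length (filter (u ∈?_) (edges G))

Covered : RGraph r n → Fin n → Fin n → Set
Covered G u w = ∃[ e ] Edge G e × u ∈ e × w ∈ e

covered? : (G : RGraph r n) (u w : Fin n) → Dec (Covered G u w)
covered? G u w = anySubset? λ e → Bool.T? (edgeᵇ G e) ×-dec (u ∈? e ×-dec w ∈? e)

fromList : (es : List (Subset n)) → All (λ e → ∣ e ∣ ≡ r) es → RGraph r n
fromList es all = record
  { edgeᵇ   = λ e → isYes (e ∈ᴸ? es)
  ; uniform = λ {e} t → All.lookup all (toWitness {a? = e ∈ᴸ? es} t)
  }
  where open DecMembership (Vec.≡-dec Bool._≟_) renaming (_∈?_ to _∈ᴸ?_)

image : (Fin v → Fin n) → Subset v → Subset n
image f e = tabulate λ w → isYes (Fin.any? λ u → u ∈? e ×-dec (f u Fin.≟ w))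

record Copy (F : RGraph r v) (G : RGraph r n) : Set where
  field
    embed     : Fin v → Fin n
    injective : Injective _≡_ _≡_ embed
    preserves : ∀ {e} → Edge F e → Edge G (image embed e)

open Copy public

Free : RGraph r v → RGraph r n → Set
Free F G = ¬ Copy F G

-- A copy of F in the induced subgraph G[K]: isolated vertices of F must land in K too.
CopyWithin : RGraph r v → (G : RGraph r n) → Subset n → Set
CopyWithin F G K = Σ[ c ∈ Copy F G ] (∀ u → embed c u ∈ K)

IsTuránNumber : ∀ n → RGraph r v → ℕ → Set
IsTuránNumber {r} n F N =
    (Σ[ G ∈ RGraph r n ] Free F G × size G ≡ N)
  × (∀ (G : RGraph r n) → Free F G → size G ℕ.≤ N)

-- The parts are the fibres of χ.
Transversal : (Fin n → Fin m) → Subset n → Set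
Transversal χ e = ∀ u w → u ∈ e → w ∈ e → χ u ≡ χ w → u ≡ w

transversal? : (χ : Fin n → Fin m) (e : Subset n) → Dec (Transversal χ e)
transversal? χ e = Fin.all? λ u → Fin.all? λ w →
  u ∈? e →-dec (w ∈? e →-dec (χ u Fin.≟ χ w →-dec u Fin.≟ w))

Partite : ∀ m → RGraph r n → Set
Partite {n = n} m G = Σ[ χ ∈ (Fin n → Fin m) ] (∀ {e} → Edge G e → Transversal χ e)

completePartite : ∀ r → (Fin n → Fin m) → RGraph r n
completePartite r χ = record
  { edgeᵇ   = λ e → isYes (edge? e)
  ; uniform = λ {e} t → proj₁ (toWitness {a? = edge? e} t)
  }
  where
  edge? : ∀ e → Dec (∣ e ∣ ≡ r × Transversal χ e)
  edge? e = (∣ e ∣ ℕ.≟ r) ×-dec transversal? χ e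

-- Residue classes mod m split Fin n into m parts whose sizes differ by at most one.
turánGraph : ∀ r n m .{{_ : NonZero m}} → RGraph r n
turánGraph r n m = completePartite r (λ (i : Fin n) → toℕ i mod m)

-- The vertices in S are kept, but isolated.  For m ≥ 1 this does not affect m-partiteness,
-- because an isolated vertex may be put in any part.
deleteVertices : RGraph r n → Subset n → RGraph r n
deleteVertices G S = record
  { edgeᵇ   = λ e → edgeᵇ G e ∧ isYes (e ⊆? ∁ S)
  ; uniform = λ t → uniform G (proj₁ (Bool.T-∧ .Equivalence.to t))
  }
  where open import Function.Bundles using (module Equivalence)

lagrangePoly : RGraph r n → (Fin n → ℝ) → ℝ
lagrangePoly {r} G x =
  fromℕ (r !) *ℝ sumℝ (map (λ e → productℝ (map x (elements e))) (edges G))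

InSimplex : (Fin n → ℝ) → Set
InSimplex x = (∀ i → 0ℝ ≤ℝ x i) × sumℝ (map x (allFin _)) ≈ℝ 1ℝ

-- λ(G) ≤ c.  As λ(G) is a maximum over the simplex, this bounds p_G at every point of it.
LagrangianAtMost : RGraph r n → ℝ → Set
LagrangianAtMost G c = ∀ x → InSimplex x → lagrangePoly G x ≤ℝ c

-- π_λ(F) ≤ c.  As π_λ(F) is a supremum, this bounds λ(G) for every F-free r-graph G.
LagrangianDensityAtMost : RGraph r v → ℝ → Set
LagrangianDensityAtMost {r} F c =
  ∀ {t} (G : RGraph r t) → Free F G → LagrangianAtMost G c

InK : RGraph r v → ℕ → RGraph r n → Set
InK {n = n} F p H = Σ[ K ∈ Subset n ]
    ∣ K ∣ ≡ p
  × CopyWithin F H K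
  × (∀ u w → u ∈ K → w ∈ K → u ≢ w → Covered H u w)

KFree : RGraph r v → ℕ → RGraph r n → Set
KFree {r} F p G = ∀ {h} (H : RGraph r h) → InK F p H → Free H G

turánDensity : ∀ r m .{{_ : NonZero m}} → ℝ
turánDensity r m = fromℚ (+ (m P r) ℚ./ (m ^ r))
  where instance _ = ℕ.m^n≢0 m r

record Stable (F : RGraph r v) (m : ℕ) .{{_ : NonZero m}} : Set where
  field
    density≤ : LagrangianDensityAtMost F (turánDensity r m)
    stable   : ∀ ε → 0ℝ <ℝ ε → Σ[ δ₁ ∈ ℝ ] 0ℝ <ℝ δ₁ × ∃[ n₁ ]
      (∀ {n} → n₁ ℕ.≤ n → (G : RGraph r n) → KFree F (suc m) G →
       (turánDensity r m -ℝ δ₁) *ℝ fromℕ (n C r) <ℝ fromℕ (size G) →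
       Σ[ S ∈ Subset n ] fromℕ ∣ S ∣ ≤ℝ ε *ℝ fromℕ n × Partite m (deleteVertices G S))

∣padRight∣ : (v≤p : v ℕ.≤ p) (e : Subset v) → ∣ padRight v≤p outside e ∣ ≡ ∣ e ∣
∣padRight∣ {p = p} z≤n []    = ∣⊥∣≡0 p
∣padRight∣ (s≤s v≤p) (inside  ∷ e) = cong suc (∣padRight∣ v≤p e)
∣padRight∣ (s≤s v≤p) (outside ∷ e) = ∣padRight∣ v≤p e

∣++∣ : (e : Subset m) (e′ : Subset n) → ∣ e Vec.++ e′ ∣ ≡ ∣ e ∣ ℕ.+ ∣ e′ ∣
∣++∣ []            e′ = refl
∣++∣ (inside  ∷ e) e′ = cong suc (∣++∣ e e′)
∣++∣ (outside ∷ e) e′ = ∣++∣ e e′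

∣⁅i⁆∪⁅j⁆∣ : {i j : Fin n} → i ≢ j → ∣ ⁅ i ⁆ ∪ ⁅ j ⁆ ∣ ≡ 2
∣⁅i⁆∪⁅j⁆∣ {i = zero}  {zero}  i≢j = contradiction refl i≢j
∣⁅i⁆∪⁅j⁆∣ {i = zero}  {suc j} _   =
  cong suc (trans (cong ∣_∣ (∪-identityˡ ⁅ j ⁆)) (∣⁅x⁆∣≡1 j))
∣⁅i⁆∪⁅j⁆∣ {i = suc i} {zero}  _   =
  cong suc (trans (cong ∣_∣ (∪-identityʳ ⁅ i ⁆)) (∣⁅x⁆∣≡1 i))
∣⁅i⁆∪⁅j⁆∣ {i = suc i} {suc j} i≢j = ∣⁅i⁆∪⁅j⁆∣ λ i≡j → i≢j (cong suc i≡j)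

-- The c-th of k consecutive blocks of s vertices.
block : ∀ {k} → Fin k → ∀ s → Subset (k ℕ.* s)
block c s = Vec.concat (Vec.map (replicate s) ⁅ c ⁆)

∣blowup∣ : ∀ {k} (e : Subset k) s → ∣ Vec.concat (Vec.map (replicate s) e) ∣ ≡ ∣ e ∣ ℕ.* s
∣blowup∣ []            s = refl
∣blowup∣ (inside  ∷ e) s = trans (∣++∣ (replicate s inside) _)
                                 (cong₂ ℕ._+_ (∣inside∣ s) (∣blowup∣ e s))
  where
  ∣inside∣ : ∀ s → ∣ replicate s inside ∣ ≡ s
  ∣inside∣ zero    = refl
  ∣inside∣ (suc s) = cong suc (∣inside∣ s)
∣blowup∣ (outside ∷ e) s = trans (∣++∣ (replicate s outside) _)
                                 (cong₂ ℕ._+_ (∣⊥∣≡0 s) (∣blowup∣ e s))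

∣block∣ : ∀ {k} (c : Fin k) s → ∣ block c s ∣ ≡ s
∣block∣ c s = trans (∣blowup∣ ⁅ c ⁆ s) (trans (cong (ℕ._* s) (∣⁅x⁆∣≡1 c)) (ℕ.*-identityˡ s))

edges-uniform : (G : RGraph r n) → All (λ e → ∣ e ∣ ≡ r) (edges G)
edges-uniform G = All.map (uniform G) (All.all-filter (λ e → Bool.T? (edgeᵇ G e)) (subsets _))

-- F together with p − v new isolated vertices, labelled after those of F.
addIsolated : v ℕ.≤ p → RGraph r v → RGraph r p
addIsolated v≤p F = fromList
  (map (padRight v≤p outside) (edges F))
  (All.map⁺ (All.map (λ {e} ∣e∣≡r → trans (∣padRight∣ v≤p e) ∣e∣≡r) (edges-uniform F)))

uncoveredPair? : (G : RGraph r n) (ij : Fin n × Fin n) →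
  Dec (proj₁ ij Fin.< proj₂ ij × ¬ Covered G (proj₁ ij) (proj₂ ij))
uncoveredPair? G (i , j) = (i Fin.<? j) ×-dec ¬? (covered? G i j)

uncoveredPairs : RGraph r n → List (Fin n × Fin n)
uncoveredPairs G = filter (uncoveredPair? G) (cartesianProduct (allFin _) (allFin _))

-- H^F_p for an r-graph on p vertices.  The first p vertices of the result are those of F, and
-- the B_{i,j} are consecutive blocks of r − 2 vertices, one for each uncovered pair {i,j}.
extendCovering : 2 ℕ.≤ r → (F : RGraph r p) →
  RGraph r (p ℕ.+ length (uncoveredPairs F) ℕ.* (r ∸ 2))
extendCovering {r} {p} 2≤r F = fromList
  (map (Vec._++ ⊥) (edges F) ++ List.tabulate pairEdge)
  (All.++⁺
    (All.map⁺ (All.map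
      (λ {e} ∣e∣≡r → trans (∣++∣ e ⊥)
        (trans (cong₂ ℕ._+_ ∣e∣≡r (∣⊥∣≡0 (k ℕ.* (r ∸ 2)))) (ℕ.+-identityʳ r)))
      (edges-uniform F)))
    (All.tabulate⁺ λ c → trans (∣++∣ (pair c) (block c (r ∸ 2)))
      (trans (cong₂ ℕ._+_ (∣⁅i⁆∪⁅j⁆∣ (pair-distinct c)) (∣block∣ c (r ∸ 2)))
             (ℕ.m+[n∸m]≡n 2≤r))))
  where
  k = length (uncoveredPairs F)

  pair : Fin k → Subset p
  pair c = let i , j = List.lookup (uncoveredPairs F) c in ⁅ i ⁆ ∪ ⁅ j ⁆

  pairEdge : Fin k → Subset (p ℕ.+ k ℕ.* (r ∸ 2))
  pairEdge c = pair c Vec.++ block c (r ∸ 2)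

  pair-distinct : (c : Fin k) → let i , j = List.lookup (uncoveredPairs F) c in i ≢ j
  pair-distinct c = Fin.<⇒≢ (proj₁ (proj₂
    (∈-filter⁻ (uncoveredPair? F) {xs = cartesianProduct (allFin _) (allFin _)}
      (∈-lookup {xs = uncoveredPairs F} c))))

extension : 2 ℕ.≤ r → (v≤p : v ℕ.≤ p) (F : RGraph r v) →
  RGraph r (p ℕ.+ length (uncoveredPairs (addIsolated v≤p F)) ℕ.* (r ∸ 2))
extension 2≤r v≤p F = extendCovering 2≤r (addIsolated v≤p F)

{-# OPTIONS --safe #-}

-- Let G be a large graph without the extension.  Deleting a vertex of smaller degree than that of the
-- last vertex of the Turán graph increases the excess of G over the Turán number, so G may be assumed to
-- have large minimum degree.  Deleting the edges through pairs of small codegree loses O(n^(r-1)) edges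
-- and leaves a graph free of the whole family, because the uncovered pairs of a core could be covered
-- greedily by disjoint edges.  Stability then gives a colouring with m colours for which almost all edges
-- of G are rainbow; comparing the degrees with Maclaurin's inequality shows that the colour classes are
-- balanced and that almost all vertices miss few rainbow links.
--
-- Say that x is attached to the colour j if almost all rainbow lists avoiding j extend x to an edge.  Two
-- random choices produce the extension, using that some core vertex lies in at most one edge of F:
-- if two vertices attached to the same colour lie in a common edge, that edge covers this pair of the
-- core; if x is attached to no colour, then the edges at x meet every colour class often, so that x can
-- be joined by disjoint edges to a vertex in each class.  Hence every vertex is attached to a colour,
-- and recolouring the vertices accordingly makes all edges of G rainbow.
--
-- Edges are counted by the ordered lists of their vertices, which turns degrees and links into iterated
-- sums, and densities are bounded by multiplied-out inequalities between natural numbers.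

module Submission where

open import Data.Bool.Base as Bool using (Bool; true; false; T; if_then_else_)
import Data.Bool.Properties as Bool
open import Data.Fin.Base as Fin
  using (Fin; zero; suc; toℕ; fromℕ<; inject≤; cast; punchIn; punchOut; _↑ˡ_; _↑ʳ_; splitAt; combine; remQuot)
open import Data.Fin.Permutation.Components using (transpose; transpose-inverse)
import Data.Fin.Properties as Fin
open import Data.Fin.Subset using (Subset; outside; _∈_; _∉_; ∣_∣; ⁅_⁆; _∪_; ∁; ⊥; _-_)
open import Data.Fin.Subset.Properties
  using (_∈?_; _⊆?_; ⊆-antisym; p⊆q⇒∣p∣≤∣q∣; x∈⁅x⁆; x∈⁅y⁆⇒x≡y; x∈p∪q⁺; x∈p∪q⁻; ∉⊥; ∣⊥∣≡0; ∪-identityˡ;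
         x∈p∧x≢y⇒x∈p-y; p─q⊆p; drop-there; x∉p⇒x∈∁p)
import Data.Integer.Base as ℤ
import Data.Integer.Properties as ℤ
open import Data.List.Base as List using (List; []; _∷_; _++_; map; filter; length; take; allFin; cartesianProduct)
import Data.List.Membership.DecPropositional as DecMembership
open import Data.List.Membership.Propositional using () renaming (_∈_ to _∈ᴸ_; _∉_ to _∉ᴸ_)
open import Data.List.Membership.Propositional.Properties
  using (∈-map⁺; ∈-map⁻; ∈-filter⁺; ∈-filter⁻; ∈-allFin; ∈-++⁺ˡ; ∈-++⁺ʳ; ∈-++⁻; ∈-tabulate⁺; ∈-tabulate⁻;
         ∈-cartesianProduct⁺; ∈-lookup)
open import Data.List.Properties
  using (length-map; length-++; length-tabulate; length-take; map-∘; map-id; ∷-injectiveˡ)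
open import Data.List.Relation.Binary.Permutation.Propositional as Perm using (_↭_; ↭-refl; prep; swap)
open import Data.List.Relation.Binary.Permutation.Propositional.Properties using (∈-resp-↭)
open import Data.List.Relation.Binary.Sublist.Propositional using (_⊆_; []; _∷_; _∷ʳ_; from∈)
open import Data.List.Relation.Binary.Sublist.Propositional.Properties using (filter-⊆)
open import Data.List.Relation.Unary.All as All using (All; []; _∷_)
import Data.List.Relation.Unary.All.Properties as All
open import Data.List.Relation.Unary.AllPairs using ([]; _∷_)
open import Data.List.Relation.Unary.Any as Any using (here; there)
open import Data.List.Relation.Unary.Any.Properties using (lookup-index)
open import Data.List.Relation.Unary.Unique.Propositional using (Unique)
import Data.List.Relation.Unary.Unique.Propositional.Properties as Unique
open import Data.Nat.Base hiding (∣_-_∣; _/_; _%_)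
open import Data.Nat.Combinatorics as Comb using (_C_; nCk+nC[k+1]≡[n+1]C[k+1]; nCk≡nPk/k!)
import Data.Nat.Combinatorics.Base as Comb using (_P′_)
open import Data.Nat.Combinatorics.Specification using (k!∣nP′k)
open import Data.Nat.DivMod
  using (_mod_; _/_; _%_; m%n<n; [m+kn]%n≡m%n; m<n⇒m%n≡m; m≡m%n+[m/n]*n; m*[n/m]≡n; m/n*n≤m; /-monoˡ-≤; m*n/n≡m)
open import Data.Nat.Divisibility using (_∣_)
open import Data.Nat.Properties as ℕ hiding (suc-injective)
open import Data.Nat.Tactic.RingSolver using (solve-∀)
open import Data.Product.Base using (∃-syntax; Σ-syntax; _×_; _,_; proj₁; proj₂)
open import Data.Rational.Base as ℚ using (ℚ; mkℚ; 0ℚ; 1ℚ)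
import Data.Rational.Properties as ℚ
import Data.Rational.Solver as ℚSolver
import Data.Rational.Unnormalised.Base as ℚᵘ
import Data.Rational.Unnormalised.Properties as ℚᵘ
open import Data.Sum.Base using (_⊎_; inj₁; inj₂; [_,_]′)
open import Data.Vec.Base as Vec using ([]; _∷_; padRight)
open import Data.Vec.Functional using (updateAt; insertAt) renaming (_∷_ to _∷ᶠ_)
open import Data.Vec.Functional.Properties using (updateAt-updates; updateAt-minimal; insertAt-lookup; insertAt-punchIn)
import Data.Vec.Properties as Vec
open import Defs
open import Function.Base using (_∘_; id; const)
open import Function.Bundles using (module Equivalence)
open import Function.Definitions using (Injective)
open import Relation.Binary.Definitions using (tri<; tri≈; tri>)
open import Relation.Binary.PropositionalEquality hiding (J)
open import Relation.Nullary.Decidable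
  using (Dec; yes; no; does; ¬?; _×-dec_; _⊎-dec_; isYes; toWitness; fromWitness; decidable-stable)
open import Relation.Nullary.Negation using (¬_; contradiction)

module _ {n : ℕ} where
  open import Data.List.Membership.DecPropositional (Fin._≟_ {n}) public using () renaming (_∈?_ to _∈ᴸ?_)
  open import Data.List.Relation.Unary.Unique.DecPropositional (Fin._≟_ {n}) public using (unique?)

open ≤-Reasoning

-- Stability says nothing about a small set of exceptional vertices, while the theorem is exact, so
-- each of these must receive a colour too. This rests on a dichotomy: the minimum degree is about
-- as large as the class sizes allow, so if few edges at `x` meet class `j`, then `x` misses few
-- links of `j` and is attached to it; otherwise the edges at `x` meet every class often. The core
-- has m + 1 vertices and only m colours. The vertex `u₀` in at most one edge absorbs this: its edge
-- has r - 1 < m other vertices, so some core vertex forms an uncovered pair with `u₀`, and these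
-- two may share a colour. An inequality `q * x ≤ n ^ k` reads "x is at most a 1/q fraction of all
-- lists of length k". With d = r - 1, `A = d ! * (M C d)` and `L = suc M ^ d`, the leading term of
-- the ordered degrees in the Turán graph is A n^d / L. The precision of the first sampling fixes
-- when a vertex counts as attached; this fixes how often an unattached vertex meets each class,
-- hence the precision of the second sampling; the quality asked of the colouring comes last.

private
  variable
    k l m n r v M : ℕ
    P Q R : Set

-- Sums over lists of vertices

𝟙 : Dec P → ℕ
𝟙 d = if does d then 1 else 0

𝟙-yes : (d : Dec P) → P → 𝟙 d ≡ 1
𝟙-yes (yes _) _ = refl
𝟙-yes (no ¬p) p = contradiction p ¬p

𝟙-no : (d : Dec P) → ¬ P → 𝟙 d ≡ 0
𝟙-no (yes p) ¬p = contradiction p ¬p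
𝟙-no (no _)  _  = refl

𝟙≤1 : (d : Dec P) → 𝟙 d ≤ 1
𝟙≤1 (yes _) = ≤-refl
𝟙≤1 (no _)  = z≤n

0<𝟙⇒ : (d : Dec P) → 0 < 𝟙 d → P
0<𝟙⇒ (yes p) _ = p

𝟙≡0⇒¬ : (d : Dec P) → 𝟙 d ≡ 0 → ¬ P
𝟙≡0⇒¬ (no ¬p) _ = ¬p

𝟙-mono : (d : Dec P) (e : Dec Q) → (P → Q) → 𝟙 d ≤ 𝟙 e
𝟙-mono (yes p) e f = ≤-reflexive (sym (𝟙-yes e (f p)))
𝟙-mono (no _)  e f = z≤n

𝟙-cong : (d : Dec P) (e : Dec Q) → (P → Q) → (Q → P) → 𝟙 d ≡ 𝟙 e
𝟙-cong d e f g = ≤-antisym (𝟙-mono d e f) (𝟙-mono e d g)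

𝟙-⊎ : (d : Dec P) (e : Dec Q) (f : Dec R) → (P → Q ⊎ R) → 𝟙 d ≤ 𝟙 e + 𝟙 f
𝟙-⊎ (no _)  e f h = z≤n
𝟙-⊎ (yes p) e f h with h p
... | inj₁ q = ≤-trans (≤-reflexive (sym (𝟙-yes e q))) (m≤m+n _ _)
... | inj₂ q = ≤-trans (≤-reflexive (sym (𝟙-yes f q))) (m≤n+m _ _)

𝟙-× : (d : Dec P) (e : Dec Q) → 𝟙 (d ×-dec e) ≡ 𝟙 d * 𝟙 e
𝟙-× (yes p) (yes q) = refl
𝟙-× (yes p) (no _)  = refl
𝟙-× (no _)  e       = refl

∑ : (Fin n → ℕ) → ℕ
∑ {zero}  f = 0
∑ {suc n} f = f zero + ∑ (f ∘ suc)

∑-cong : {f g : Fin n → ℕ} → (∀ i → f i ≡ g i) → ∑ f ≡ ∑ g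
∑-cong {zero}  h = refl
∑-cong {suc n} h = cong₂ _+_ (h zero) (∑-cong (h ∘ suc))

∑-+ : (f g : Fin n → ℕ) → ∑ (λ i → f i + g i) ≡ ∑ f + ∑ g
∑-+ {zero}  f g = refl
∑-+ {suc n} f g = trans (cong (f zero + g zero +_) (∑-+ (f ∘ suc) (g ∘ suc)))
  (+-exchange (f zero) (g zero) _ _)
  where
  +-exchange : ∀ a b c d → a + b + (c + d) ≡ a + c + (b + d)
  +-exchange = solve-∀

∑-* : ∀ c (f : Fin n → ℕ) → ∑ (λ i → c * f i) ≡ c * ∑ f
∑-* {zero}  c f = sym (*-zeroʳ c)
∑-* {suc n} c f = trans (cong (c * f zero +_) (∑-* c (f ∘ suc))) (sym (*-distribˡ-+ c _ _))

∑-mono : {f g : Fin n → ℕ} → (∀ i → f i ≤ g i) → ∑ f ≤ ∑ g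
∑-mono {n = zero}  f≤g = z≤n
∑-mono {n = suc n} f≤g = +-mono-≤ (f≤g zero) (∑-mono (f≤g ∘ suc))

∑-const : ∀ n c → ∑ (λ (_ : Fin n) → c) ≡ n * c
∑-const zero    c = refl
∑-const (suc n) c = cong (c +_) (∑-const n c)

∑-bound : {f : Fin n → ℕ} {c : ℕ} → (∀ i → f i ≤ c) → ∑ f ≤ n * c
∑-bound {n} {c = c} f≤c = ≤-trans (∑-mono f≤c) (≤-reflexive (∑-const n c))

∑-swap : (f : Fin m → Fin n → ℕ) → ∑ (λ i → ∑ (f i)) ≡ ∑ (λ j → ∑ (λ i → f i j))
∑-swap {zero}  {n} f = sym (trans (∑-const n 0) (*-zeroʳ n))
∑-swap {suc m} f = trans (cong (∑ (f zero) +_) (∑-swap (f ∘ suc))) (sym (∑-+ (f zero) _))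

∑-punchIn : (i : Fin (suc n)) (f : Fin (suc n) → ℕ) → ∑ f ≡ f i + ∑ (f ∘ punchIn i)
∑-punchIn zero f = refl
∑-punchIn {suc n} (suc i) f = trans (cong (f zero +_) (∑-punchIn i (f ∘ suc)))
  (+-exchange (f zero) (f (suc i)) _)
  where
  +-exchange : ∀ a b c → a + (b + c) ≡ b + (a + c)
  +-exchange = solve-∀

term≤∑ : (f : Fin n → ℕ) (i : Fin n) → f i ≤ ∑ f
term≤∑ f zero    = m≤m+n _ _
term≤∑ f (suc i) = ≤-trans (term≤∑ (f ∘ suc) i) (m≤n+m _ _)

∑-find : {f g : Fin n → ℕ} → ∑ f < ∑ g → ∃[ i ] f i < g i
∑-find {n = suc n} {f} {g} lt with f zero <? g zero
... | yes p = zero , p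
... | no ¬p with suc (∑ (f ∘ suc)) ≤? ∑ (g ∘ suc)
...   | yes q = let i , h = ∑-find q in suc i , h
...   | no ¬q = contradiction lt (≤⇒≯ (+-mono-≤ (≮⇒≥ ¬p) (≮⇒≥ ¬q)))

∑-𝟙≡ : (u : Fin n) (f : Fin n → ℕ) → ∑ (λ v → 𝟙 (u Fin.≟ v) * f v) ≡ f u
∑-𝟙≡ {suc n} zero f = begin-equality
  1 * f zero + ∑ (λ v → 𝟙 (zero Fin.≟ Fin.suc v) * f (suc v)) ≡⟨ cong (1 * f zero +_) (∑-const n 0) ⟩
  1 * f zero + n * 0       ≡⟨ cong (1 * f zero +_) (*-zeroʳ n) ⟩
  1 * f zero + 0           ≡⟨ +-identityʳ _ ⟩
  1 * f zero               ≡⟨ *-identityˡ _ ⟩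
  f zero                   ∎
∑-𝟙≡ {suc n} (suc u) f = trans (∑-cong λ v → cong (_* f (suc v)) (𝟙-cong (suc u Fin.≟ suc v) (u Fin.≟ v) Fin.suc-injective (cong suc))) (∑-𝟙≡ u (f ∘ suc))

∑ᴸ : ℕ → (List (Fin n) → ℕ) → ℕ
∑ᴸ zero    f = f []
∑ᴸ (suc k) f = ∑ λ v → ∑ᴸ k (f ∘ (v ∷_))

module _ {n : ℕ} where

  ∑ᴸ-mono : ∀ k {f g : List (Fin n) → ℕ} →
    (∀ l → length l ≡ k → f l ≤ g l) → ∑ᴸ k f ≤ ∑ᴸ k g
  ∑ᴸ-mono zero    h = h [] refl
  ∑ᴸ-mono (suc k) h = ∑-mono λ v → ∑ᴸ-mono k λ l eq → h (v ∷ l) (cong suc eq)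

  ∑ᴸ-cong : ∀ k {f g : List (Fin n) → ℕ} →
    (∀ l → length l ≡ k → f l ≡ g l) → ∑ᴸ k f ≡ ∑ᴸ k g
  ∑ᴸ-cong k h = ≤-antisym (∑ᴸ-mono k λ l eq → ≤-reflexive (h l eq))
                          (∑ᴸ-mono k λ l eq → ≤-reflexive (sym (h l eq)))

  ∑ᴸ-+ : ∀ k (f g : List (Fin n) → ℕ) → ∑ᴸ k (λ l → f l + g l) ≡ ∑ᴸ k f + ∑ᴸ k g
  ∑ᴸ-+ zero    f g = refl
  ∑ᴸ-+ (suc k) f g = trans
    (∑-cong λ v → ∑ᴸ-+ k (f ∘ (v ∷_)) (g ∘ (v ∷_)))
    (∑-+ {n} _ _)

  ∑ᴸ-* : ∀ k c (f : List (Fin n) → ℕ) → ∑ᴸ k (λ l → c * f l) ≡ c * ∑ᴸ k f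
  ∑ᴸ-* zero    c f = refl
  ∑ᴸ-* (suc k) c f = trans
    (∑-cong λ v → ∑ᴸ-* k c (f ∘ (v ∷_)))
    (∑-* c λ v → ∑ᴸ k (f ∘ (v ∷_)))

  ∑ᴸ-const : ∀ k c → ∑ᴸ {n} k (λ _ → c) ≡ n ^ k * c
  ∑ᴸ-const zero    c = sym (+-identityʳ c)
  ∑ᴸ-const (suc k) c = begin-equality
    ∑ (λ (_ : Fin n) → ∑ᴸ {n} k λ _ → c) ≡⟨ ∑-const n _ ⟩
    n * ∑ᴸ {n} k (λ _ → c)      ≡⟨ cong (n *_) (∑ᴸ-const k c) ⟩
    n * (n ^ k * c)             ≡⟨ sym (*-assoc n _ c) ⟩
    n * n ^ k * c               ∎

  ∑ᴸ-0 : ∀ k → ∑ᴸ {n} k (λ _ → 0) ≡ 0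
  ∑ᴸ-0 k = trans (∑ᴸ-const k 0) (*-zeroʳ (n ^ k))

  ∑ᴸ-swap : ∀ {m} k (f : Fin m → List (Fin n) → ℕ) →
    ∑ᴸ k (λ l → ∑ λ i → f i l) ≡ ∑ λ i → ∑ᴸ k (f i)
  ∑ᴸ-swap zero    f = refl
  ∑ᴸ-swap (suc k) f = trans
    (∑-cong λ v → ∑ᴸ-swap k λ i → f i ∘ (v ∷_))
    (∑-swap λ v i → ∑ᴸ k (f i ∘ (v ∷_)))

  ∑ᴸ-++ : ∀ k l (f : List (Fin n) → ℕ) →
    ∑ᴸ (k + l) f ≡ ∑ᴸ k λ xs → ∑ᴸ l λ ys → f (xs ++ ys)
  ∑ᴸ-++ zero    l f = refl
  ∑ᴸ-++ (suc k) l f = ∑-cong λ v → ∑ᴸ-++ k l (f ∘ (v ∷_))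

  ∑ᴸ-find : ∀ k {f g : List (Fin n) → ℕ} → ∑ᴸ k f < ∑ᴸ k g →
    ∃[ l ] length l ≡ k × f l < g l
  ∑ᴸ-find zero    lt = [] , refl , lt
  ∑ᴸ-find (suc k) lt =
    let v , h = ∑-find lt
        l , eq , h′ = ∑ᴸ-find k h
    in v ∷ l , cong suc eq , h′

Symmetric : (List (Fin n) → ℕ) → Set
Symmetric f = ∀ {xs ys} → xs ↭ ys → f xs ≡ f ys

-- Sum over the position of `u` in the list: by symmetry each position contributes as much as the
-- first. Lists containing `u` several times are overcounted on the right.
∑ᴸ-∋ : ∀ k (u : Fin n) (f : List (Fin n) → ℕ) → Symmetric f →
  ∑ᴸ k (λ l → 𝟙 (u ∈ᴸ? l) * f l) ≤ k * ∑ᴸ (k ∸ 1) (f ∘ (u ∷_))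
∑ᴸ-∋ zero    u f sy = z≤n
∑ᴸ-∋ {n} (suc k) u f sy = begin
  ∑ (λ v → ∑ᴸ k λ l → 𝟙 (u ∈ᴸ? (v ∷ l)) * f (v ∷ l))
    ≤⟨ ∑-mono (λ v → ∑ᴸ-mono k λ l _ → begin
         𝟙 (u ∈ᴸ? (v ∷ l)) * f (v ∷ l)
           ≤⟨ *-monoˡ-≤ (f (v ∷ l)) (𝟙-⊎ (u ∈ᴸ? (v ∷ l)) (u Fin.≟ v) (u ∈ᴸ? l)
                (λ { (here p) → inj₁ p ; (there p) → inj₂ p })) ⟩
         (𝟙 (u Fin.≟ v) + 𝟙 (u ∈ᴸ? l)) * f (v ∷ l)
           ≡⟨ *-distribʳ-+ (f (v ∷ l)) (𝟙 (u Fin.≟ v)) _ ⟩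
         𝟙 (u Fin.≟ v) * f (v ∷ l) + 𝟙 (u ∈ᴸ? l) * f (v ∷ l) ∎) ⟩
  ∑ (λ v → ∑ᴸ k λ l → 𝟙 (u Fin.≟ v) * f (v ∷ l) + 𝟙 (u ∈ᴸ? l) * f (v ∷ l))
    ≡⟨ ∑-cong {n} (λ v → trans (∑ᴸ-+ k (λ l → 𝟙 (u Fin.≟ v) * f (v ∷ l)) _)
         (cong (_+ ∑ᴸ k (λ l → 𝟙 (u ∈ᴸ? l) * f (v ∷ l))) (∑ᴸ-* k (𝟙 (u Fin.≟ v)) (f ∘ (v ∷_))))) ⟩
  ∑ (λ v → 𝟙 (u Fin.≟ v) * ∑ᴸ k (f ∘ (v ∷_)) + ∑ᴸ k λ l → 𝟙 (u ∈ᴸ? l) * f (v ∷ l))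
    ≡⟨ ∑-+ (λ v → 𝟙 (u Fin.≟ v) * ∑ᴸ k (f ∘ (v ∷_))) _ ⟩
  ∑ (λ v → 𝟙 (u Fin.≟ v) * ∑ᴸ k (f ∘ (v ∷_))) + ∑ (λ v → ∑ᴸ k λ l → 𝟙 (u ∈ᴸ? l) * f (v ∷ l))
    ≤⟨ +-mono-≤ (≤-reflexive (∑-𝟙≡ u (λ v → ∑ᴸ k (f ∘ (v ∷_)))))
         (∑-mono λ v → ∑ᴸ-∋ k u (f ∘ (v ∷_)) (sy ∘ prep v)) ⟩
  ∑ᴸ k (f ∘ (u ∷_)) + ∑ (λ v → k * ∑ᴸ (k ∸ 1) (λ l → f (v ∷ u ∷ l)))
    ≤⟨ +-monoʳ-≤ (∑ᴸ k (f ∘ (u ∷_))) (rest k) ⟩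
  ∑ᴸ k (f ∘ (u ∷_)) + k * ∑ᴸ k (f ∘ (u ∷_)) ∎
  where
  rest : ∀ k → ∑ (λ v → k * ∑ᴸ (k ∸ 1) (λ l → f (v ∷ u ∷ l))) ≤ k * ∑ᴸ k (f ∘ (u ∷_))
  rest zero    = ≤-reflexive (trans (∑-const n 0) (*-zeroʳ n))
  rest (suc k) = ≤-reflexive (trans (∑-* (suc k) λ v → ∑ᴸ k (λ l → f (v ∷ u ∷ l))) (cong (suc k *_)
    (∑-cong λ v → ∑ᴸ-cong k λ l _ → sy (swap v u ↭-refl))))

∑ᴸ-∌ : ∀ k (u : Fin (suc n)) (f : List (Fin (suc n)) → ℕ) →
  ∑ᴸ k (λ l → 𝟙 (¬? (u ∈ᴸ? l)) * f l) ≤ ∑ᴸ k (f ∘ map (punchIn u))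
∑ᴸ-∌ zero    u f = ≤-reflexive (+-identityʳ _)
∑ᴸ-∌ {n} (suc k) u f = begin
  ∑ F                        ≡⟨ ∑-punchIn u F ⟩
  F u + ∑ (F ∘ punchIn u)    ≤⟨ +-mono-≤ (≤-reflexive F≡0) (∑-mono step) ⟩
  ∑ (λ v → ∑ᴸ k (f ∘ map (punchIn u) ∘ (v ∷_))) ∎
  where
  F : Fin (suc n) → ℕ
  F v = ∑ᴸ k λ l → 𝟙 (¬? (u ∈ᴸ? (v ∷ l))) * f (v ∷ l)
  F≡0 : F u ≡ 0
  F≡0 = trans (∑ᴸ-cong k λ l _ → cong (_* f (u ∷ l)) (𝟙-no (¬? (u ∈ᴸ? (u ∷ l))) λ h → h (here refl))) (∑ᴸ-0 k)
  step : ∀ v → F (punchIn u v) ≤ ∑ᴸ k (f ∘ map (punchIn u) ∘ (v ∷_))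
  step v = ≤-trans (∑ᴸ-mono k λ l _ → *-monoˡ-≤ _ (𝟙-mono (¬? (u ∈ᴸ? (punchIn u v ∷ l))) (¬? (u ∈ᴸ? l)) (λ h p → h (there p))))
                   (∑ᴸ-∌ k u (f ∘ (punchIn u v ∷_)))

-- Lists are split by whether they contain `u`. For the edge indicator the first sum belongs to the
-- graph without `u`, and the second is `k` times the ordered degree of `u`.
∑ᴸ-delete : ∀ k (u : Fin (suc n)) (f : List (Fin (suc n)) → ℕ) → Symmetric f →
  ∑ᴸ k f ≤ ∑ᴸ k (f ∘ map (punchIn u)) + k * ∑ᴸ (k ∸ 1) (f ∘ (u ∷_))
∑ᴸ-delete k u f sy = begin
  ∑ᴸ k f ≤⟨ ∑ᴸ-mono k (λ l _ → begin
      f l                      ≡⟨ sym (*-identityˡ _) ⟩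
      1 * f l                  ≤⟨ *-monoˡ-≤ (f l) (one (u ∈ᴸ? l)) ⟩
      (𝟙 (¬? (u ∈ᴸ? l)) + 𝟙 (u ∈ᴸ? l)) * f l ≡⟨ *-distribʳ-+ (f l) (𝟙 (¬? (u ∈ᴸ? l))) _ ⟩
      𝟙 (¬? (u ∈ᴸ? l)) * f l + 𝟙 (u ∈ᴸ? l) * f l ∎) ⟩
  ∑ᴸ k (λ l → 𝟙 (¬? (u ∈ᴸ? l)) * f l + 𝟙 (u ∈ᴸ? l) * f l) ≡⟨ ∑ᴸ-+ k _ _ ⟩
  ∑ᴸ k (λ l → 𝟙 (¬? (u ∈ᴸ? l)) * f l) + ∑ᴸ k (λ l → 𝟙 (u ∈ᴸ? l) * f l)
    ≤⟨ +-mono-≤ (∑ᴸ-∌ k u f) (∑ᴸ-∋ k u f sy) ⟩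
  ∑ᴸ k (f ∘ map (punchIn u)) + k * ∑ᴸ (k ∸ 1) (f ∘ (u ∷_)) ∎
  where
  one : ∀ {P : Set} (d : Dec P) → 1 ≤ 𝟙 (¬? d) + 𝟙 d
  one (yes _) = ≤-refl
  one (no _)  = ≤-refl

-- The sum over all subsequences: for an indicator `f` it counts the bad ones in a union bound.
subSum : (List (Fin n) → ℕ) → List (Fin n) → ℕ
subSum f []      = f []
subSum f (v ∷ z) = subSum f z + subSum (f ∘ (v ∷_)) z

subSum≡0 : (f : List (Fin n) → ℕ) (z : List (Fin n)) → subSum f z ≡ 0 → ∀ {l} → l ⊆ z → f l ≡ 0
subSum≡0 f []      eq []         = eq
subSum≡0 f (v ∷ z) eq (_ ∷ʳ s)   = subSum≡0 f z (m+n≡0⇒m≡0 _ eq) s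
subSum≡0 f (v ∷ z) eq (refl ∷ s) = subSum≡0 (f ∘ (v ∷_)) z (m+n≡0⇒n≡0 (subSum f z) eq) s

∑-subSum : ∀ {m} (f : Fin m → List (Fin n) → ℕ) z →
  ∑ (λ i → subSum (f i) z) ≡ subSum (λ l → ∑ λ i → f i l) z
∑-subSum f []      = refl
∑-subSum f (v ∷ z) = trans (∑-+ (λ i → subSum (f i) z) λ i → subSum (f i ∘ (v ∷_)) z)
  (cong₂ _+_ (∑-subSum f z) (∑-subSum (λ i → f i ∘ (v ∷_)) z))

-- Linearity of expectation: each of the `2 ^ k` subsequences of a uniformly random list is itself
-- uniformly random. In the induction, keeping the first entry turns `f` into its sum `f′` over that
-- entry, for which the hypothesis holds with `B * n`.
∑ᴸ-subSum : ∀ (k : ℕ) (f : List (Fin n) → ℕ) (Q B : ℕ) → (∀ (s : ℕ) → Q * ∑ᴸ s f ≤ B * n ^ s) →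
  Q * ∑ᴸ k (subSum f) ≤ 2 ^ k * (B * n ^ k)
∑ᴸ-subSum zero f Q B h = ≤-trans (h 0) (≤-reflexive (sym (+-identityʳ _)))
∑ᴸ-subSum {n} (suc k) f Q B h = begin
  Q * ∑ (λ v → ∑ᴸ k λ l → subSum f l + subSum (f ∘ (v ∷_)) l)
    ≡⟨ cong (Q *_) (trans (∑-cong {n} λ v → ∑ᴸ-+ k (subSum f) (subSum (f ∘ (v ∷_)))) (∑-+ {n} _ _)) ⟩
  Q * (∑ (λ (_ : Fin n) → ∑ᴸ k (subSum f)) + ∑ (λ v → ∑ᴸ k (subSum (f ∘ (v ∷_)))))
    ≡⟨ cong₂ (λ a b → Q * (a + b)) (∑-const n _)
        (trans (sym (∑ᴸ-swap k λ v → subSum (f ∘ (v ∷_)))) (∑ᴸ-cong k λ l _ → ∑-subSum (λ v → f ∘ (v ∷_)) l)) ⟩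
  Q * (n * ∑ᴸ k (subSum f) + ∑ᴸ k (subSum f′))
    ≡⟨ eq₁ Q n _ _ ⟩
  n * (Q * ∑ᴸ k (subSum f)) + Q * ∑ᴸ k (subSum f′)
    ≤⟨ +-mono-≤ (*-monoʳ-≤ n (∑ᴸ-subSum k f Q B h)) (∑ᴸ-subSum k f′ Q (B * n) h′) ⟩
  n * (2 ^ k * (B * n ^ k)) + 2 ^ k * (B * n * n ^ k)
    ≡⟨ eq₂ n (2 ^ k) B (n ^ k) ⟩
  2 * 2 ^ k * (B * (n * n ^ k)) ∎
  where
  f′ : List (Fin n) → ℕ
  f′ l = ∑ λ v → f (v ∷ l)
  h′ : ∀ (s : ℕ) → Q * ∑ᴸ s f′ ≤ B * n * n ^ s
  h′ s = begin
    Q * ∑ᴸ s f′                    ≡⟨ cong (Q *_) (∑ᴸ-swap s λ v → f ∘ (v ∷_)) ⟩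
    Q * ∑ᴸ (suc s) f               ≤⟨ h (suc s) ⟩
    B * (n * n ^ s)                ≡⟨ sym (*-assoc B n _) ⟩
    B * n * n ^ s ∎
  eq₁ : ∀ (Q n a b : ℕ) → Q * (n * a + b) ≡ n * (Q * a) + Q * b
  eq₁ = solve-∀
  eq₂ : ∀ (n t B x : ℕ) → n * (t * (B * x)) + t * (B * n * x) ≡ 2 * t * (B * (n * x))
  eq₂ = solve-∀

-- Sets, lists and edges

ext : {e e′ : Subset n} → (∀ {v} → v ∈ e → v ∈ e′) → (∀ {v} → v ∈ e′ → v ∈ e) → e ≡ e′
ext f g = ⊆-antisym f g

setOf : List (Fin n) → Subset n
setOf []      = ⊥
setOf (v ∷ l) = ⁅ v ⁆ ∪ setOf l

∈-setOf⁺ : ∀ {v : Fin n} {l} → v ∈ᴸ l → v ∈ setOf l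
∈-setOf⁺ {v = v} (here refl) = x∈p∪q⁺ (inj₁ (x∈⁅x⁆ v))
∈-setOf⁺ (there p)           = x∈p∪q⁺ (inj₂ (∈-setOf⁺ p))

∈-setOf⁻ : ∀ {v : Fin n} l → v ∈ setOf l → v ∈ᴸ l
∈-setOf⁻ []      p = contradiction p ∉⊥
∈-setOf⁻ (u ∷ l) p with x∈p∪q⁻ ⁅ u ⁆ (setOf l) p
... | inj₁ q = here (x∈⁅y⁆⇒x≡y u q)
... | inj₂ q = there (∈-setOf⁻ l q)

setOf-↭ : {xs ys : List (Fin n)} → xs ↭ ys → setOf xs ≡ setOf ys
setOf-↭ {xs = xs} {ys} p = ext
  (λ h → ∈-setOf⁺ (∈-resp-↭ p (∈-setOf⁻ xs h)))
  (λ h → ∈-setOf⁺ (∈-resp-↭ (Perm.↭-sym p) (∈-setOf⁻ ys h)))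

∣⁅v⁆∪e∣≡ : (v : Fin n) (e : Subset n) → v ∉ e → ∣ ⁅ v ⁆ ∪ e ∣ ≡ suc ∣ e ∣
∣⁅v⁆∪e∣≡ zero    (true  ∷ e) v∉e = contradiction Vec.here v∉e
∣⁅v⁆∪e∣≡ zero    (false ∷ e) v∉e = cong (suc ∘ ∣_∣) (∪-identityˡ e)
∣⁅v⁆∪e∣≡ (suc v) (true  ∷ e) v∉e = cong suc (∣⁅v⁆∪e∣≡ v e (v∉e ∘ Vec.there))
∣⁅v⁆∪e∣≡ (suc v) (false ∷ e) v∉e = ∣⁅v⁆∪e∣≡ v e (v∉e ∘ Vec.there)

⁅v⁆∪e≡e : {v : Fin n} {e : Subset n} → v ∈ e → ⁅ v ⁆ ∪ e ≡ e
⁅v⁆∪e≡e {v = v} {e} v∈e = ext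
  (λ p → [ (λ q → subst (_∈ e) (sym (x∈⁅y⁆⇒x≡y v q)) v∈e) , id ]′ (x∈p∪q⁻ ⁅ v ⁆ e p))
  (λ p → x∈p∪q⁺ (inj₂ p))

∣setOf∣≤ : (l : List (Fin n)) → ∣ setOf l ∣ ≤ length l
∣setOf∣≤ {n} [] = ≤-reflexive (∣⊥∣≡0 n)
∣setOf∣≤ (v ∷ l) with v ∈? setOf l
... | yes p = ≤-trans (≤-reflexive (cong ∣_∣ (⁅v⁆∪e≡e p))) (m≤n⇒m≤1+n (∣setOf∣≤ l))
... | no ¬p = ≤-trans (≤-reflexive (∣⁅v⁆∪e∣≡ v (setOf l) ¬p)) (s≤s (∣setOf∣≤ l))

∉⇒All≢ : {v : Fin n} {l : List (Fin n)} → v ∉ᴸ l → All (v ≢_) l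
∉⇒All≢ {l = []}    h = []
∉⇒All≢ {l = u ∷ l} h = (λ eq → h (here eq)) ∷ ∉⇒All≢ (h ∘ there)

Unique⇒∉ : {v : Fin n} {l : List (Fin n)} → Unique (v ∷ l) → v ∉ᴸ l
Unique⇒∉ (v≢ ∷ _) v∈l = All.lookup v≢ v∈l refl

Unique⇒∣setOf∣ : {l : List (Fin n)} → Unique l → ∣ setOf l ∣ ≡ length l
Unique⇒∣setOf∣ {n} {[]}    []       = ∣⊥∣≡0 n
Unique⇒∣setOf∣ {n} {v ∷ l} u@(_ ∷ ul) = trans
  (∣⁅v⁆∪e∣≡ v (setOf l) (Unique⇒∉ u ∘ ∈-setOf⁻ l))
  (cong suc (Unique⇒∣setOf∣ ul))

∣setOf∣⇒Unique : (l : List (Fin n)) → ∣ setOf l ∣ ≡ length l → Unique l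
∣setOf∣⇒Unique []      _  = []
∣setOf∣⇒Unique (v ∷ l) eq with v ∈? setOf l
... | yes p = contradiction
  (≤-trans (≤-reflexive (trans (sym eq) (cong ∣_∣ (⁅v⁆∪e≡e p)))) (∣setOf∣≤ l)) (<-irrefl refl)
... | no ¬p = ∉⇒All≢ (¬p ∘ ∈-setOf⁺)
  ∷ ∣setOf∣⇒Unique l (ℕ.suc-injective (trans (sym (∣⁅v⁆∪e∣≡ v (setOf l) ¬p)) eq))

∈-elements⁺ : {e : Subset n} {v : Fin n} → v ∈ e → v ∈ᴸ elements e
∈-elements⁺ {e = e} p = ∈-filter⁺ (_∈? e) (∈-allFin _) p

∈-elements⁻ : (e : Subset n) {v : Fin n} → v ∈ᴸ elements e → v ∈ e
∈-elements⁻ e p = proj₂ (∈-filter⁻ (_∈? e) {xs = allFin _} p)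

setOf-elements : (e : Subset n) → setOf (elements e) ≡ e
setOf-elements e = ext (λ p → ∈-elements⁻ e (∈-setOf⁻ (elements e) p)) (λ p → ∈-setOf⁺ (∈-elements⁺ p))

elements-unique : (e : Subset n) → Unique (elements e)
elements-unique e = Unique.filter⁺ (_∈? e) (Unique.allFin⁺ _)

length-elements : (e : Subset n) → length (elements e) ≡ ∣ e ∣
length-elements e = trans (sym (Unique⇒∣setOf∣ (elements-unique e))) (cong ∣_∣ (setOf-elements e))

∈-image⁺ : (f : Fin v → Fin n) {e : Subset v} {u : Fin v} → u ∈ e → f u ∈ image f e
∈-image⁺ f {e} {u} p = Vec.lookup⇒[]= (f u) (image f e)
  (trans (Vec.lookup∘tabulate _ (f u)) (T⇒true (fromWitness {a? = Fin.any? λ u′ → u′ ∈? e ×-dec (f u′ Fin.≟ f u)} (u , p , refl))))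
  where
  T⇒true : ∀ {b} → T b → b ≡ true
  T⇒true {true} _ = refl

∈-image⁻ : (f : Fin v → Fin n) {e : Subset v} {w : Fin n} → w ∈ image f e → ∃[ u ] u ∈ e × f u ≡ w
∈-image⁻ f {e} {w} p = toWitness {a? = Fin.any? λ u → u ∈? e ×-dec (f u Fin.≟ w)}
  (subst T (trans (sym (Vec.[]=⇒lookup p)) (Vec.lookup∘tabulate _ w)) _)

image-setOf : (f : Fin v → Fin n) (l : List (Fin v)) → image f (setOf l) ≡ setOf (map f l)
image-setOf f l = ext fwd bwd
  where
  fwd : ∀ {w} → w ∈ image f (setOf l) → w ∈ setOf (map f l)
  fwd p with ∈-image⁻ f p
  ... | u , u∈ , refl = ∈-setOf⁺ (∈-map⁺ f (∈-setOf⁻ l u∈))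
  bwd : ∀ {w} → w ∈ setOf (map f l) → w ∈ image f (setOf l)
  bwd p with ∈-map⁻ f (∈-setOf⁻ (map f l) p)
  ... | u , u∈ , refl = ∈-image⁺ f (∈-setOf⁺ u∈)

image-∘ : (g : Fin m → Fin n) (f : Fin v → Fin m) (e : Subset v) → image g (image f e) ≡ image (g ∘ f) e
image-∘ g f e = ext fwd bwd
  where
  fwd : ∀ {w} → w ∈ image g (image f e) → w ∈ image (g ∘ f) e
  fwd p with ∈-image⁻ g p
  ... | u , u∈ , refl with ∈-image⁻ f u∈
  ...   | u′ , u′∈ , refl = ∈-image⁺ (g ∘ f) u′∈
  bwd : ∀ {w} → w ∈ image (g ∘ f) e → w ∈ image g (image f e)
  bwd p with ∈-image⁻ (g ∘ f) p
  ... | u , u∈ , refl = ∈-image⁺ g (∈-image⁺ f u∈)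

∣image∣ : (f : Fin v → Fin n) → Injective _≡_ _≡_ f → (e : Subset v) → ∣ image f e ∣ ≡ ∣ e ∣
∣image∣ f inj e = begin-equality
  ∣ image f e ∣                     ≡⟨ cong (∣_∣ ∘ image f) (sym (setOf-elements e)) ⟩
  ∣ image f (setOf (elements e)) ∣  ≡⟨ cong ∣_∣ (image-setOf f (elements e)) ⟩
  ∣ setOf (map f (elements e)) ∣    ≡⟨ Unique⇒∣setOf∣ (Unique.map⁺ inj (elements-unique e)) ⟩
  length (map f (elements e))       ≡⟨ length-map f (elements e) ⟩
  length (elements e)               ≡⟨ length-elements e ⟩
  ∣ e ∣                             ∎

edge? : (G : RGraph r n) (e : Subset n) → Dec (Edge G e)
edge? G e = Bool.T? (edgeᵇ G e)

-- For lists l of length r this is 0 if l has repetitions, since edges have r elements.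
[_]ᴱ : RGraph r n → List (Fin n) → ℕ
[ G ]ᴱ l = 𝟙 (edge? G (setOf l))

[]ᴱ-sym : (G : RGraph r n) → Symmetric [ G ]ᴱ
[]ᴱ-sym G p = cong (λ e → 𝟙 (edge? G e)) (setOf-↭ p)

edge⇒Unique : (G : RGraph r n) (l : List (Fin n)) → length l ≡ r → Edge G (setOf l) → Unique l
edge⇒Unique G l eq e = ∣setOf∣⇒Unique l (trans (uniform G e) (sym eq))

pullback : (f : Fin v → Fin n) → Injective _≡_ _≡_ f → RGraph r n → RGraph r v
pullback f inj G = record
  { edgeᵇ   = λ e → edgeᵇ G (image f e)
  ; uniform = λ {e} t → trans (sym (∣image∣ f inj e)) (uniform G t)
  }

copy-pullback : (f : Fin v → Fin n) (inj : Injective _≡_ _≡_ f) (G : RGraph r n) {F : RGraph r k} →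
  Copy F (pullback f inj G) → Copy F G
copy-pullback f inj G c = record
  { embed     = f ∘ embed c
  ; injective = injective c ∘ inj
  ; preserves = λ {e} h → subst (Edge G) (image-∘ f (embed c) e) (preserves c h)
  }

∑-∈ : (e : Subset n) → ∑ (λ v → 𝟙 (v ∈? e)) ≡ ∣ e ∣
∑-∈ []          = refl
∑-∈ (true  ∷ e) = cong suc (trans (∑-cong λ v → 𝟙-cong (suc v ∈? (true ∷ e)) (v ∈? e) drop-there Vec.there) (∑-∈ e))
∑-∈ (false ∷ e) = trans (∑-cong λ v → 𝟙-cong (suc v ∈? (false ∷ e)) (v ∈? e) drop-there Vec.there) (∑-∈ e)

_≟ˢ_ : (e e′ : Subset n) → Dec (e ≡ e′)
_≟ˢ_ = Vec.≡-dec Bool._≟_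

⁅v⁆∪[e-v]≡e : {v : Fin n} {e : Subset n} → v ∈ e → ⁅ v ⁆ ∪ (e - v) ≡ e
⁅v⁆∪[e-v]≡e {n} {v} {e} v∈e = ext fwd bwd
  where
  fwd : ∀ {w} → w ∈ ⁅ v ⁆ ∪ (e - v) → w ∈ e
  fwd p with x∈p∪q⁻ ⁅ v ⁆ (e - v) p
  ... | inj₁ q = subst (_∈ e) (sym (x∈⁅y⁆⇒x≡y v q)) v∈e
  ... | inj₂ q = p─q⊆p e ⁅ v ⁆ q
  bwd : ∀ {w} → w ∈ e → w ∈ ⁅ v ⁆ ∪ (e - v)
  bwd {w} p with w Fin.≟ v
  ... | yes refl = x∈p∪q⁺ (inj₁ (x∈⁅x⁆ v))
  ... | no w≢v   = x∈p∪q⁺ (inj₂ (x∈p∧x≢y⇒x∈p-y p w≢v))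

v∉e-v : (v : Fin n) (e : Subset n) → v ∉ e - v
v∉e-v zero    (x ∷ e) p with x | p
... | true  | ()
... | false | ()
v∉e-v (suc v) (x ∷ e) (Vec.there p) = v∉e-v v e p

∣e-v∣ : {v : Fin n} {e : Subset n} → v ∈ e → suc ∣ e - v ∣ ≡ ∣ e ∣
∣e-v∣ {v = v} {e} v∈e = trans (sym (∣⁅v⁆∪e∣≡ v (e - v) (v∉e-v v e))) (cong ∣_∣ (⁅v⁆∪[e-v]≡e v∈e))

-- A list of length `k` whose set has `k` elements has no repetition, so removing its first vertex
-- `v` leaves an ordering of `e - v`.
∑ᴸ-setOf≡ : ∀ k (e : Subset n) → ∣ e ∣ ≡ k → ∑ᴸ k (λ l → 𝟙 (setOf l ≟ˢ e)) ≡ k !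
∑ᴸ-setOf≡ zero    e eq = 𝟙-yes (⊥ ≟ˢ e) (sym (Empty⇒ e eq))
  where
  Empty⇒ : ∀ {n} (e : Subset n) → ∣ e ∣ ≡ 0 → e ≡ ⊥
  Empty⇒ []          _  = refl
  Empty⇒ (false ∷ e) eq = cong (false ∷_) (Empty⇒ e eq)
∑ᴸ-setOf≡ {n} (suc k) e eq = begin-equality
  ∑ (λ v → ∑ᴸ k λ l → 𝟙 ((⁅ v ⁆ ∪ setOf l) ≟ˢ e)) ≡⟨ ∑-cong term ⟩
  ∑ (λ v → k ! * 𝟙 (v ∈? e))                     ≡⟨ ∑-* (k !) (λ v → 𝟙 (v ∈? e)) ⟩
  k ! * ∑ (λ v → 𝟙 (v ∈? e))                     ≡⟨ cong (k ! *_) (trans (∑-∈ e) eq) ⟩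
  k ! * suc k                                    ≡⟨ *-comm (k !) (suc k) ⟩
  suc k !                                        ∎
  where
  term : ∀ v → ∑ᴸ k (λ l → 𝟙 ((⁅ v ⁆ ∪ setOf l) ≟ˢ e)) ≡ k ! * 𝟙 (v ∈? e)
  term v with v ∈? e
  ... | no v∉e = trans (∑ᴸ-cong k λ l _ → 𝟙-no ((⁅ v ⁆ ∪ setOf l) ≟ˢ e)
                   λ h → v∉e (subst (v ∈_) h (x∈p∪q⁺ (inj₁ (x∈⁅x⁆ v)))))
                   (trans (∑ᴸ-0 {n} k) (sym (*-zeroʳ (k !))))
  ... | yes v∈e = trans (∑ᴸ-cong k λ l len → 𝟙-cong ((⁅ v ⁆ ∪ setOf l) ≟ˢ e) (setOf l ≟ˢ (e - v)) (fwd l len)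
                   λ h → trans (cong (⁅ v ⁆ ∪_) h) (⁅v⁆∪[e-v]≡e v∈e))
                   (trans (∑ᴸ-setOf≡ k (e - v) (ℕ.suc-injective (trans (∣e-v∣ v∈e) eq)))
                          (sym (*-identityʳ (k !))))
    where
    fwd : ∀ l → length l ≡ k → ⁅ v ⁆ ∪ setOf l ≡ e → setOf l ≡ e - v
    fwd l len refl with v ∈? setOf l
    ... | yes p = contradiction (≤-trans (≤-reflexive (trans (sym eq) (cong ∣_∣ (⁅v⁆∪e≡e p)))) (∣setOf∣≤ l))
                    (<⇒≱ (s≤s (≤-reflexive len)))
    ... | no ¬p = ext (λ {w} h → x∈p∧x≢y⇒x∈p-y (x∈p∪q⁺ (inj₂ h)) (λ { refl → ¬p h })) bwd
      where
      bwd : ∀ {w} → w ∈ (⁅ v ⁆ ∪ setOf l) - v → w ∈ setOf l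
      bwd h with x∈p∪q⁻ ⁅ v ⁆ (setOf l) (p─q⊆p (⁅ v ⁆ ∪ setOf l) ⁅ v ⁆ h)
      ... | inj₁ q = contradiction (subst (_∈ (⁅ v ⁆ ∪ setOf l) - v) (x∈⁅y⁆⇒x≡y v q) h) (v∉e-v v _)
      ... | inj₂ q = q

∑ˡ : {A : Set} → (A → ℕ) → List A → ℕ
∑ˡ f []       = 0
∑ˡ f (x ∷ xs) = f x + ∑ˡ f xs

∑ˡ-++ : {A : Set} (f : A → ℕ) (xs ys : List A) → ∑ˡ f (xs ++ ys) ≡ ∑ˡ f xs + ∑ˡ f ys
∑ˡ-++ f []       ys = refl
∑ˡ-++ f (x ∷ xs) ys = trans (cong (f x +_) (∑ˡ-++ f xs ys)) (sym (+-assoc (f x) _ _))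

∑ˡ-map : {A B : Set} (f : B → ℕ) (h : A → B) (xs : List A) → ∑ˡ f (map h xs) ≡ ∑ˡ (f ∘ h) xs
∑ˡ-map f h []       = refl
∑ˡ-map f h (x ∷ xs) = cong (f (h x) +_) (∑ˡ-map f h xs)

∑ˡ-cong : {A : Set} {f g : A → ℕ} (xs : List A) → (∀ x → f x ≡ g x) → ∑ˡ f xs ≡ ∑ˡ g xs
∑ˡ-cong []       h = refl
∑ˡ-cong (x ∷ xs) h = cong₂ _+_ (h x) (∑ˡ-cong xs h)

∑ˡ-0 : {A : Set} (xs : List A) → ∑ˡ (λ _ → 0) xs ≡ 0
∑ˡ-0 []       = refl
∑ˡ-0 (x ∷ xs) = ∑ˡ-0 xs

∑ˡ-* : {A : Set} (c : ℕ) (f : A → ℕ) (xs : List A) → ∑ˡ (λ x → c * f x) xs ≡ c * ∑ˡ f xs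
∑ˡ-* c f []       = sym (*-zeroʳ c)
∑ˡ-* c f (x ∷ xs) = trans (cong (c * f x +_) (∑ˡ-* c f xs)) (sym (*-distribˡ-+ c (f x) _))

∑ᴸ-∑ˡ : {A : Set} (k : ℕ) (f : A → List (Fin n) → ℕ) (xs : List A) →
  ∑ᴸ k (λ l → ∑ˡ (λ x → f x l) xs) ≡ ∑ˡ (λ x → ∑ᴸ k (f x)) xs
∑ᴸ-∑ˡ k f []       = ∑ᴸ-0 k
∑ᴸ-∑ˡ k f (x ∷ xs) = trans (∑ᴸ-+ k (f x) _) (cong (∑ᴸ k (f x) +_) (∑ᴸ-∑ˡ k f xs))

length-filter : {A : Set} {P : A → Set} (P? : ∀ x → Dec (P x)) (xs : List A) →
  length (filter P? xs) ≡ ∑ˡ (𝟙 ∘ P?) xs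
length-filter P? []       = refl
length-filter P? (x ∷ xs) with P? x
... | yes _ = cong suc (length-filter P? xs)
... | no  _ = length-filter P? xs

∑-subsets : (s : Subset n) (f : Subset n → ℕ) → ∑ˡ (λ e → 𝟙 (s ≟ˢ e) * f e) (subsets n) ≡ f s
∑-subsets [] f = trans (+-identityʳ _) (*-identityˡ _)
∑-subsets {suc n} (b ∷ s) f = begin-equality
  ∑ˡ F (map (true ∷_) (subsets n) ++ map (false ∷_) (subsets n))
    ≡⟨ ∑ˡ-++ F (map (true ∷_) (subsets n)) _ ⟩
  ∑ˡ F (map (true ∷_) (subsets n)) + ∑ˡ F (map (false ∷_) (subsets n))
    ≡⟨ cong₂ _+_ (∑ˡ-map F (true ∷_) (subsets n)) (∑ˡ-map F (false ∷_) (subsets n)) ⟩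
  ∑ˡ (F ∘ (true ∷_)) (subsets n) + ∑ˡ (F ∘ (false ∷_)) (subsets n)
    ≡⟨ halves b ⟩
  f (b ∷ s) ∎
  where
  F : Subset (suc n) → ℕ
  F e = 𝟙 ((b ∷ s) ≟ˢ e) * f e
  same : ∀ b → ∑ˡ (λ e → 𝟙 ((b ∷ s) ≟ˢ (b ∷ e)) * f (b ∷ e)) (subsets n) ≡ f (b ∷ s)
  same b = trans (∑ˡ-cong (subsets n) λ e → cong (_* f (b ∷ e))
    (𝟙-cong ((b ∷ s) ≟ˢ (b ∷ e)) (s ≟ˢ e) Vec.∷-injectiveʳ (cong (b ∷_))))
    (∑-subsets s (f ∘ (b ∷_)))
  diff : ∀ b c → b ≢ c → ∑ˡ (λ e → 𝟙 ((b ∷ s) ≟ˢ (c ∷ e)) * f (c ∷ e)) (subsets n) ≡ 0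
  diff b c b≢c = trans (∑ˡ-cong (subsets n) λ e → cong (_* f (c ∷ e))
    (𝟙-no ((b ∷ s) ≟ˢ (c ∷ e)) (b≢c ∘ Vec.∷-injectiveˡ))) (∑ˡ-0 (subsets n))
  halves : ∀ b → ∑ˡ (λ e → 𝟙 ((b ∷ s) ≟ˢ (true ∷ e)) * f (true ∷ e)) (subsets n)
    + ∑ˡ (λ e → 𝟙 ((b ∷ s) ≟ˢ (false ∷ e)) * f (false ∷ e)) (subsets n) ≡ f (b ∷ s)
  halves true  = trans (cong₂ _+_ (same true) (diff true false λ ())) (+-identityʳ _)
  halves false = cong₂ _+_ (diff false true λ ()) (same false)

D : RGraph r n → ℕ
D {r} G = ∑ᴸ r [ G ]ᴱ

D≡r!*size : (G : RGraph r n) → D G ≡ r ! * size G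
D≡r!*size {r} {n} G = begin-equality
  ∑ᴸ r (λ l → 𝟙 (edge? G (setOf l)))
    ≡⟨ ∑ᴸ-cong r (λ l _ → sym (∑-subsets (setOf l) (𝟙 ∘ edge? G))) ⟩
  ∑ᴸ r (λ l → ∑ˡ (λ e → 𝟙 (setOf l ≟ˢ e) * 𝟙 (edge? G e)) (subsets n))
    ≡⟨ ∑ᴸ-∑ˡ r (λ e l → 𝟙 (setOf l ≟ˢ e) * 𝟙 (edge? G e)) (subsets n) ⟩
  ∑ˡ (λ e → ∑ᴸ r λ l → 𝟙 (setOf l ≟ˢ e) * 𝟙 (edge? G e)) (subsets n)
    ≡⟨ ∑ˡ-cong (subsets n) (λ e → count e (edge? G e)) ⟩
  ∑ˡ (λ e → r ! * 𝟙 (edge? G e)) (subsets n)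
    ≡⟨ ∑ˡ-* (r !) (𝟙 ∘ edge? G) (subsets n) ⟩
  r ! * ∑ˡ (𝟙 ∘ edge? G) (subsets n)
    ≡⟨ cong (r ! *_) (sym (length-filter (edge? G) (subsets n))) ⟩
  r ! * size G ∎
  where
  count : ∀ e (d : Dec (Edge G e)) → ∑ᴸ r (λ l → 𝟙 (setOf l ≟ˢ e) * 𝟙 d) ≡ r ! * 𝟙 d
  count e (no _)  = trans (∑ᴸ-cong r λ l _ → *-zeroʳ (𝟙 (setOf l ≟ˢ e))) (trans (∑ᴸ-0 {n} r) (sym (*-zeroʳ (r !))))
  count e (yes h) = trans (∑ᴸ-cong r λ l _ → *-identityʳ (𝟙 (setOf l ≟ˢ e)))
                      (trans (∑ᴸ-setOf≡ r e (uniform G h)) (sym (*-identityʳ (r !))))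

-- Elementary symmetric functions

E : (Fin m → ℕ) → ℕ → ℕ
E         s zero    = 1
E {zero}  s (suc k) = 0
E {suc m} s (suc k) = E (s ∘ suc) (suc k) + s zero * E (s ∘ suc) k

E-mono : ∀ k {s t : Fin m → ℕ} → (∀ i → s i ≤ t i) → E s k ≤ E t k
E-mono         zero    h = ≤-refl
E-mono {zero}  (suc k) h = ≤-refl
E-mono {suc m} (suc k) h = +-mono-≤ (E-mono (suc k) (h ∘ suc)) (*-mono-≤ (h zero) (E-mono k (h ∘ suc)))

E-cong : ∀ k {s t : Fin m → ℕ} → (∀ i → s i ≡ t i) → E s k ≡ E t k
E-cong k h = ≤-antisym (E-mono k (≤-reflexive ∘ h)) (E-mono k (≤-reflexive ∘ sym ∘ h))

E-punchIn : ∀ (i : Fin (suc m)) (s : Fin (suc m) → ℕ) k →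
  E s (suc k) ≡ E (s ∘ punchIn i) (suc k) + s i * E (s ∘ punchIn i) k
E-punchIn zero s k = refl
E-punchIn {suc m} (suc i) s zero = begin-equality
  E (s ∘ suc) 1 + s zero * 1 ≡⟨ cong (_+ s zero * 1) (E-punchIn i (s ∘ suc) 0) ⟩
  E t 1 + s (suc i) * 1 + s zero * 1 ≡⟨ +-swapʳ (E t 1) (s (suc i) * 1) (s zero * 1) ⟩
  E t 1 + s zero * 1 + s (suc i) * 1 ∎
  where
  t : Fin m → ℕ
  t = s ∘ suc ∘ punchIn i
  +-swapʳ : ∀ a b c → a + b + c ≡ a + c + b
  +-swapʳ = solve-∀
E-punchIn {suc m} (suc i) s (suc k) = begin-equality
  E (s ∘ suc) (2 + k) + s zero * E (s ∘ suc) (suc k)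
    ≡⟨ cong₂ (λ x y → x + s zero * y) (E-punchIn i (s ∘ suc) (suc k)) (E-punchIn i (s ∘ suc) k) ⟩
  E t (2 + k) + s (suc i) * E t (suc k) + s zero * (E t (suc k) + s (suc i) * E t k)
    ≡⟨ rearrange (E t (2 + k)) (E t (suc k)) (E t k) (s zero) (s (suc i)) ⟩
  E t (2 + k) + s zero * E t (suc k) + s (suc i) * (E t (suc k) + s zero * E t k) ∎
  where
  t : Fin m → ℕ
  t = s ∘ suc ∘ punchIn i
  rearrange : ∀ a b c x y → a + y * b + x * (b + y * c) ≡ a + x * b + y * (b + x * c)
  rearrange = solve-∀

-- Each monomial of degree `k + 1` arises once from each of its `k + 1` variables.
E-∑ : ∀ (s : Fin (suc m) → ℕ) k → suc k * E s (suc k) ≡ ∑ (λ i → s i * E (s ∘ punchIn i) k)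
E-∑ {zero}  s zero    = trans (*-identityˡ (s zero * 1)) (sym (+-identityʳ _))
E-∑ {zero}  s (suc k) = trans (cong (suc (suc k) *_) (*-zeroʳ (s zero)))
  (trans (*-zeroʳ (suc (suc k))) (sym (trans (+-identityʳ _) (*-zeroʳ (s zero)))))
E-∑ {suc m} s zero = begin-equality
  E (s ∘ suc) 1 + s zero * 1 + 0 ≡⟨ rearrange (E (s ∘ suc) 1) (s zero * 1) ⟩
  s zero * 1 + 1 * E (s ∘ suc) 1 ≡⟨ cong (s zero * 1 +_) (E-∑ (s ∘ suc) 0) ⟩
  s zero * 1 + ∑ (λ i → s (suc i) * 1) ∎
  where
  rearrange : ∀ a b → a + b + 0 ≡ b + 1 * a
  rearrange = solve-∀
E-∑ {suc m} s (suc k) = begin-equality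
  suc (suc k) * (E t (2 + k) + s zero * E t (suc k))
    ≡⟨ rearrange k (E t (2 + k)) (s zero) (E t (suc k)) ⟩
  s zero * E t (suc k) + (suc (suc k) * E t (2 + k) + s zero * (suc k * E t (suc k)))
    ≡⟨ cong (s zero * E t (suc k) +_) (cong₂ (λ x y → x + s zero * y) (E-∑ t (suc k)) (E-∑ t k)) ⟩
  s zero * E t (suc k) + (∑ (λ i → t i * E (t ∘ punchIn i) (suc k)) + s zero * ∑ (λ i → t i * E (t ∘ punchIn i) k))
    ≡⟨ cong (s zero * E t (suc k) +_) (cong (∑ (λ i → t i * E (t ∘ punchIn i) (suc k)) +_) (sym (∑-* (s zero) λ i → t i * E (t ∘ punchIn i) k))) ⟩
  s zero * E t (suc k) + (∑ (λ i → t i * E (t ∘ punchIn i) (suc k)) + ∑ (λ i → s zero * (t i * E (t ∘ punchIn i) k)))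
    ≡⟨ cong (s zero * E t (suc k) +_) (sym (∑-+ (λ i → t i * E (t ∘ punchIn i) (suc k)) λ i → s zero * (t i * E (t ∘ punchIn i) k))) ⟩
  s zero * E t (suc k) + ∑ (λ i → t i * E (t ∘ punchIn i) (suc k) + s zero * (t i * E (t ∘ punchIn i) k))
    ≡⟨ cong (s zero * E t (suc k) +_) (∑-cong λ i → factor (t i) (E (t ∘ punchIn i) (suc k)) (s zero) (E (t ∘ punchIn i) k)) ⟩
  s zero * E t (suc k) + ∑ (λ i → t i * (E (t ∘ punchIn i) (suc k) + s zero * E (t ∘ punchIn i) k)) ∎
  where
  t : Fin (suc m) → ℕ
  t = s ∘ suc
  rearrange : ∀ k a x b → suc (suc k) * (a + x * b) ≡ x * b + (suc (suc k) * a + x * (suc k * b))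
  rearrange = solve-∀
  factor : ∀ x a y b → x * a + y * (x * b) ≡ x * (a + y * b)
  factor = solve-∀

-- In the two variables `a` and `t i`, the function is a nonnegative combination of 1, their sum and
-- their product; the sum is kept and the product does not fall.
E-smooth : ∀ k (a a′ : ℕ) (t t′ : Fin (suc m) → ℕ) i → (∀ j → t (punchIn i j) ≡ t′ (punchIn i j)) →
  a + t i ≡ a′ + t′ i → a * t i ≤ a′ * t′ i → E (a ∷ᶠ t) k ≤ E (a′ ∷ᶠ t′) k
E-smooth zero _ _ _ _ _ _ _ _ = ≤-refl
E-smooth (suc zero) a a′ t t′ i eq s≡ p≤ = ≤-reflexive (begin-equality
  E t 1 + a * 1                         ≡⟨ cong (_+ a * 1) (E-punchIn i t 0) ⟩
  E (t ∘ punchIn i) 1 + t i * 1 + a * 1 ≡⟨ rearrange (E (t ∘ punchIn i) 1) (t i) a ⟩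
  E (t ∘ punchIn i) 1 + (a + t i)       ≡⟨ cong₂ _+_ (E-cong 1 eq) s≡ ⟩
  E (t′ ∘ punchIn i) 1 + (a′ + t′ i)    ≡⟨ sym (rearrange (E (t′ ∘ punchIn i) 1) (t′ i) a′) ⟩
  E (t′ ∘ punchIn i) 1 + t′ i * 1 + a′ * 1 ≡⟨ cong (_+ a′ * 1) (sym (E-punchIn i t′ 0)) ⟩
  E t′ 1 + a′ * 1 ∎)
  where
  rearrange : ∀ u x y → u + x * 1 + y * 1 ≡ u + (y + x)
  rearrange = solve-∀
E-smooth (suc (suc k)) a a′ t t′ i eq s≡ p≤ = begin
  E t (2 + k) + a * E t (suc k)
    ≡⟨ expand a t ⟩
  E u (2 + k) + (a + t i) * E u (suc k) + a * t i * E u k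
    ≤⟨ +-mono-≤ (≤-reflexive (cong₂ _+_ (E-cong (2 + k) eq) (cong₂ _*_ s≡ (E-cong (suc k) eq))))
                (*-mono-≤ p≤ (≤-reflexive (E-cong k eq))) ⟩
  E u′ (2 + k) + (a′ + t′ i) * E u′ (suc k) + a′ * t′ i * E u′ k
    ≡⟨ sym (expand a′ t′) ⟩
  E t′ (2 + k) + a′ * E t′ (suc k) ∎
  where
  u u′ : Fin _ → ℕ
  u  = t ∘ punchIn i
  u′ = t′ ∘ punchIn i
  rearrange : ∀ U V W x y → U + x * V + y * (V + x * W) ≡ U + (y + x) * V + y * x * W
  rearrange = solve-∀
  expand : ∀ a t → E t (2 + k) + a * E t (suc k)
    ≡ E (t ∘ punchIn i) (2 + k) + (a + t i) * E (t ∘ punchIn i) (suc k) + a * t i * E (t ∘ punchIn i) k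
  expand a t = trans (cong₂ (λ x y → x + a * y) (E-punchIn i t (suc k)) (E-punchIn i t k))
    (rearrange (E (t ∘ punchIn i) (2 + k)) (E (t ∘ punchIn i) (suc k)) (E (t ∘ punchIn i) k) (t i) a)

E-∷-mono : ∀ k {a b} {s t : Fin m → ℕ} → a ≤ b → (∀ k → E s k ≤ E t k) → E (a ∷ᶠ s) k ≤ E (b ∷ᶠ t) k
E-∷-mono zero    a≤b h = ≤-refl
E-∷-mono (suc k) a≤b h = +-mono-≤ (h (suc k)) (*-mono-≤ a≤b (h k))

module _ (t : Fin (suc m) → ℕ) (i : Fin (suc m)) (x : ℕ) where

  set : Fin (suc m) → ℕ
  set = updateAt t i (const x)

  set-i : set i ≡ x
  set-i = updateAt-updates i t

  set-punchIn : ∀ j → t (punchIn i j) ≡ set (punchIn i j)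
  set-punchIn j = sym (updateAt-minimal (punchIn i j) i t (Fin.punchInᵢ≢i i j))

  ∑-set : ∀ {a a′} → a + t i ≡ a′ + x → a + ∑ t ≡ a′ + ∑ set
  ∑-set {a} {a′} eq = begin-equality
    a + ∑ t                            ≡⟨ cong (a +_) (∑-punchIn i t) ⟩
    a + (t i + ∑ (t ∘ punchIn i))      ≡⟨ sym (+-assoc a (t i) _) ⟩
    a + t i + ∑ (t ∘ punchIn i)        ≡⟨ cong₂ _+_ eq (∑-cong set-punchIn) ⟩
    a′ + x + ∑ (set ∘ punchIn i)       ≡⟨ cong (λ y → a′ + y + ∑ (set ∘ punchIn i)) (sym set-i) ⟩
    a′ + set i + ∑ (set ∘ punchIn i)   ≡⟨ +-assoc a′ (set i) _ ⟩
    a′ + (set i + ∑ (set ∘ punchIn i)) ≡⟨ cong (a′ +_) (sym (∑-punchIn i set)) ⟩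
    a′ + ∑ set                         ∎

-- Moving one unit between the first argument and another one brings the first arguments of both
-- sides closer together; once they agree, induct on the number of arguments.
E-balanced-step : ∀ {q} (s t : Fin (2 + m) → ℕ) → (∀ i → q ≤ t i × t i ≤ suc q) →
  (∀ u → ∑ u ≤ ∑ (t ∘ suc) → ∀ k → E u k ≤ E (t ∘ suc) k) → ∑ s ≤ ∑ t → ∀ k → E s (suc k) ≤ E t (suc k)
E-balanced-step {m} {q} s t bal IH s≤t k with ≤-total (s zero) (t zero)
... | inj₁ s₀≤ = asc (t zero ∸ s zero) (s zero) (s ∘ suc) (m+[n∸m]≡n s₀≤) s≤t
  where
  asc : ∀ g a (u : Fin (suc m) → ℕ) → a + g ≡ t zero → a + ∑ u ≤ ∑ t → E (a ∷ᶠ u) (suc k) ≤ E t (suc k)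
  asc g a u eq le with ∑ u ≤? ∑ (t ∘ suc)
  ... | yes u≤ = E-∷-mono (suc k) {a} (m+n≤o⇒m≤o a (≤-reflexive eq))
                   (IH u u≤)
  asc zero    a u eq le | no u≰ = contradiction
    (+-cancelˡ-≤ a _ _ (subst (λ b → a + ∑ u ≤ b + ∑ (t ∘ suc)) (trans (sym eq) (+-identityʳ a)) le)) u≰
  -- The other arguments sum to more than their targets, so some `u i` exceeds its target and is at
  -- least `q + 1`. As `a` is below `t zero`, it is at most `q`, and moving a unit from `u i` to `a`
  -- does not lower the product.
  asc (suc g) a u eq le | no u≰ with ∑-find {f = t ∘ suc} {u} (≰⇒> u≰)
  ... | i , tᵢ<uᵢ with u i in uᵢ≡
  ...   | suc x = ≤-trans
    (E-smooth (suc k) a (suc a) u (set u i x) i (set-punchIn u i x)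
      (trans sum≡ (cong (suc a +_) (sym (set-i u i x))))
      (begin
        a * u i             ≡⟨ cong (a *_) uᵢ≡ ⟩
        a * suc x           ≡⟨ *-suc a x ⟩
        a + a * x           ≤⟨ +-monoˡ-≤ (a * x) a≤x ⟩
        x + a * x           ≡⟨ cong (suc a *_) (sym (set-i u i x)) ⟩
        suc a * set u i x i ∎))
    (asc g (suc a) (set u i x) (trans (sym (+-suc a g)) eq)
      (≤-trans (≤-reflexive (sym (∑-set u i x {a} {suc a} sum≡))) le))
    where
    sum≡ : a + u i ≡ suc a + x
    sum≡ = trans (cong (a +_) uᵢ≡) (+-suc a x)
    a≤x : a ≤ x
    a≤x = s≤s⁻¹ (begin
      suc a           ≤⟨ s≤s (m≤m+n a g) ⟩
      suc (a + g)     ≡⟨ sym (+-suc a g) ⟩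
      a + suc g       ≡⟨ eq ⟩
      t zero          ≤⟨ proj₂ (bal zero) ⟩
      suc q           ≤⟨ s≤s (≤-trans (proj₁ (bal (suc i))) (s≤s⁻¹ tᵢ<uᵢ)) ⟩
      suc x           ∎)
... | inj₂ t₀≤ = subst (λ a → E (a ∷ᶠ (s ∘ suc)) (suc k) ≤ E t (suc k)) (m∸n+n≡m t₀≤)
    (desc (s zero ∸ t zero) (s ∘ suc) (subst (λ a → a + ∑ (s ∘ suc) ≤ ∑ t) (sym (m∸n+n≡m t₀≤)) s≤t))
  where
  desc : ∀ g (u : Fin (suc m) → ℕ) → g + t zero + ∑ u ≤ ∑ t → E ((g + t zero) ∷ᶠ u) (suc k) ≤ E t (suc k)
  desc zero    u le = E-∷-mono (suc k) {t zero} ≤-refl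
    (IH u (+-cancelˡ-≤ (t zero) _ _ le))
  desc (suc g) u le with ∑-find {f = u} {t ∘ suc}
    (+-cancelˡ-≤ (t zero) _ _ (≤-trans (≤-trans (≤-reflexive (+-suc (t zero) _)) (s≤s (+-monoˡ-≤ (∑ u) (m≤n+m (t zero) g)))) le))
  ... | i , uᵢ<tᵢ = ≤-trans
    (E-smooth (suc k) (suc g + t zero) (g + t zero) u (set u i (suc (u i))) i (set-punchIn u i (suc (u i)))
      (trans sum≡ (cong (g + t zero +_) (sym (set-i u i (suc (u i))))))
      (begin
        u i + (g + t zero) * u i        ≤⟨ +-monoˡ-≤ _ uᵢ≤ ⟩
        g + t zero + (g + t zero) * u i ≡⟨ sym (*-suc (g + t zero) (u i)) ⟩
        (g + t zero) * suc (u i)        ≡⟨ cong ((g + t zero) *_) (sym (set-i u i (suc (u i)))) ⟩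
        (g + t zero) * set u i (suc (u i)) i ∎))
    (desc g (set u i (suc (u i))) (≤-trans (≤-reflexive (sym (∑-set u i (suc (u i)) {suc g + t zero} {g + t zero} sum≡))) le))
    where
    sum≡ : suc g + t zero + u i ≡ g + t zero + suc (u i)
    sum≡ = sym (+-suc (g + t zero) (u i))
    uᵢ≤ : u i ≤ g + t zero
    uᵢ≤ = begin
      u i        ≤⟨ s≤s⁻¹ (≤-trans uᵢ<tᵢ (proj₂ (bal (suc i)))) ⟩
      q          ≤⟨ proj₁ (bal zero) ⟩
      t zero     ≤⟨ m≤n+m (t zero) g ⟩
      g + t zero ∎

-- Needed for two balanced `t`: the class sizes of the Turán graph, where it gives the optimality of
-- that graph, and a constant, where it is Maclaurin's inequality.
E-balanced-max : ∀ {q} (s t : Fin m → ℕ) → (∀ i → q ≤ t i × t i ≤ suc q) → ∑ s ≤ ∑ t → ∀ k → E s k ≤ E t k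
E-balanced-max              s t bal s≤t zero    = ≤-refl
E-balanced-max {zero}       s t bal s≤t (suc k) = ≤-refl
E-balanced-max {suc zero}   s t bal s≤t (suc k) = E-mono (suc k) {s} {t}
  λ { zero → subst₂ _≤_ (+-identityʳ _) (+-identityʳ _) s≤t }
E-balanced-max {suc (suc m)} s t bal s≤t (suc k) = E-balanced-step s t bal
  (λ u → E-balanced-max u (t ∘ suc) (bal ∘ suc)) s≤t k

E-upper : ∀ k {b} (s : Fin m → ℕ) → (∀ i → s i ≤ b) → E s k ≤ (m C k) * b ^ k
E-upper         zero    s h = ≤-refl
E-upper {zero}  (suc k) s h = z≤n
E-upper {suc m} (suc k) {b} s h = begin
  E (s ∘ suc) (suc k) + s zero * E (s ∘ suc) k
    ≤⟨ +-mono-≤ (E-upper (suc k) (s ∘ suc) (h ∘ suc)) (*-mono-≤ (h zero) (E-upper k (s ∘ suc) (h ∘ suc))) ⟩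
  (m C suc k) * (b * b ^ k) + b * ((m C k) * b ^ k)
    ≡⟨ rearrange (m C suc k) b (b ^ k) (m C k) ⟩
  ((m C k) + (m C suc k)) * (b * b ^ k)
    ≡⟨ cong (_* (b * b ^ k)) (nCk+nC[k+1]≡[n+1]C[k+1] m k) ⟩
  (suc m C suc k) * (b * b ^ k) ∎
  where
  rearrange : ∀ x b p y → x * (b * p) + b * (y * p) ≡ (y + x) * (b * p)
  rearrange = solve-∀

E-lower : ∀ k {b} (s : Fin m → ℕ) → (∀ i → b ≤ s i) → (m C k) * b ^ k ≤ E s k
E-lower         zero    s h = ≤-refl
E-lower {zero}  (suc k) s h = z≤n
E-lower {suc m} (suc k) {b} s h = begin
  (suc m C suc k) * (b * b ^ k)
    ≡⟨ cong (_* (b * b ^ k)) (sym (nCk+nC[k+1]≡[n+1]C[k+1] m k)) ⟩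
  ((m C k) + (m C suc k)) * (b * b ^ k)
    ≡⟨ rearrange (m C suc k) b (b ^ k) (m C k) ⟩
  (m C suc k) * (b * b ^ k) + b * ((m C k) * b ^ k)
    ≤⟨ +-mono-≤ (E-lower (suc k) (s ∘ suc) (h ∘ suc)) (*-mono-≤ (h zero) (E-lower k (s ∘ suc) (h ∘ suc))) ⟩
  E (s ∘ suc) (suc k) + s zero * E (s ∘ suc) k ∎
  where
  rearrange : ∀ x b p y → (y + x) * (b * p) ≡ x * (b * p) + b * (y * p)
  rearrange = solve-∀

-- Colourings and the Turán graph

Colouring : ℕ → ℕ → Set
Colouring n m = Fin n → Fin m

part : Colouring n m → Fin m → ℕ
part χ c = ∑ λ v → 𝟙 (χ v Fin.≟ c)

∑-fibres : (χ : Colouring n m) (f : Fin m → ℕ) → ∑ (f ∘ χ) ≡ ∑ (λ c → part χ c * f c)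
∑-fibres {n} {m} χ f = begin-equality
  ∑ (f ∘ χ)                                   ≡⟨ ∑-cong (λ v → sym (∑-𝟙≡ (χ v) f)) ⟩
  ∑ (λ v → ∑ λ c → 𝟙 (χ v Fin.≟ c) * f c)     ≡⟨ ∑-swap (λ v c → 𝟙 (χ v Fin.≟ c) * f c) ⟩
  ∑ (λ c → ∑ λ v → 𝟙 (χ v Fin.≟ c) * f c)     ≡⟨ ∑-cong (λ c → trans (∑-cong {n} λ v → *-comm (𝟙 (χ v Fin.≟ c)) (f c))
      (trans (∑-* (f c) λ v → 𝟙 (χ v Fin.≟ c)) (*-comm (f c) _))) ⟩
  ∑ (λ c → part χ c * f c)                    ∎

∑-part : (χ : Colouring n m) → ∑ (part χ) ≡ n
∑-part {n} χ = begin-equality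
  ∑ (part χ)             ≡⟨ ∑-cong (λ c → sym (*-identityʳ (part χ c))) ⟩
  ∑ (λ c → part χ c * 1) ≡⟨ sym (∑-fibres χ λ _ → 1) ⟩
  ∑ (λ (_ : Fin n) → 1)  ≡⟨ ∑-const n 1 ⟩
  n * 1                  ≡⟨ *-identityʳ n ⟩
  n                      ∎

-- The list `js` accumulates the colours of earlier vertices, so that the condition splits off one
-- vertex at a time.
Avoiding : Colouring n m → List (Fin m) → List (Fin n) → Set
Avoiding χ js l = Unique (map χ l) × All (_∉ᴸ js) (map χ l)

avoiding? : (χ : Colouring n m) (js : List (Fin m)) (l : List (Fin n)) → Dec (Avoiding χ js l)
avoiding? χ js l = unique? (map χ l) ×-dec All.all? (λ c → ¬? (c ∈ᴸ? js)) (map χ l)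

avoiding-∷ : (χ : Colouring n m) (js : List (Fin m)) (v : Fin n) (l : List (Fin n)) →
  𝟙 (avoiding? χ js (v ∷ l)) ≡ 𝟙 (¬? (χ v ∈ᴸ? js)) * 𝟙 (avoiding? χ (χ v ∷ js) l)
avoiding-∷ χ js v l = trans
  (𝟙-cong (avoiding? χ js (v ∷ l)) (¬? (χ v ∈ᴸ? js) ×-dec avoiding? χ (χ v ∷ js) l)
    (λ { (v≢ ∷ u , v∉ ∷ a) → v∉ , u , All.zipWith (λ { (x≢ , x∉) → λ { (here eq) → x≢ (sym eq) ; (there p) → x∉ p } }) (v≢ , a) })
    (λ { (v∉ , u , a) → All.map (λ x∉ eq → x∉ (here (sym eq))) a ∷ u , v∉ ∷ All.map (λ x∉ p → x∉ (there p)) a }))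
  (𝟙-× (¬? (χ v ∈ᴸ? js)) (avoiding? χ (χ v ∷ js) l))

-- Forbidden classes get size zero instead of being removed, which keeps the index set fixed while
-- colours accumulate.
partsOff : Colouring n m → List (Fin m) → Fin m → ℕ
partsOff χ js c = 𝟙 (¬? (c ∈ᴸ? js)) * part χ c

E-off : (s : Fin (suc m) → ℕ) (i : Fin (suc m)) → s i ≡ 0 → ∀ k → E s k ≡ E (s ∘ punchIn i) k
E-off s i eq zero    = refl
E-off s i eq (suc k) = trans (E-punchIn i s k)
  (trans (cong (λ x → E (s ∘ punchIn i) (suc k) + x * E (s ∘ punchIn i) k) eq) (+-identityʳ _))

partsOff-∷ : ∀ (χ : Colouring n (suc M)) js c k → E (partsOff χ (c ∷ js)) k ≡ E (partsOff χ js ∘ punchIn c) k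
partsOff-∷ χ js c k = trans
  (E-off (partsOff χ (c ∷ js)) c (cong (_* part χ c) (𝟙-no (¬? (c ∈ᴸ? (c ∷ js))) λ h → h (here refl))) k)
  (E-cong k λ j → cong (_* part χ (punchIn c j))
    (𝟙-cong (¬? (punchIn c j ∈ᴸ? (c ∷ js))) (¬? (punchIn c j ∈ᴸ? js))
      (λ h p → h (there p)) (λ { h (here eq) → Fin.punchInᵢ≢i c j eq ; h (there p) → h p })))

-- Fix the colour `c` of the first vertex: there are `part χ c` choices, and the rest must avoid `c`
-- as well. Summing over `c` gives the recursion `E-∑`.
count-avoiding : ∀ (χ : Colouring n (suc M)) k js → ∑ᴸ k (𝟙 ∘ avoiding? χ js) ≡ k ! * E (partsOff χ js) k
count-avoiding χ zero    js = 𝟙-yes (avoiding? χ js []) ([] , [])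
count-avoiding {n} χ (suc k) js = begin-equality
  ∑ (λ v → ∑ᴸ k λ l → 𝟙 (avoiding? χ js (v ∷ l)))
    ≡⟨ ∑-cong {n} (λ v → trans (∑ᴸ-cong k λ l _ → avoiding-∷ χ js v l) (∑ᴸ-* k (𝟙 (¬? (χ v ∈ᴸ? js))) (𝟙 ∘ avoiding? χ (χ v ∷ js)))) ⟩
  ∑ (λ v → 𝟙 (¬? (χ v ∈ᴸ? js)) * ∑ᴸ k (𝟙 ∘ avoiding? χ (χ v ∷ js)))
    ≡⟨ ∑-cong {n} (λ v → cong (𝟙 (¬? (χ v ∈ᴸ? js)) *_) (trans (count-avoiding χ k (χ v ∷ js)) (cong (k ! *_) (partsOff-∷ χ js (χ v) k)))) ⟩
  ∑ (H ∘ χ)                      ≡⟨ ∑-fibres χ H ⟩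
  ∑ (λ c → part χ c * H c)       ≡⟨ ∑-cong (λ c → rearrange (part χ c) (𝟙 (¬? (c ∈ᴸ? js))) (k !) (E (partsOff χ js ∘ punchIn c) k)) ⟩
  ∑ (λ c → k ! * (partsOff χ js c * E (partsOff χ js ∘ punchIn c) k)) ≡⟨ ∑-* (k !) (λ c → partsOff χ js c * E (partsOff χ js ∘ punchIn c) k) ⟩
  k ! * ∑ (λ c → partsOff χ js c * E (partsOff χ js ∘ punchIn c) k)   ≡⟨ cong (k ! *_) (sym (E-∑ (partsOff χ js) k)) ⟩
  k ! * (suc k * E (partsOff χ js) (suc k))                           ≡⟨ rearrange′ (k !) (suc k) _ ⟩
  suc k * k ! * E (partsOff χ js) (suc k) ∎
  where
  H : Fin _ → ℕ
  H c = 𝟙 (¬? (c ∈ᴸ? js)) * (k ! * E (partsOff χ js ∘ punchIn c) k)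
  rearrange : ∀ p i f e → p * (i * (f * e)) ≡ f * (i * p * e)
  rearrange = solve-∀
  rearrange′ : ∀ f k e → f * (k * e) ≡ k * f * e
  rearrange′ = solve-∀

Rainbow : Colouring n m → List (Fin n) → Set
Rainbow χ l = Unique (map χ l)

rainbow? : (χ : Colouring n m) (l : List (Fin n)) → Dec (Rainbow χ l)
rainbow? χ l = unique? (map χ l)

count-rainbow : ∀ (χ : Colouring n (suc M)) k → ∑ᴸ k (𝟙 ∘ rainbow? χ) ≡ k ! * E (part χ) k
count-rainbow χ k = trans
  (∑ᴸ-cong k λ l _ → 𝟙-cong (rainbow? χ l) (avoiding? χ [] l) (λ u → u , All.universal (λ _ ()) _) proj₁)
  (trans (count-avoiding χ k []) (cong (k ! *_) (E-cong k λ c → *-identityˡ (part χ c))))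

Link : Colouring n m → Fin m → List (Fin n) → Set
Link χ j l = Unique (j ∷ map χ l)

link? : (χ : Colouring n m) (j : Fin m) (l : List (Fin n)) → Dec (Link χ j l)
link? χ j l = unique? (j ∷ map χ l)

count-link : ∀ (χ : Colouring n (suc M)) k j → ∑ᴸ k (𝟙 ∘ link? χ j) ≡ k ! * E (part χ ∘ punchIn j) k
count-link χ k j = trans
  (∑ᴸ-cong k λ l _ → 𝟙-cong (link? χ j l) (avoiding? χ (j ∷ []) l)
    (λ { (j≢ ∷ u) → u , All.map (λ { x≢ (here eq) → x≢ (sym eq) ; x≢ (there ()) }) j≢ })
    (λ { (u , a) → All.map (λ x∉ eq → x∉ (here (sym eq))) a ∷ u }))
  (trans (count-avoiding χ k (j ∷ [])) (cong (k ! *_) (trans (partsOff-∷ χ [] j k) (E-cong k λ c → *-identityˡ (part χ (punchIn j c))))))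

Rainbow⇒Transversal : (χ : Colouring n m) (l : List (Fin n)) → Rainbow χ l → Transversal χ (setOf l)
Rainbow⇒Transversal χ l u x y x∈ y∈ eq = go l u (∈-setOf⁻ l x∈) (∈-setOf⁻ l y∈)
  where
  go : ∀ l → Rainbow χ l → x ∈ᴸ l → y ∈ᴸ l → x ≡ y
  go (w ∷ l) _        (here refl) (here refl) = refl
  go (w ∷ l) (w≢ ∷ _) (here refl) (there q)   = contradiction eq (All.lookup w≢ (∈-map⁺ χ q))
  go (w ∷ l) (w≢ ∷ _) (there p)   (here refl) = contradiction (sym eq) (All.lookup w≢ (∈-map⁺ χ p))
  go (w ∷ l) (_ ∷ u)  (there p)   (there q)   = go l u p q

Transversal⇒Rainbow : (χ : Colouring n m) (l : List (Fin n)) → Unique l → Transversal χ (setOf l) → Rainbow χ l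
Transversal⇒Rainbow χ []      _          t = []
Transversal⇒Rainbow χ (v ∷ l) u@(_ ∷ ul) t = All.map⁺ (All.tabulate λ {x} x∈ eq →
    Unique⇒∉ u (subst (_∈ᴸ l) (sym (t v x (∈-setOf⁺ {l = v ∷ l} (here refl)) (∈-setOf⁺ {l = v ∷ l} (there x∈)) eq)) x∈))
  ∷ Transversal⇒Rainbow χ l ul λ x y x∈ y∈ → t x y (x∈p∪q⁺ (inj₂ x∈)) (x∈p∪q⁺ (inj₂ y∈))

Rainbow⇒Unique : (χ : Colouring n m) (l : List (Fin n)) → Rainbow χ l → Unique l
Rainbow⇒Unique χ l u = Unique.map⁻ u

edge-completePartite⁺ : (χ : Colouring n m) {e : Subset n} → ∣ e ∣ ≡ r → Transversal χ e → Edge (completePartite r χ) e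
edge-completePartite⁺ {r = r} χ {e} eq t = fromWitness {a? = (∣ e ∣ ≟ r) ×-dec transversal? χ e} (eq , t)

edge-completePartite⁻ : (χ : Colouring n m) {e : Subset n} → Edge (completePartite r χ) e → Transversal χ e
edge-completePartite⁻ {r = r} χ {e} h = proj₂ (toWitness {a? = (∣ e ∣ ≟ r) ×-dec transversal? χ e} h)

D-completePartite : ∀ r (χ : Colouring n (suc M)) → D (completePartite r χ) ≡ r ! * E (part χ) r
D-completePartite r χ = trans
  (∑ᴸ-cong r λ l len → 𝟙-cong (edge? (completePartite r χ) (setOf l)) (rainbow? χ l)
    (λ h → Transversal⇒Rainbow χ l (edge⇒Unique (completePartite r χ) l len h) (edge-completePartite⁻ χ h))
    (λ u → edge-completePartite⁺ χ (trans (Unique⇒∣setOf∣ (Rainbow⇒Unique χ l u)) len) (Rainbow⇒Transversal χ l u)))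
  (count-rainbow χ r)

residue : ∀ n M → Colouring n (suc M)
residue n M i = toℕ i mod suc M

∑-toℕ : ∀ n (h : ℕ → ℕ) → ∑ (λ (i : Fin (suc n)) → h (toℕ i)) ≡ h n + ∑ (λ (i : Fin n) → h (toℕ i))
∑-toℕ zero    h = refl
∑-toℕ (suc n) h = trans (cong (h 0 +_) (∑-toℕ n (h ∘ suc))) (rearrange (h 0) (h (suc n)) _)
  where
  rearrange : ∀ a b c → a + (b + c) ≡ b + (a + c)
  rearrange = solve-∀

part-residue-suc : ∀ n M c → part (residue (suc n) M) c ≡ 𝟙 (n mod suc M Fin.≟ c) + part (residue n M) c
part-residue-suc n M c = ∑-toℕ n λ i → 𝟙 (i mod suc M Fin.≟ c)

part-residue : ∀ M q ρ → ρ ≤ suc M → ∀ c → part (residue (ρ + q * suc M) M) c ≡ 𝟙 (toℕ c <? ρ) + q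
part-residue M zero    zero _ c = refl
-- A full period of residues is the case `ρ = suc M` of the smaller quotient; this is why `ρ` is
-- allowed to reach `suc M`.
part-residue M (suc q) zero _ c = trans (part-residue M q (suc M) ≤-refl c) (cong (_+ q) (𝟙-yes (toℕ c <? suc M) (Fin.toℕ<n c)))
part-residue M q (suc ρ) ρ<m c = begin-equality
  part (residue (suc ρ + q * suc M) M) c
    ≡⟨ part-residue-suc (ρ + q * suc M) M c ⟩
  𝟙 ((ρ + q * suc M) mod suc M Fin.≟ c) + part (residue (ρ + q * suc M) M) c
    ≡⟨ cong (𝟙 ((ρ + q * suc M) mod suc M Fin.≟ c) +_) (part-residue M q ρ (<⇒≤ ρ<m) c) ⟩
  𝟙 ((ρ + q * suc M) mod suc M Fin.≟ c) + (𝟙 (toℕ c <? ρ) + q)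
    ≡⟨ sym (+-assoc (𝟙 ((ρ + q * suc M) mod suc M Fin.≟ c)) _ q) ⟩
  𝟙 ((ρ + q * suc M) mod suc M Fin.≟ c) + 𝟙 (toℕ c <? ρ) + q
    ≡⟨ cong (_+ q) step ⟩
  𝟙 (toℕ c <? suc ρ) + q ∎
  where
  mod≡ : toℕ ((ρ + q * suc M) mod suc M) ≡ ρ
  mod≡ = trans (Fin.toℕ-fromℕ< _) (trans ([m+kn]%n≡m%n ρ q (suc M)) (m<n⇒m%n≡m ρ<m))
  step : 𝟙 ((ρ + q * suc M) mod suc M Fin.≟ c) + 𝟙 (toℕ c <? ρ) ≡ 𝟙 (toℕ c <? suc ρ)
  step with <-cmp (toℕ c) ρ
  ... | tri< lt ≢ _ = trans (cong₂ _+_ (𝟙-no (_ Fin.≟ c) λ eq → ≢ (trans (cong toℕ (sym eq)) mod≡)) (𝟙-yes (toℕ c <? ρ) lt))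
                            (sym (𝟙-yes (toℕ c <? suc ρ) (m<n⇒m<1+n lt)))
  ... | tri≈ ≮ eq _ = trans (cong₂ _+_ (𝟙-yes (_ Fin.≟ c) (Fin.toℕ-injective (trans mod≡ (sym eq)))) (𝟙-no (toℕ c <? ρ) ≮))
                            (sym (𝟙-yes (toℕ c <? suc ρ) (s≤s (≤-reflexive eq))))
  ... | tri> _ ≢ gt = trans (cong₂ _+_ (𝟙-no (_ Fin.≟ c) λ eq → ≢ (trans (cong toℕ (sym eq)) mod≡)) (𝟙-no (toℕ c <? ρ) (<⇒≯ gt)))
                            (sym (𝟙-no (toℕ c <? suc ρ) (≤⇒≯ gt)))

part-residue-bounds : ∀ n M c → n / suc M ≤ part (residue n M) c × part (residue n M) c ≤ suc (n / suc M)
part-residue-bounds n M c = subst (λ x → n / suc M ≤ x × x ≤ suc (n / suc M)) (sym eq)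
  (m≤n+m _ _ , +-monoˡ-≤ (n / suc M) (𝟙≤1 (toℕ c <? n % suc M)))
  where
  eq : part (residue n M) c ≡ 𝟙 (toℕ c <? n % suc M) + n / suc M
  eq = trans (cong (λ x → part (residue x M) c) (m≡m%n+[m/n]*n n (suc M)))
             (part-residue M (n / suc M) (n % suc M) (<⇒≤ (m%n<n n (suc M))) c)

E-part≤turán : (χ : Colouring n (suc M)) → ∀ k → E (part χ) k ≤ E (part (residue n M)) k
E-part≤turán {n} {M} χ = E-balanced-max (part χ) (part (residue n M)) (part-residue-bounds n M)
  (≤-reflexive (trans (∑-part χ) (sym (∑-part (residue n M)))))

-- The new vertex joins class `n mod suc M`; its links are the rainbow lists in the other classes,
-- each of size at least `n / suc M`. The minimum degree will be compared with this increment.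
D-turán-suc : ∀ n M d → D (turánGraph (suc d) n (suc M)) + suc d * (d ! * (M C d) * (n / suc M) ^ d)
  ≤ D (turánGraph (suc d) (suc n) (suc M))
D-turán-suc n M d = begin
  D (turánGraph (suc d) n (suc M)) + suc d * (d ! * (M C d) * q ^ d)
    ≡⟨ cong₂ _+_ (D-completePartite (suc d) (residue n M)) (rearrange (suc d) (d !) (M C d) (q ^ d)) ⟩
  suc d ! * E s (suc d) + suc d ! * ((M C d) * q ^ d)
    ≤⟨ +-monoʳ-≤ _ (*-monoʳ-≤ (suc d !) (E-lower d (s ∘ punchIn c) λ i → proj₁ (part-residue-bounds n M (punchIn c i)))) ⟩
  suc d ! * E s (suc d) + suc d ! * E (s ∘ punchIn c) d
    ≡⟨ sym (*-distribˡ-+ (suc d !) (E s (suc d)) _) ⟩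
  suc d ! * (E s (suc d) + E (s ∘ punchIn c) d)
    ≡⟨ cong (suc d ! *_) (sym E-suc) ⟩
  suc d ! * E t (suc d)
    ≡⟨ sym (D-completePartite (suc d) (residue (suc n) M)) ⟩
  D (turánGraph (suc d) (suc n) (suc M)) ∎
  where
  q = n / suc M
  c = n mod suc M
  s = part (residue n M)
  t = part (residue (suc n) M)
  rearrange : ∀ a b x y → a * (b * x * y) ≡ a * b * (x * y)
  rearrange = solve-∀
  t≡s : ∀ i → t (punchIn c i) ≡ s (punchIn c i)
  t≡s i = trans (part-residue-suc n M (punchIn c i))
    (cong (_+ s (punchIn c i)) (𝟙-no (c Fin.≟ punchIn c i) (Fin.punchInᵢ≢i c i ∘ sym)))
  E-suc : E t (suc d) ≡ E s (suc d) + E (s ∘ punchIn c) d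
  E-suc = begin-equality
    E t (suc d) ≡⟨ E-punchIn c t d ⟩
    E (t ∘ punchIn c) (suc d) + t c * E (t ∘ punchIn c) d
      ≡⟨ cong₂ (λ x y → x + t c * y) (E-cong (suc d) t≡s) (E-cong d t≡s) ⟩
    E (s ∘ punchIn c) (suc d) + t c * E (s ∘ punchIn c) d
      ≡⟨ cong (λ x → E (s ∘ punchIn c) (suc d) + x * E (s ∘ punchIn c) d)
           (trans (part-residue-suc n M c) (cong (_+ s c) (𝟙-yes (c Fin.≟ c) refl))) ⟩
    E (s ∘ punchIn c) (suc d) + (1 + s c) * E (s ∘ punchIn c) d
      ≡⟨ rearrange′ (E (s ∘ punchIn c) (suc d)) (s c) _ ⟩
    E (s ∘ punchIn c) (suc d) + s c * E (s ∘ punchIn c) d + E (s ∘ punchIn c) d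
      ≡⟨ cong (_+ E (s ∘ punchIn c) d) (sym (E-punchIn c s d)) ⟩
    E s (suc d) + E (s ∘ punchIn c) d ∎
    where
    rearrange′ : ∀ a b c → a + (1 + b) * c ≡ a + b * c + c
    rearrange′ = solve-∀

D≤turán : (G : RGraph r n) (χ : Colouring n (suc M)) →
  (∀ l → length l ≡ r → Edge G (setOf l) → Rainbow χ l) → D G ≤ D (turánGraph r n (suc M))
D≤turán {r} {n} {M} G χ h = begin
  D G                           ≤⟨ ∑ᴸ-mono r (λ l len → 𝟙-mono (edge? G (setOf l)) (rainbow? χ l) (h l len)) ⟩
  ∑ᴸ r (𝟙 ∘ rainbow? χ)         ≡⟨ count-rainbow χ r ⟩
  r ! * E (part χ) r            ≤⟨ *-monoʳ-≤ (r !) (E-part≤turán χ r) ⟩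
  r ! * E (part (residue n M)) r ≡⟨ sym (D-completePartite r (residue n M)) ⟩
  D (turánGraph r n (suc M))    ∎

-- Copies of the extension

lookup-injective : {A : Set} {xs : List A} → Unique xs → ∀ i j → List.lookup xs i ≡ List.lookup xs j → i ≡ j
lookup-injective {xs = x ∷ xs} _        zero    zero    eq = refl
lookup-injective {xs = x ∷ xs} (x≢ ∷ _) zero    (suc j) eq = contradiction eq (All.lookup x≢ (∈-lookup j))
lookup-injective {xs = x ∷ xs} (x≢ ∷ _) (suc i) zero    eq = contradiction (sym eq) (All.lookup x≢ (∈-lookup i))
lookup-injective {xs = x ∷ xs} (_ ∷ u)  (suc i) (suc j) eq = cong suc (lookup-injective u i j eq)

module _ (es : List (Subset n)) {e : Subset n} where

  open DecMembership (_≟ˢ_ {n}) using () renaming (_∈?_ to _∈ˢ?_)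

  edge-fromList⁻ : T (isYes (e ∈ˢ? es)) → e ∈ᴸ es
  edge-fromList⁻ = toWitness {a? = e ∈ˢ? es}

  edge-fromList⁺ : e ∈ᴸ es → T (isYes (e ∈ˢ? es))
  edge-fromList⁺ = fromWitness {a? = e ∈ˢ? es}

∈-subsets : (e : Subset n) → e ∈ᴸ subsets n
∈-subsets []          = here refl
∈-subsets (true ∷ e)  = ∈-++⁺ˡ (∈-map⁺ (true ∷_) (∈-subsets e))
∈-subsets (false ∷ e) = ∈-++⁺ʳ (map (true ∷_) (subsets _)) (∈-map⁺ (false ∷_) (∈-subsets e))

∈-edges⁺ : (G : RGraph r n) {e : Subset n} → Edge G e → e ∈ᴸ edges G
∈-edges⁺ G h = ∈-filter⁺ (λ e → Bool.T? (edgeᵇ G e)) (∈-subsets _) h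

∈-edges⁻ : (G : RGraph r n) {e : Subset n} → e ∈ᴸ edges G → Edge G e
∈-edges⁻ {n = n} G h = proj₂ (∈-filter⁻ (λ e → Bool.T? (edgeᵇ G e)) {xs = subsets n} h)

∈-++⁺ˡ′ : ∀ {q} {e : Subset m} (e′ : Subset q) {i} → i ∈ e → i ↑ˡ q ∈ e Vec.++ e′
∈-++⁺ˡ′ {q = q} {e} e′ {i} h = Vec.lookup⇒[]= (i ↑ˡ q) _ (trans (Vec.lookup-++ˡ e e′ i) (Vec.[]=⇒lookup h))

∈-++⁻ˡ : ∀ {q} (e : Subset m) (e′ : Subset q) {i} → i ↑ˡ q ∈ e Vec.++ e′ → i ∈ e
∈-++⁻ˡ e e′ {i} h = Vec.lookup⇒[]= i _ (trans (sym (Vec.lookup-++ˡ e e′ i)) (Vec.[]=⇒lookup h))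

∈-++⁺ʳ′ : ∀ {q} (e : Subset m) {e′ : Subset q} {i} → i ∈ e′ → m ↑ʳ i ∈ e Vec.++ e′
∈-++⁺ʳ′ {m} e {e′} {i} h = Vec.lookup⇒[]= (m ↑ʳ i) _ (trans (Vec.lookup-++ʳ e e′ i) (Vec.[]=⇒lookup h))

∈-++⁻ʳ : ∀ {q} (e : Subset m) (e′ : Subset q) {i} → m ↑ʳ i ∈ e Vec.++ e′ → i ∈ e′
∈-++⁻ʳ e e′ {i} h = Vec.lookup⇒[]= i _ (trans (sym (Vec.lookup-++ʳ e e′ i)) (Vec.[]=⇒lookup h))

lookup-block : ∀ (c c′ : Fin k) s (t : Fin s) → Vec.lookup (block c s) (combine c′ t) ≡ Vec.lookup ⁅ c ⁆ c′
lookup-block c c′ s t = trans (Vec.lookup-concat (Vec.map (Vec.replicate s) ⁅ c ⁆) c′ t)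
  (trans (cong (λ xs → Vec.lookup xs t) (Vec.lookup-map c′ (Vec.replicate s) ⁅ c ⁆)) (Vec.lookup-replicate t _))

∈-block⁺ : ∀ (c : Fin k) s (t : Fin s) → combine c t ∈ block c s
∈-block⁺ c s t = Vec.lookup⇒[]= (combine c t) _ (trans (lookup-block c c s t) (Vec.[]=⇒lookup (x∈⁅x⁆ c)))

∈-block⁻ : ∀ (c c′ : Fin k) s (t : Fin s) → combine c′ t ∈ block c s → c′ ≡ c
∈-block⁻ c c′ s t h = x∈⁅y⁆⇒x≡y c
  (Vec.lookup⇒[]= c′ _ (trans (sym (lookup-block c c′ s t)) (Vec.[]=⇒lookup h)))

module _ {r p : ℕ} (F : RGraph r p) where

  #pairs : ℕ
  #pairs = length (uncoveredPairs F)

  pairˡ pairʳ : Fin #pairs → Fin p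
  pairˡ c = proj₁ (List.lookup (uncoveredPairs F) c)
  pairʳ c = proj₂ (List.lookup (uncoveredPairs F) c)

  pair-uncovered : ∀ c → pairˡ c Fin.< pairʳ c × ¬ Covered F (pairˡ c) (pairʳ c)
  pair-uncovered c = proj₂ (∈-filter⁻ (uncoveredPair? F) {xs = cartesianProduct (allFin p) (allFin p)}
    (∈-lookup {xs = uncoveredPairs F} c))

  pair-injective : ∀ c c′ → pairˡ c ≡ pairˡ c′ → pairʳ c ≡ pairʳ c′ → c ≡ c′
  pair-injective c c′ eqˡ eqʳ = lookup-injective
    (Unique.filter⁺ (uncoveredPair? F) (Unique.cartesianProduct⁺ (Unique.allFin⁺ p) (Unique.allFin⁺ p)))
    c c′ (cong₂ _,_ eqˡ eqʳ)

  find-pair : ∀ {i j} → i Fin.< j → ¬ Covered F i j → ∃[ c ] pairˡ c ≡ i × pairʳ c ≡ j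
  find-pair {i} {j} i<j ¬cov = Any.index ij∈ , cong proj₁ (sym eq) , cong proj₂ (sym eq)
    where
    ij∈ : (i , j) ∈ᴸ uncoveredPairs F
    ij∈ = ∈-filter⁺ (uncoveredPair? F) (∈-cartesianProduct⁺ (∈-allFin i) (∈-allFin j)) (i<j , ¬cov)
    eq : (i , j) ≡ List.lookup (uncoveredPairs F) (Any.index ij∈)
    eq = lookup-index ij∈

  Ext : (2≤r : 2 ≤ r) → RGraph r (p + #pairs * (r ∸ 2))
  Ext 2≤r = extendCovering 2≤r F

  pairEdge : Fin #pairs → Subset (p + #pairs * (r ∸ 2))
  pairEdge c = (⁅ pairˡ c ⁆ ∪ ⁅ pairʳ c ⁆) Vec.++ block c (r ∸ 2)

  Ext-edge⁻ : ∀ 2≤r {e} → Edge (Ext 2≤r) e → (∃[ e₀ ] Edge F e₀ × e ≡ e₀ Vec.++ ⊥) ⊎ (∃[ c ] e ≡ pairEdge c)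
  Ext-edge⁻ 2≤r h with ∈-++⁻ (map (Vec._++ ⊥) (edges F)) (edge-fromList⁻ _ h)
  ... | inj₁ q = let e₀ , e₀∈ , eq = ∈-map⁻ (Vec._++ ⊥) q in inj₁ (e₀ , ∈-edges⁻ F e₀∈ , eq)
  ... | inj₂ q = inj₂ (∈-tabulate⁻ q)

  Ext-core-edge : ∀ 2≤r {e} → Edge F e → Edge (Ext 2≤r) (e Vec.++ ⊥)
  Ext-core-edge 2≤r h = edge-fromList⁺ _ (∈-++⁺ˡ (∈-map⁺ (Vec._++ ⊥) (∈-edges⁺ F h)))

  Ext-pair-edge : ∀ 2≤r c → Edge (Ext 2≤r) (pairEdge c)
  Ext-pair-edge 2≤r c = edge-fromList⁺ _ (∈-++⁺ʳ (map (Vec._++ ⊥) (edges F)) (∈-tabulate⁺ c))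

  Ext-covered : ∀ 2≤r {i j} → i Fin.< j → Covered (Ext 2≤r) (i ↑ˡ (#pairs * (r ∸ 2))) (j ↑ˡ (#pairs * (r ∸ 2)))
  Ext-covered 2≤r {i} {j} i<j with covered? F i j
  ... | yes (e , h , i∈ , j∈) = e Vec.++ ⊥ , Ext-core-edge 2≤r h , ∈-++⁺ˡ′ ⊥ i∈ , ∈-++⁺ˡ′ ⊥ j∈
  ... | no ¬cov with find-pair i<j ¬cov
  ...   | c , refl , refl = pairEdge c , Ext-pair-edge 2≤r c
    , ∈-++⁺ˡ′ (block c (r ∸ 2)) (x∈p∪q⁺ (inj₁ (x∈⁅x⁆ _)))
    , ∈-++⁺ˡ′ (block c (r ∸ 2)) (x∈p∪q⁺ (inj₂ (x∈⁅x⁆ _)))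

  -- Any two of the `p` core vertices are covered in the extension, but by pigeonhole two of them
  -- fall into the same part, and no edge contains both.
  partite-Ext-free : ∀ {2≤r} (χ : Colouring n m) → m < p → Free (Ext 2≤r) (completePartite r χ)
  partite-Ext-free {2≤r = 2≤r} χ m<p c with Fin.pigeonhole m<p (λ u → χ (embed c (u ↑ˡ (#pairs * (r ∸ 2)))))
  ... | i , j , i<j , eq with Ext-covered 2≤r i<j
  ...   | e , h , i∈ , j∈ = Fin.<⇒≢ i<j (Fin.↑ˡ-injective _ i j (injective c
    (edge-completePartite⁻ χ (preserves c h) _ _ (∈-image⁺ (embed c) i∈) (∈-image⁺ (embed c) j∈) eq)))

  module _ (2≤r : 2 ≤ r) (G : RGraph r n) (y : Fin p → Fin n) (b : Fin #pairs → Fin (r ∸ 2) → Fin n)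
    (y-inj : Injective _≡_ _≡_ y)
    (b-inj : ∀ {c t c′ t′} → b c t ≡ b c′ t′ → c ≡ c′ × t ≡ t′)
    (y≢b : ∀ (u : Fin p) (c : Fin #pairs) (t : Fin (r ∸ 2)) → y u ≢ b c t)
    (core : ∀ {e} → Edge F e → Edge G (image y e))
    (cover : ∀ c → Edge G (setOf (y (pairˡ c) ∷ y (pairʳ c) ∷ List.tabulate (b c))))
    where

    private
      s = r ∸ 2

      place : Fin p ⊎ Fin (#pairs * s) → Fin n
      place (inj₁ u) = y u
      place (inj₂ w) = b (proj₁ (remQuot {#pairs} s w)) (proj₂ (remQuot {#pairs} s w))

      emb : Fin (p + #pairs * s) → Fin n
      emb u = place (splitAt p u)

      emb-ˡ : ∀ u → emb (u ↑ˡ (#pairs * s)) ≡ y u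
      emb-ˡ u = cong place (Fin.splitAt-↑ˡ p u _)

      emb-ʳ : ∀ (c : Fin #pairs) (t : Fin s) → emb (p ↑ʳ combine c t) ≡ b c t
      emb-ʳ c t = trans (cong place (Fin.splitAt-↑ʳ p _ (combine c t)))
        (cong (λ ct → b (proj₁ ct) (proj₂ ct)) (Fin.remQuot-combine {#pairs} c t))

      -- The vertex set is a sum whose second summand is a product, coded as one `Fin`; the view
      -- recovers core vertices and the `t`-th vertex of the `c`-th block for case analysis.
      data View : Fin (p + #pairs * s) → Set where
        left  : ∀ (u : Fin p) → View (u ↑ˡ (#pairs * s))
        right : ∀ (c : Fin #pairs) (t : Fin s) → View (p ↑ʳ combine c t)

      view : ∀ u → View u
      view u with splitAt p u in eq
      ... | inj₁ u′ = subst View (Fin.splitAt⁻¹-↑ˡ eq) (left u′)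
      ... | inj₂ w  = subst View (trans (cong (p ↑ʳ_) (Fin.combine-remQuot {#pairs} s w)) (Fin.splitAt⁻¹-↑ʳ eq))
                        (right (proj₁ (remQuot {#pairs} s w)) (proj₂ (remQuot {#pairs} s w)))

      emb-inj : ∀ {u w} → View u → View w → emb u ≡ emb w → u ≡ w
      emb-inj (left u)    (left w)      eq = cong (_↑ˡ (#pairs * s)) (y-inj (trans (sym (emb-ˡ u)) (trans eq (emb-ˡ w))))
      emb-inj (left u)    (right c t)   eq = contradiction (trans (sym (emb-ˡ u)) (trans eq (emb-ʳ c t))) (y≢b u c t)
      emb-inj (right c t) (left w)      eq = contradiction (trans (sym (emb-ˡ w)) (trans (sym eq) (emb-ʳ c t))) (y≢b w c t)
      emb-inj (right c t) (right c′ t′) eq with b-inj (trans (sym (emb-ʳ c t)) (trans eq (emb-ʳ c′ t′)))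
      ... | refl , refl = refl

      image-core : ∀ e → image emb (e Vec.++ ⊥) ≡ image y e
      image-core e = ext fwd bwd
        where
        fwd′ : ∀ {u} → View u → u ∈ e Vec.++ ⊥ → emb u ∈ image y e
        fwd′ (left u)    h = subst (_∈ image y e) (sym (emb-ˡ u)) (∈-image⁺ y (∈-++⁻ˡ e ⊥ h))
        fwd′ (right c t) h = contradiction (∈-++⁻ʳ e ⊥ h) ∉⊥
        fwd : ∀ {w} → w ∈ image emb (e Vec.++ ⊥) → w ∈ image y e
        fwd h with ∈-image⁻ emb h
        ... | u , u∈ , refl = fwd′ (view u) u∈
        bwd : ∀ {w} → w ∈ image y e → w ∈ image emb (e Vec.++ ⊥)
        bwd h with ∈-image⁻ y h
        ... | u , u∈ , refl = subst (_∈ image emb (e Vec.++ ⊥)) (emb-ˡ u) (∈-image⁺ emb (∈-++⁺ˡ′ ⊥ u∈))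

      image-pair : ∀ c → image emb (pairEdge c) ≡ setOf (y (pairˡ c) ∷ y (pairʳ c) ∷ List.tabulate (b c))
      image-pair c = ext fwd bwd
        where
        target = y (pairˡ c) ∷ y (pairʳ c) ∷ List.tabulate (b c)
        fwd′ : ∀ {u} → View u → u ∈ pairEdge c → emb u ∈ᴸ target
        fwd′ (left u) h with x∈p∪q⁻ ⁅ pairˡ c ⁆ ⁅ pairʳ c ⁆ (∈-++⁻ˡ _ (block c s) h)
        ... | inj₁ q = here (trans (emb-ˡ u) (cong y (x∈⁅y⁆⇒x≡y _ q)))
        ... | inj₂ q = there (here (trans (emb-ˡ u) (cong y (x∈⁅y⁆⇒x≡y _ q))))
        fwd′ (right c′ t) h with ∈-block⁻ c c′ s t (∈-++⁻ʳ (⁅ pairˡ c ⁆ ∪ ⁅ pairʳ c ⁆) (block c s) h)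
        ... | refl = there (there (subst (_∈ᴸ List.tabulate (b c)) (sym (emb-ʳ c t)) (∈-tabulate⁺ t)))
        fwd : ∀ {w} → w ∈ image emb (pairEdge c) → w ∈ setOf target
        fwd h with ∈-image⁻ emb h
        ... | u , u∈ , refl = ∈-setOf⁺ (fwd′ (view u) u∈)
        bwd′ : ∀ {w} → w ∈ᴸ target → w ∈ image emb (pairEdge c)
        bwd′ (here refl)         = subst (_∈ image emb (pairEdge c)) (emb-ˡ _)
          (∈-image⁺ emb (∈-++⁺ˡ′ (block c s) (x∈p∪q⁺ (inj₁ (x∈⁅x⁆ _)))))
        bwd′ (there (here refl)) = subst (_∈ image emb (pairEdge c)) (emb-ˡ _)
          (∈-image⁺ emb (∈-++⁺ˡ′ (block c s) (x∈p∪q⁺ (inj₂ (x∈⁅x⁆ _)))))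
        bwd′ (there (there h)) with ∈-tabulate⁻ h
        ... | t , refl = subst (_∈ image emb (pairEdge c)) (emb-ʳ c t)
          (∈-image⁺ emb (∈-++⁺ʳ′ (⁅ pairˡ c ⁆ ∪ ⁅ pairʳ c ⁆) (∈-block⁺ c s t)))
        bwd : ∀ {w} → w ∈ setOf target → w ∈ image emb (pairEdge c)
        bwd h = bwd′ (∈-setOf⁻ target h)

    Ext-copy : Copy (Ext 2≤r) G
    Ext-copy = record
      { embed     = emb
      ; injective = λ {u} {w} → emb-inj (view u) (view w)
      ; preserves = λ h → [ (λ { (e₀ , h₀ , refl) → subst (Edge G) (sym (image-core e₀)) (core h₀) })
                          , (λ { (c , refl) → subst (Edge G) (sym (image-pair c)) (cover c) }) ]′ (Ext-edge⁻ 2≤r h)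
      }

setOf-cong : (xs ys : List (Fin n)) → (∀ {v} → v ∈ᴸ xs → v ∈ᴸ ys) → (∀ {v} → v ∈ᴸ ys → v ∈ᴸ xs) → setOf xs ≡ setOf ys
setOf-cong xs ys f g = ext (∈-setOf⁺ ∘ f ∘ ∈-setOf⁻ xs) (∈-setOf⁺ ∘ g ∘ ∈-setOf⁻ ys)

lookup-cast-∈ : {A : Set} (l : List A) {s : ℕ} (eq : length l ≡ s) {x : A} → x ∈ᴸ l →
  ∃[ t ] List.lookup l (cast (sym eq) t) ≡ x
lookup-cast-∈ l refl x∈ = Any.index x∈ , trans (cong (List.lookup l) (Fin.cast-is-id refl _)) (sym (lookup-index x∈))

module _ {r p : ℕ} (F : RGraph r p) (2≤r : 2 ≤ r) (G : RGraph r n) (y : Fin p → Fin n) (L : Fin (#pairs F) → List (Fin n))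
  (y-inj : Injective _≡_ _≡_ y)
  (len : ∀ c → length (L c) ≡ r ∸ 2)
  (core : ∀ {e} → Edge F e → Edge G (image y e))
  (cover : ∀ c → Edge G (setOf (y (pairˡ F c) ∷ y (pairʳ F c) ∷ L c)))
  (y∉L : ∀ u c → y u ∉ᴸ L c)
  (L-disjoint : ∀ {c c′} → c ≢ c′ → ∀ {w} → w ∈ᴸ L c → w ∉ᴸ L c′)
  where

  private
    b : Fin (#pairs F) → Fin (r ∸ 2) → Fin n
    b c t = List.lookup (L c) (cast (sym (len c)) t)

    b∈ : ∀ c t → b c t ∈ᴸ L c
    b∈ c t = ∈-lookup _

    -- An edge has `r` elements, so a list of `r` vertices spanning it cannot repeat one.
    L-unique : ∀ c → Unique (L c)
    L-unique c with edge⇒Unique G (y (pairˡ F c) ∷ y (pairʳ F c) ∷ L c) (trans (cong (2 +_) (len c)) (m+[n∸m]≡n 2≤r)) (cover c)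
    ... | _ ∷ _ ∷ u = u

    b-inj : ∀ {c t c′ t′} → b c t ≡ b c′ t′ → c ≡ c′ × t ≡ t′
    b-inj {c} {t} {c′} {t′} eq with c Fin.≟ c′
    ... | yes refl = refl , Fin.toℕ-injective (trans (sym (Fin.toℕ-cast (sym (len c)) t))
                       (trans (cong toℕ (lookup-injective (L-unique c) _ _ eq)) (Fin.toℕ-cast (sym (len c)) t′)))
    ... | no c≢c′  = contradiction (subst (_∈ᴸ L c′) (sym eq) (b∈ c′ t′)) (L-disjoint c≢c′ (b∈ c t))

  Ext-copy-lists : Copy (Ext F 2≤r) G
  Ext-copy-lists = Ext-copy F 2≤r G y b y-inj b-inj (λ u c t eq → y∉L u c (subst (_∈ᴸ L c) (sym eq) (b∈ c t))) core
    λ c → subst (Edge G) (setOf-cong _ _ (fwd c) (bwd c)) (cover c)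
    where
    fwd : ∀ c {v} → v ∈ᴸ y (pairˡ F c) ∷ y (pairʳ F c) ∷ L c → v ∈ᴸ y (pairˡ F c) ∷ y (pairʳ F c) ∷ List.tabulate (b c)
    fwd c (here eq)         = here eq
    fwd c (there (here eq)) = there (here eq)
    fwd c (there (there h)) with lookup-cast-∈ (L c) (len c) h
    ... | t , refl = there (there (∈-tabulate⁺ t))
    bwd : ∀ c {v} → v ∈ᴸ y (pairˡ F c) ∷ y (pairʳ F c) ∷ List.tabulate (b c) → v ∈ᴸ y (pairˡ F c) ∷ y (pairʳ F c) ∷ L c
    bwd c (here eq)         = here eq
    bwd c (there (here eq)) = there (here eq)
    bwd c (there (there h)) with ∈-tabulate⁻ h
    ... | t , refl = there (there (b∈ c t))

∈-pad⁻ : ∀ {p} (v≤p : v ≤ p) (e : Subset v) {u} → u ∈ padRight v≤p outside e → ∃[ u₀ ] u₀ ∈ e × inject≤ u₀ v≤p ≡ u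
∈-pad⁻ z≤n       []      h              = contradiction h ∉⊥
∈-pad⁻ (s≤s v≤p) (x ∷ e) Vec.here       = zero , Vec.here , refl
∈-pad⁻ (s≤s v≤p) (x ∷ e) (Vec.there h) with ∈-pad⁻ v≤p e h
... | u₀ , u₀∈ , eq = suc u₀ , Vec.there u₀∈ , cong suc eq

∈-pad⁺ : ∀ {p} (v≤p : v ≤ p) {e : Subset v} {u} → u ∈ e → inject≤ u v≤p ∈ padRight v≤p outside e
∈-pad⁺ (s≤s v≤p) Vec.here      = Vec.here
∈-pad⁺ (s≤s v≤p) (Vec.there h) = Vec.there (∈-pad⁺ v≤p h)

module _ {p : ℕ} (v≤p : v ≤ p) (F : RGraph r v) where

  addIsolated-edge⁻ : ∀ {e} → Edge (addIsolated v≤p F) e → ∃[ e₀ ] Edge F e₀ × e ≡ padRight v≤p outside e₀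
  addIsolated-edge⁻ h with ∈-map⁻ (padRight v≤p outside) (edge-fromList⁻ _ h)
  ... | e₀ , e₀∈ , eq = e₀ , ∈-edges⁻ F e₀∈ , eq

  addIsolated-edge⁺ : ∀ {e} → Edge F e → Edge (addIsolated v≤p F) (padRight v≤p outside e)
  addIsolated-edge⁺ h = edge-fromList⁺ _ (∈-map⁺ (padRight v≤p outside) (∈-edges⁺ F h))

length-filter-split : {A : Set} {P : A → Set} (P? : ∀ x → Dec (P x)) (xs : List A) →
  length xs ≡ length (filter P? xs) + length (filter (¬? ∘ P?) xs)
length-filter-split P? []       = refl
length-filter-split P? (x ∷ xs) with P? x
... | yes _ = cong suc (length-filter-split P? xs)
... | no  _ = trans (cong suc (length-filter-split P? xs)) (sym (+-suc _ _))

Unique-⊆-length : (xs ys : List (Fin n)) → Unique xs → (∀ {v} → v ∈ᴸ xs → v ∈ᴸ ys) → length xs ≤ length ys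
Unique-⊆-length xs ys u sub = begin
  length xs    ≡⟨ sym (Unique⇒∣setOf∣ u) ⟩
  ∣ setOf xs ∣ ≤⟨ p⊆q⇒∣p∣≤∣q∣ (λ h → ∈-setOf⁺ (sub (∈-setOf⁻ xs h))) ⟩
  ∣ setOf ys ∣ ≤⟨ ∣setOf∣≤ ys ⟩
  length ys    ∎

-- An injection of Fin v into S extends to one of all of Fin ∣S∣.
module _ {p : ℕ} (v≤p : v ≤ p) (f : Fin v → Fin n) (f-inj : Injective _≡_ _≡_ f)
  (S : Subset n) (f∈ : ∀ u → f u ∈ S) (∣S∣ : ∣ S ∣ ≡ p) where

  private
    img : List (Fin n)
    img = map f (allFin v)

    rest : List (Fin n)
    rest = filter (λ w → ¬? (w ∈ᴸ? img)) (elements S)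

    rest-unique : Unique rest
    rest-unique = Unique.filter⁺ (λ w → ¬? (w ∈ᴸ? img)) (elements-unique S)

    p≤ : p ≤ v + length rest
    p≤ = begin
      p                       ≡⟨ sym (trans (length-elements S) ∣S∣) ⟩
      length (elements S)     ≡⟨ length-filter-split (_∈ᴸ? img) (elements S) ⟩
      length (filter (_∈ᴸ? img) (elements S)) + length rest
        ≤⟨ +-monoˡ-≤ (length rest) (Unique-⊆-length _ img (Unique.filter⁺ (_∈ᴸ? img) (elements-unique S))
             λ h → proj₂ (∈-filter⁻ (_∈ᴸ? img) {xs = elements S} h)) ⟩
      length img + length rest ≡⟨ cong (_+ length rest) (trans (length-map f (allFin v)) (length-tabulate id)) ⟩
      v + length rest ∎

    ∸<rest : ∀ (i : Fin p) → ¬ (toℕ i < v) → toℕ i ∸ v < length rest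
    ∸<rest i i≮v = +-cancelˡ-< v _ _ (begin-strict
      v + (toℕ i ∸ v) ≡⟨ m+[n∸m]≡n (≮⇒≥ i≮v) ⟩
      toℕ i           <⟨ Fin.toℕ<n i ⟩
      p               ≤⟨ p≤ ⟩
      v + length rest ∎)

    go : (i : Fin p) → Dec (toℕ i < v) → Fin n
    go i (yes i<v) = f (fromℕ< i<v)
    go i (no i≮v)  = List.lookup rest (fromℕ< (∸<rest i i≮v))

    go-img : ∀ i i<v → go i (yes i<v) ∈ᴸ img
    go-img i i<v = ∈-map⁺ f (∈-allFin _)

    go-rest : ∀ i i≮v → go i (no i≮v) ∉ᴸ img
    go-rest i i≮v = proj₂ (∈-filter⁻ (λ w → ¬? (w ∈ᴸ? img)) {xs = elements S} (∈-lookup _))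

    go-inj : ∀ i j di dj → go i di ≡ go j dj → i ≡ j
    go-inj i j (yes a) (yes b) eq = Fin.toℕ-injective
      (trans (sym (Fin.toℕ-fromℕ< a)) (trans (cong toℕ (f-inj eq)) (Fin.toℕ-fromℕ< b)))
    go-inj i j (yes a) (no b)  eq = contradiction (subst (_∈ᴸ img) eq (go-img i a)) (go-rest j b)
    go-inj i j (no a)  (yes b) eq = contradiction (subst (_∈ᴸ img) (sym eq) (go-img j b)) (go-rest i a)
    go-inj i j (no a)  (no b)  eq = Fin.toℕ-injective (∸-cancelʳ-≡ (≮⇒≥ a) (≮⇒≥ b)
      (trans (sym (Fin.toℕ-fromℕ< (∸<rest i a))) (trans (cong toℕ (lookup-injective rest-unique _ _ eq)) (Fin.toℕ-fromℕ< (∸<rest j b)))))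

    go∈ : ∀ i d → go i d ∈ S
    go∈ i (yes a) = f∈ _
    go∈ i (no a)  = ∈-elements⁻ S (proj₁ (∈-filter⁻ (λ w → ¬? (w ∈ᴸ? img)) {xs = elements S} (∈-lookup _)))

    go-inject : ∀ u d → go (inject≤ u v≤p) d ≡ f u
    go-inject u (yes a) = cong f (Fin.toℕ-injective (trans (Fin.toℕ-fromℕ< a) (Fin.toℕ-inject≤ u v≤p)))
    go-inject u (no a)  = contradiction (subst (_< v) (sym (Fin.toℕ-inject≤ u v≤p)) (Fin.toℕ<n u)) a

  extend : Fin p → Fin n
  extend i = go i (toℕ i <? v)

  extend-injective : Injective _≡_ _≡_ extend
  extend-injective {i} {j} = go-inj i j (toℕ i <? v) (toℕ j <? v)

  extend∈ : ∀ i → extend i ∈ S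
  extend∈ i = go∈ i (toℕ i <? v)

  extend-inject≤ : ∀ u → extend (inject≤ u v≤p) ≡ f u
  extend-inject≤ u = go-inject u (toℕ (inject≤ u v≤p) <? v)

-- Of a copy of a member of the family only the core and the fact that its pairs are covered are
-- kept; the covering edges are forgotten, because `Core⇒Copy` chooses new ones.
record Core {p} (F : RGraph r p) (G : RGraph r n) : Set where
  field
    vertex    : Fin p → Fin n
    injective : Injective _≡_ _≡_ vertex
    preserves : ∀ {e} → Edge F e → Edge G (image vertex e)
    covered   : ∀ {i j} → i ≢ j → Covered G (vertex i) (vertex j)

-- The copy of `F` labels only `v` of the `p` core vertices; the remaining ones take the places of
-- the isolated vertices in some order.
InK⇒Core : ∀ {p h} (v≤p : v ≤ p) (F : RGraph r v) {H : RGraph r h} {G : RGraph r n} →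
  InK F p H → Copy H G → Core (addIsolated v≤p F) G
InK⇒Core v≤p F {H} {G} (S , ∣S∣ , (c , c∈) , cov) φ = record
  { vertex    = embed φ ∘ y
  ; injective = extend-injective v≤p (embed c) (injective c) S c∈ ∣S∣ ∘ injective φ
  ; preserves = edge
  ; covered   = λ {i} {j} i≢j →
      let e , h , i∈ , j∈ = cov (y i) (y j) (extend∈ v≤p (embed c) (injective c) S c∈ ∣S∣ i)
                              (extend∈ v≤p (embed c) (injective c) S c∈ ∣S∣ j)
                              (i≢j ∘ extend-injective v≤p (embed c) (injective c) S c∈ ∣S∣)
      in image (embed φ) e , preserves φ h , ∈-image⁺ (embed φ) i∈ , ∈-image⁺ (embed φ) j∈
  }
  where
  y = extend v≤p (embed c) (injective c) S c∈ ∣S∣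
  edge : ∀ {e} → Edge (addIsolated v≤p F) e → Edge G (image (embed φ ∘ y) e)
  edge h with addIsolated-edge⁻ v≤p F h
  ... | e₀ , h₀ , refl = subst (Edge G) (trans (cong (image (embed φ)) (sym image≡)) (image-∘ (embed φ) y _)) (preserves φ (preserves c h₀))
    where
    image≡ : image y (padRight v≤p outside e₀) ≡ image (embed c) e₀
    image≡ = ext fwd bwd
      where
      fwd : ∀ {w} → w ∈ image y (padRight v≤p outside e₀) → w ∈ image (embed c) e₀
      fwd h with ∈-image⁻ y h
      ... | u , u∈ , refl with ∈-pad⁻ v≤p e₀ u∈
      ...   | u₀ , u₀∈ , refl = subst (_∈ image (embed c) e₀) (sym (extend-inject≤ v≤p (embed c) (injective c) S c∈ ∣S∣ u₀)) (∈-image⁺ (embed c) u₀∈)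
      bwd : ∀ {w} → w ∈ image (embed c) e₀ → w ∈ image y (padRight v≤p outside e₀)
      bwd h with ∈-image⁻ (embed c) h
      ... | u₀ , u₀∈ , refl = subst (_∈ image y (padRight v≤p outside e₀)) (extend-inject≤ v≤p (embed c) (injective c) S c∈ ∣S∣ u₀) (∈-image⁺ y (∈-pad⁺ v≤p u₀∈))

-- Removing the pairs of small codegree

∑-mono-< : {f g : Fin n → ℕ} → (∀ i → f i ≤ g i) → ∀ j → f j < g j → ∑ f < ∑ g
∑-mono-< {suc n} h zero    lt = +-mono-<-≤ lt (∑-mono (h ∘ suc))
∑-mono-< {suc n} h (suc j) lt = +-mono-≤-< (h zero) (∑-mono-< (h ∘ suc) j lt)

term≤∑ᴸ : ∀ (l : List (Fin n)) (f : List (Fin n) → ℕ) → f l ≤ ∑ᴸ (length l) f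
term≤∑ᴸ []      f = ≤-refl
term≤∑ᴸ (v ∷ l) f = ≤-trans (term≤∑ᴸ l (f ∘ (v ∷_))) (term≤∑ (λ v → ∑ᴸ (length l) (f ∘ (v ∷_))) v)

Meets : List (Fin n) → List (Fin n) → Set
Meets W l = Any.Any (_∈ᴸ l) W

meets? : (W l : List (Fin n)) → Dec (Meets W l)
meets? W l = Any.any? (_∈ᴸ? l) W

count-∋ : ∀ k (w : Fin n) → ∑ᴸ k (λ l → 𝟙 (w ∈ᴸ? l)) ≤ k * n ^ (k ∸ 1)
count-∋ {n} k w = begin
  ∑ᴸ k (λ l → 𝟙 (w ∈ᴸ? l))     ≡⟨ ∑ᴸ-cong k (λ l _ → sym (*-identityʳ (𝟙 (w ∈ᴸ? l)))) ⟩
  ∑ᴸ k (λ l → 𝟙 (w ∈ᴸ? l) * 1) ≤⟨ ∑ᴸ-∋ k w (λ _ → 1) (λ _ → refl) ⟩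
  k * ∑ᴸ {n} (k ∸ 1) (λ _ → 1) ≡⟨ cong (k *_) (trans (∑ᴸ-const {n} (k ∸ 1) 1) (*-identityʳ _)) ⟩
  k * n ^ (k ∸ 1)              ∎

count-meets : ∀ k (W : List (Fin n)) → ∑ᴸ k (λ l → 𝟙 (meets? W l)) ≤ length W * (k * n ^ (k ∸ 1))
count-meets {n} k []      = ≤-reflexive (∑ᴸ-0 {n} k)
count-meets {n} k (w ∷ W) = begin
  ∑ᴸ k (λ l → 𝟙 (meets? (w ∷ W) l))
    ≤⟨ ∑ᴸ-mono k (λ l _ → 𝟙-⊎ (meets? (w ∷ W) l) (w ∈ᴸ? l) (meets? W l) λ { (here p) → inj₁ p ; (there p) → inj₂ p }) ⟩
  ∑ᴸ k (λ l → 𝟙 (w ∈ᴸ? l) + 𝟙 (meets? W l))   ≡⟨ ∑ᴸ-+ k (λ l → 𝟙 (w ∈ᴸ? l)) (λ l → 𝟙 (meets? W l)) ⟩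
  ∑ᴸ k (λ l → 𝟙 (w ∈ᴸ? l)) + ∑ᴸ k (λ l → 𝟙 (meets? W l)) ≤⟨ +-mono-≤ (count-∋ k w) (count-meets k W) ⟩
  k * n ^ (k ∸ 1) + length W * (k * n ^ (k ∸ 1)) ∎

split-pair : ∀ {t} {e : Subset n} {u w} → u ∈ e → w ∈ e → u ≢ w → ∣ e ∣ ≡ 2 + t →
  ∃[ l ] length l ≡ t × setOf (u ∷ w ∷ l) ≡ e
split-pair {t = t} {e} {u} {w} u∈ w∈ u≢w eq = elements ((e - u) - w) , len , set≡
  where
  w∈′ : w ∈ e - u
  w∈′ = x∈p∧x≢y⇒x∈p-y w∈ (u≢w ∘ sym)
  len : length (elements ((e - u) - w)) ≡ t
  len = trans (length-elements ((e - u) - w)) (ℕ.suc-injective (ℕ.suc-injective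
    (trans (cong suc (∣e-v∣ {v = w} {e - u} w∈′)) (trans (∣e-v∣ u∈) eq))))
  set≡ : setOf (u ∷ w ∷ elements ((e - u) - w)) ≡ e
  set≡ = trans (cong (λ s → ⁅ u ⁆ ∪ (⁅ w ⁆ ∪ s)) (setOf-elements _))
    (trans (cong (⁅ u ⁆ ∪_) (⁅v⁆∪[e-v]≡e w∈′)) (⁅v⁆∪[e-v]≡e u∈))

Disjoint : List (Fin n) → List (Fin n) → Set
Disjoint xs ys = ∀ {w} → w ∈ᴸ xs → w ∉ᴸ ys

-- Each chosen block is added to `W`; the budget `B` covers everything to be avoided up to the last
-- block.
greedy : ∀ {t B} K (Ok : Fin K → List (Fin n) → Set) →
  (∀ c W → length W ≤ B → ∃[ l ] length l ≡ t × Ok c l × Disjoint l W) →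
  ∀ W → length W + K * t ≤ B →
  Σ[ L ∈ (Fin K → List (Fin n)) ] (∀ c → length (L c) ≡ t × Ok c (L c) × Disjoint (L c) W)
    × (∀ {c c′} → c ≢ c′ → Disjoint (L c) (L c′))
greedy zero    Ok h W le = (λ ()) , (λ ()) , λ {}
greedy {n} {t} {B} (suc K) Ok h W le
  with h zero W (≤-trans (m≤m+n _ _) le)
... | l , len , ok , dis
  with greedy K (Ok ∘ suc) (h ∘ suc) (l ++ W) (begin
         length (l ++ W) + K * t       ≡⟨ cong (_+ K * t) (trans (length-++ l) (+-comm (length l) _)) ⟩
         length W + length l + K * t   ≡⟨ cong (λ x → length W + x + K * t) len ⟩
         length W + t + K * t          ≡⟨ +-assoc (length W) t _ ⟩
         length W + (t + K * t)        ≤⟨ le ⟩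
         B ∎)
... | L , good , disL = L′ , good′ , disL′
  where
  L′ : Fin (suc K) → List (Fin n)
  L′ zero    = l
  L′ (suc c) = L c
  good′ : ∀ c → length (L′ c) ≡ t × Ok c (L′ c) × Disjoint (L′ c) W
  good′ zero    = len , ok , dis
  good′ (suc c) = let x , y , z = good c in x , y , λ p q → z p (∈-++⁺ʳ l q)
  disL′ : ∀ {c c′} → c ≢ c′ → Disjoint (L′ c) (L′ c′)
  disL′ {zero}  {zero}   c≢ = contradiction refl c≢
  disL′ {zero}  {suc c′} c≢ p q = proj₂ (proj₂ (good c′)) q (∈-++⁺ˡ p)
  disL′ {suc c} {zero}   c≢ p q = proj₂ (proj₂ (good c)) p (∈-++⁺ˡ q)
  disL′ {suc c} {suc c′} c≢ = disL (c≢ ∘ cong suc)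

module _ {t : ℕ} where

  codegree : RGraph (2 + t) n → Fin n → Fin n → ℕ
  codegree G u w = ∑ᴸ t λ l → [ G ]ᴱ (u ∷ w ∷ l)

  covered⇒codegree : (G : RGraph (2 + t) n) {u w : Fin n} → u ≢ w → Covered G u w → 0 < codegree G u w
  covered⇒codegree G {u} {w} u≢w (e , h , u∈ , w∈) with split-pair u∈ w∈ u≢w (uniform G h)
  ... | l , refl , refl = ≤-trans (≤-reflexive (sym (𝟙-yes (edge? G (setOf (u ∷ w ∷ l))) h)))
                                  (term≤∑ᴸ l λ l → [ G ]ᴱ (u ∷ w ∷ l))

  Clean : ℕ → RGraph (2 + t) n → Set
  Clean T G = ∀ u w → 0 < codegree G u w → T < codegree G u w

  private
    Cover : ∀ {p} (F : RGraph (2 + t) p) (G : RGraph (2 + t) n) → (Fin p → Fin n) → Fin (#pairs F) → List (Fin n) → Set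
    Cover F G y c l = Edge G (setOf (y (pairˡ F c) ∷ y (pairʳ F c) ∷ l))

  -- At most `length W * (t * n ^ (t ∸ 1))` lists meet `W`, so a larger codegree leaves a list that
  -- avoids it.
  avoiding-edge : (G : RGraph (2 + t) n) (u w : Fin n) (W : List (Fin n)) → length W * (t * n ^ (t ∸ 1)) < codegree G u w →
    ∃[ l ] length l ≡ t × Edge G (setOf (u ∷ w ∷ l)) × Disjoint l W
  avoiding-edge G u w W lt =
    let l , len , lt′ = ∑ᴸ-find t {λ l → 𝟙 (meets? W l)} {λ l → [ G ]ᴱ (u ∷ w ∷ l)} (≤-<-trans (count-meets t W) lt)
    in l , len , 0<𝟙⇒ (edge? G _) (≤-<-trans z≤n lt′)
     , λ w∈l w∈W → <⇒≱ lt′ (≤-trans (𝟙≤1 (edge? G _)) (≤-reflexive (sym (𝟙-yes (meets? W l) (Any.map (λ { refl → w∈l }) w∈W)))))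

  -- The threshold is the number `p + #pairs F * t` of vertices of the extension times a bound for
  -- the lists through one vertex: whatever has been placed so far, a covered pair still lies in an
  -- edge whose other vertices are new.
  Core⇒Copy : ∀ {p} (F : RGraph (2 + t) p) (2≤r : 2 ≤ 2 + t) (G : RGraph (2 + t) n) →
    Clean ((p + #pairs F * t) * (t * n ^ (t ∸ 1))) G → Core F G → Copy (Ext F 2≤r) G
  Core⇒Copy {n} {p} F 2≤r G clean core = Ext-copy-lists F 2≤r G y (proj₁ blocks) (Core.injective core)
    (λ c → proj₁ (proj₁ (proj₂ blocks) c)) (Core.preserves core)
    (λ c → proj₁ (proj₂ (proj₁ (proj₂ blocks) c)))
    (λ u c h → proj₂ (proj₂ (proj₁ (proj₂ blocks) c)) h (∈-map⁺ y (∈-allFin u)))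
    (proj₂ (proj₂ blocks))
    where
    y = Core.vertex core
    find : ∀ c W → length W ≤ p + #pairs F * t → ∃[ l ] length l ≡ t × Cover F G y c l × Disjoint l W
    find c W le = avoiding-edge G (y (pairˡ F c)) (y (pairʳ F c)) W
      (≤-<-trans (*-monoˡ-≤ _ le) (clean _ _ (covered⇒codegree G (y≢ ∘ Core.injective core) (Core.covered core y≢))))
      where
      y≢ : pairˡ F c ≢ pairʳ F c
      y≢ = Fin.<⇒≢ (proj₁ (pair-uncovered F c))
    blocks : Σ[ L ∈ (Fin (#pairs F) → List (Fin n)) ]
      (∀ c → length (L c) ≡ t × Cover F G y c (L c) × Disjoint (L c) (map y (allFin p)))
      × (∀ {c c′} → c ≢ c′ → Disjoint (L c) (L c′))
    blocks = greedy (#pairs F) (Cover F G y) find (map y (allFin p))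
      (≤-reflexive (cong (_+ #pairs F * t) (trans (length-map y (allFin p)) (length-tabulate id))))

  removePair : RGraph (2 + t) n → Fin n → Fin n → RGraph (2 + t) n
  removePair G u w = record
    { edgeᵇ   = λ e → edgeᵇ G e Bool.∧ isYes (¬? (u ∈? e ×-dec w ∈? e))
    ; uniform = λ h → uniform G (proj₁ (Bool.T-∧ .Equivalence.to h))
    }

  removePair⁻ : (G : RGraph (2 + t) n) (u w : Fin n) {e : Subset n} → Edge (removePair G u w) e → Edge G e × ¬ (u ∈ e × w ∈ e)
  removePair⁻ G u w {e} h = let a , b = Bool.T-∧ .Equivalence.to h in a , toWitness {a? = ¬? (u ∈? e ×-dec w ∈? e)} b

  removePair⁺ : (G : RGraph (2 + t) n) (u w : Fin n) {e : Subset n} → Edge G e → ¬ (u ∈ e × w ∈ e) → Edge (removePair G u w) e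
  removePair⁺ G u w {e} h k = Bool.T-∧ .Equivalence.from (h , fromWitness {a? = ¬? (u ∈? e ×-dec w ∈? e)} k)

  -- The two factors count the positions of `u` and of `w` in the orderings of an edge through both.
  D-removePair : (G : RGraph (2 + t) n) {u w : Fin n} → u ≢ w →
    D G ≤ D (removePair G u w) + (2 + t) * ((1 + t) * codegree G u w)
  D-removePair {n} G {u} {w} u≢w = begin
    ∑ᴸ (2 + t) [ G ]ᴱ
      ≤⟨ ∑ᴸ-mono (2 + t) (λ l _ → term l) ⟩
    ∑ᴸ (2 + t) (λ l → [ G′ ]ᴱ l + 𝟙 (u ∈ᴸ? l) * f l)
      ≡⟨ ∑ᴸ-+ (2 + t) [ G′ ]ᴱ (λ l → 𝟙 (u ∈ᴸ? l) * f l) ⟩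
    D G′ + ∑ᴸ (2 + t) (λ l → 𝟙 (u ∈ᴸ? l) * f l)
      ≤⟨ +-monoʳ-≤ (D G′) (∑ᴸ-∋ (2 + t) u f f-sym) ⟩
    D G′ + (2 + t) * ∑ᴸ (1 + t) (f ∘ (u ∷_))
      ≤⟨ +-monoʳ-≤ (D G′) (*-monoʳ-≤ (2 + t) (begin
         ∑ᴸ (1 + t) (λ l → 𝟙 (w ∈ᴸ? (u ∷ l)) * [ G ]ᴱ (u ∷ l))
           ≤⟨ ∑ᴸ-mono (1 + t) (λ l _ → *-monoˡ-≤ ([ G ]ᴱ (u ∷ l)) (𝟙-mono (w ∈ᴸ? (u ∷ l)) (w ∈ᴸ? l)
                λ { (here eq) → contradiction (sym eq) u≢w ; (there p) → p })) ⟩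
         ∑ᴸ (1 + t) (λ l → 𝟙 (w ∈ᴸ? l) * [ G ]ᴱ (u ∷ l))
           ≤⟨ ∑ᴸ-∋ (1 + t) w ([ G ]ᴱ ∘ (u ∷_)) ([]ᴱ-sym G ∘ prep u) ⟩
         (1 + t) * codegree G u w ∎)) ⟩
    D G′ + (2 + t) * ((1 + t) * codegree G u w) ∎
    where
    G′ = removePair G u w
    f : List (Fin n) → ℕ
    f l = 𝟙 (w ∈ᴸ? l) * [ G ]ᴱ l
    f-sym : Symmetric f
    f-sym {xs} {ys} p = cong₂ _*_ (𝟙-cong (w ∈ᴸ? xs) (w ∈ᴸ? ys) (∈-resp-↭ p) (∈-resp-↭ (Perm.↭-sym p))) ([]ᴱ-sym G p)
    case : ∀ l {A B : Set} (a : Dec A) (b : Dec B) → (¬ (A × B) → ¬ (u ∈ setOf l × w ∈ setOf l)) →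
      [ G ]ᴱ l ≤ [ G′ ]ᴱ l + 𝟙 a * (𝟙 b * [ G ]ᴱ l)
    case l (yes a) (yes b) h = ≤-trans (≤-reflexive (sym (trans (*-identityˡ _) (*-identityˡ _)))) (m≤n+m _ ([ G′ ]ᴱ l))
    case l (yes a) (no ¬b) h = ≤-trans (𝟙-mono (edge? G (setOf l)) (edge? G′ (setOf l)) λ e → removePair⁺ G u w e (h (¬b ∘ proj₂))) (m≤m+n _ _)
    case l (no ¬a) b       h = ≤-trans (𝟙-mono (edge? G (setOf l)) (edge? G′ (setOf l)) λ e → removePair⁺ G u w e (h (¬a ∘ proj₁))) (m≤m+n _ _)
    term : ∀ l → [ G ]ᴱ l ≤ [ G′ ]ᴱ l + 𝟙 (u ∈ᴸ? l) * f l
    term l = case l (u ∈ᴸ? l) (w ∈ᴸ? l) λ h (p , q) → h (∈-setOf⁻ l p , ∈-setOf⁻ l q)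

  _⊑_ : RGraph (2 + t) n → RGraph (2 + t) n → Set
  G′ ⊑ G = ∀ {e} → Edge G′ e → Edge G e

  codegree-mono : {G′ G : RGraph (2 + t) n} → G′ ⊑ G → ∀ u w → codegree G′ u w ≤ codegree G u w
  codegree-mono {G′ = G′} {G} sub u w = ∑ᴸ-mono t λ l _ → 𝟙-mono (edge? G′ _) (edge? G _) sub

  codegree-removePair : (G : RGraph (2 + t) n) (u w : Fin n) → codegree (removePair G u w) u w ≡ 0
  codegree-removePair {n} G u w = trans
    (∑ᴸ-cong t λ l _ → 𝟙-no (edge? (removePair G u w) _) λ h → proj₂ (removePair⁻ G u w h)
      (∈-setOf⁺ {l = u ∷ w ∷ l} (here refl) , ∈-setOf⁺ {l = u ∷ w ∷ l} (there (here refl))))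
    (∑ᴸ-0 {n} t)

  #covered : RGraph (2 + t) n → ℕ
  #covered G = ∑ λ u → ∑ λ w → 𝟙 (0 <? codegree G u w)

  -- Removing a light pair uncovers it and covers no new pair, so `#covered` falls. The bound `N`
  -- serves both for termination and as the number of removals in the loss.
  clean : ∀ T N (G : RGraph (2 + t) n) → #covered G ≤ N →
    Σ[ G′ ∈ RGraph (2 + t) n ] G′ ⊑ G × Clean T G′ × D G ≤ D G′ + N * ((2 + t) * ((1 + t) * T))
  clean T N G le with Fin.any? (λ u → Fin.any? (λ w → (0 <? codegree G u w) ×-dec (codegree G u w ≤? T)))
  ... | no ¬light = G , id , (λ u w pos → ≰⇒> λ le → ¬light (u , w , pos , le)) , m≤m+n _ _
  ... | yes (u , w , pos , light) = go N le
    where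
    G₁ = removePair G u w
    u≢w : u ≢ w
    u≢w refl = <⇒≢ pos (sym (trans (∑ᴸ-cong t λ l len → 𝟙-no (edge? G _) λ h →
      Unique⇒∉ (edge⇒Unique G (u ∷ u ∷ l) (cong (2 +_) len) h) (here refl)) (∑ᴸ-0 {_} t)))
    mono : ∀ u′ w′ → 𝟙 (0 <? codegree G₁ u′ w′) ≤ 𝟙 (0 <? codegree G u′ w′)
    mono u′ w′ = 𝟙-mono (0 <? codegree G₁ u′ w′) (0 <? codegree G u′ w′)
      λ lt → <-≤-trans lt (codegree-mono {G′ = G₁} {G} (proj₁ ∘ removePair⁻ G u w) u′ w′)
    fewer : #covered G₁ < #covered G
    fewer = ∑-mono-< (λ u′ → ∑-mono (mono u′)) u (∑-mono-< (mono u) w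
      (subst₂ _<_ (sym (𝟙-no (0 <? codegree G₁ u w) λ lt → <⇒≢ lt (sym (codegree-removePair G u w))))
                  (sym (𝟙-yes (0 <? codegree G u w) pos)) (s≤s z≤n)))
    go : ∀ N → #covered G ≤ N → Σ[ G′ ∈ RGraph (2 + t) _ ] G′ ⊑ G × Clean T G′ × D G ≤ D G′ + N * ((2 + t) * ((1 + t) * T))
    go zero    le = contradiction (<-≤-trans fewer le) λ ()
    go (suc N) le with clean T N G₁ (s≤s⁻¹ (<-≤-trans fewer le))
    ... | G′ , sub , cl , loss = G′ , proj₁ ∘ removePair⁻ G u w ∘ sub , cl , (begin
      D G                                          ≤⟨ D-removePair G u≢w ⟩
      D G₁ + (2 + t) * ((1 + t) * codegree G u w)  ≤⟨ +-mono-≤ loss (*-monoʳ-≤ (2 + t) (*-monoʳ-≤ (1 + t) light)) ⟩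
      D G′ + N * c + c                             ≡⟨ trans (+-assoc (D G′) _ c) (cong (D G′ +_) (+-comm (N * c) c)) ⟩
      D G′ + (c + N * c)                           ∎)
      where c = (2 + t) * ((1 + t) * T)

-- Random choices

-- Subsequences of all lengths enter the union bound, whereas being a missing edge or link concerns
-- one length; the value zero elsewhere makes the density hypothesis hold at every length.
onLength : ℕ → (List (Fin n) → ℕ) → List (Fin n) → ℕ
onLength s f l = 𝟙 (length l ≟ s) * f l

onLength≡0⇒ : ∀ {s} {f : List (Fin n) → ℕ} l → onLength s f l ≡ 0 → length l ≡ s → f l ≡ 0
onLength≡0⇒ {s = s} {f} l eq len = trans (sym (*-identityˡ _)) (trans (cong (_* f l) (sym (𝟙-yes (length l ≟ s) len))) eq)

∑ᴸ-onLength : ∀ s Q B (f : List (Fin n) → ℕ) → Q * ∑ᴸ s f ≤ B * n ^ s → ∀ s′ → Q * ∑ᴸ s′ (onLength s f) ≤ B * n ^ s′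
∑ᴸ-onLength {n} s Q B f h s′ with s′ ≟ s
... | yes refl = ≤-trans (*-monoʳ-≤ Q (∑ᴸ-mono s λ l _ → ≤-trans (*-monoˡ-≤ (f l) (𝟙≤1 (length l ≟ s))) (≤-reflexive (*-identityˡ _)))) h
... | no ≢s    = ≤-trans (≤-reflexive (trans (cong (Q *_) (trans
  (∑ᴸ-cong s′ λ l len → cong (_* f l) (𝟙-no (length l ≟ s) λ eq → ≢s (trans (sym len) eq))) (∑ᴸ-0 {n} s′))) (*-zeroʳ Q))) z≤n

∑ᴸ-bound-+ : ∀ Q A B (f g : List (Fin n) → ℕ) → (∀ s → Q * ∑ᴸ s f ≤ A * n ^ s) → (∀ s → Q * ∑ᴸ s g ≤ B * n ^ s) →
  ∀ s → Q * ∑ᴸ s (λ l → f l + g l) ≤ (A + B) * n ^ s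
∑ᴸ-bound-+ {n} Q A B f g hf hg s = begin
  Q * ∑ᴸ s (λ l → f l + g l)    ≡⟨ cong (Q *_) (∑ᴸ-+ s f g) ⟩
  Q * (∑ᴸ s f + ∑ᴸ s g)         ≡⟨ *-distribˡ-+ Q (∑ᴸ s f) _ ⟩
  Q * ∑ᴸ s f + Q * ∑ᴸ s g       ≤⟨ +-mono-≤ (hf s) (hg s) ⟩
  A * n ^ s + B * n ^ s         ≡⟨ sym (*-distribʳ-+ (n ^ s) A B) ⟩
  (A + B) * n ^ s               ∎

Unique-++⁻ : {A : Set} (xs : List A) {ys : List A} → Unique (xs ++ ys) →
  Unique xs × Unique ys × (∀ {w} → w ∈ᴸ xs → w ∉ᴸ ys)
Unique-++⁻ []       u        = [] , u , λ ()
Unique-++⁻ (x ∷ xs) (x≢ ∷ u) = let uxs , uys , dis = Unique-++⁻ xs u in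
  All.++⁻ˡ xs x≢ ∷ uxs , uys , λ { (here refl) q → All.lookup (All.++⁻ʳ xs x≢) q refl ; (there p) q → dis p q }

gather : ∀ {A : Set} B → (Fin B → List A) → List A
gather zero    L = []
gather (suc B) L = L zero ++ gather B (L ∘ suc)

∈-gather : ∀ {A : Set} B (L : Fin B → List A) i {v} → v ∈ᴸ L i → v ∈ᴸ gather B L
∈-gather (suc B) L zero    p = ∈-++⁺ˡ p
∈-gather (suc B) L (suc i) p = ∈-++⁺ʳ (L zero) (∈-gather B (L ∘ suc) i p)

Unique-gather⁻ : ∀ {A : Set} B (L : Fin B → List A) → Unique (gather B L) →
  (∀ i → Unique (L i)) × (∀ {i i′} → i ≢ i′ → ∀ {w} → w ∈ᴸ L i → w ∉ᴸ L i′)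
Unique-gather⁻ zero    L u = (λ ()) , λ {}
Unique-gather⁻ {A} (suc B) L u = uniq , dis
  where
  h = Unique-++⁻ (L zero) u
  t = Unique-gather⁻ B (L ∘ suc) (proj₁ (proj₂ h))
  uniq : ∀ i → Unique (L i)
  uniq zero    = proj₁ h
  uniq (suc i) = proj₁ t i
  dis : ∀ {i i′} → i ≢ i′ → ∀ {w} → w ∈ᴸ L i → w ∉ᴸ L i′
  dis {zero}  {zero}   i≢ p q = i≢ refl
  dis {zero}  {suc i′} i≢ p q = proj₂ (proj₂ h) p (∈-gather B (L ∘ suc) i′ q)
  dis {suc i} {zero}   i≢ p q = proj₂ (proj₂ h) q (∈-gather B (L ∘ suc) i p)
  dis {suc i} {suc i′} i≢ p q = proj₂ t (i≢ ∘ cong suc) p q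

Unique-fromPairs : (z : List (Fin n)) → (∀ {v w} → v ∷ w ∷ [] ⊆ z → v ≢ w) → Unique z
Unique-fromPairs []      h = []
Unique-fromPairs (v ∷ z) h = All.tabulate (λ w∈ → h (refl ∷ from∈ w∈)) ∷ Unique-fromPairs z (h ∘ (v ∷ʳ_))

-- Treats a repetition as a bad sublist of length 2, so that distinctness comes out of the same
-- union bound as the edges.
isDouble : List (Fin n) → ℕ
isDouble (v ∷ w ∷ []) = 𝟙 (v Fin.≟ w)
isDouble _            = 0

∑ᴸ-isDouble : ∀ {Q} → Q ≤ n → Q * ∑ᴸ {n} 2 isDouble ≤ 1 * n ^ 2
∑ᴸ-isDouble {n} {Q} Q≤n = begin
  Q * ∑ (λ (v : Fin n) → ∑ λ w → 𝟙 (v Fin.≟ w)) ≡⟨ cong (Q *_) (∑-cong {n} λ v →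
      trans (∑-cong {n} λ w → sym (*-identityʳ (𝟙 (v Fin.≟ w)))) (∑-𝟙≡ v λ _ → 1)) ⟩
  Q * ∑ (λ (v : Fin n) → 1)                     ≡⟨ cong (Q *_) (trans (∑-const n 1) (*-identityʳ n)) ⟩
  Q * n                                         ≤⟨ *-monoˡ-≤ n Q≤n ⟩
  n * n                                         ≡⟨ trans (cong (n *_) (sym (*-identityʳ n))) (sym (*-identityˡ _)) ⟩
  1 * n ^ 2                                     ∎

module _ {n : ℕ} where

  -- The sum of φ over all ways to choose the i-th block among the lists of length k i on which H i holds.
  ∑ᴮ : ∀ B (k : Fin B → ℕ) (H : Fin B → List (Fin n) → ℕ) → (List (Fin n) → ℕ) → ℕ
  ∑ᴮ zero    k H φ = φ []
  ∑ᴮ (suc B) k H φ = ∑ᴸ (k zero) λ l → H zero l * ∑ᴮ B (k ∘ suc) (H ∘ suc) (φ ∘ (l ++_))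

  -- The blocks are chosen independently, so their densities, each at least 1/c, multiply.
  ∑ᴮ-lower : ∀ c B k H → (∀ i → n ^ k i ≤ c * ∑ᴸ (k i) (H i)) → n ^ ∑ k ≤ c ^ B * ∑ᴮ B k H (λ _ → 1)
  ∑ᴮ-lower c zero    k H h = ≤-refl
  ∑ᴮ-lower c (suc B) k H h = begin
    n ^ (k zero + ∑ (k ∘ suc))               ≡⟨ ^-distribˡ-+-* n (k zero) _ ⟩
    n ^ k zero * n ^ ∑ (k ∘ suc)             ≤⟨ *-mono-≤ (h zero) (∑ᴮ-lower c B (k ∘ suc) (H ∘ suc) (h ∘ suc)) ⟩
    c * ∑ᴸ (k zero) (H zero) * (c ^ B * W)   ≡⟨ rearrange c (∑ᴸ (k zero) (H zero)) (c ^ B) W ⟩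
    c * c ^ B * (W * ∑ᴸ (k zero) (H zero))   ≡⟨ cong (c * c ^ B *_) (sym (∑ᴸ-* (k zero) W (H zero))) ⟩
    c * c ^ B * ∑ᴸ (k zero) (λ l → W * H zero l) ≡⟨ cong (c * c ^ B *_) (∑ᴸ-cong (k zero) λ l _ → *-comm W (H zero l)) ⟩
    c * c ^ B * ∑ᴸ (k zero) (λ l → H zero l * W) ∎
    where
    W = ∑ᴮ B (k ∘ suc) (H ∘ suc) (λ _ → 1)
    rearrange : ∀ c x y z → c * x * (y * z) ≡ c * y * (z * x)
    rearrange = solve-∀

  ∑ᴮ-upper : ∀ B k H → (∀ i l → H i l ≤ 1) → ∀ φ → ∑ᴮ B k H φ ≤ ∑ᴸ (∑ k) φ
  ∑ᴮ-upper zero    k H h φ = ≤-refl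
  ∑ᴮ-upper (suc B) k H h φ = begin
    ∑ᴸ (k zero) (λ l → H zero l * ∑ᴮ B (k ∘ suc) (H ∘ suc) (φ ∘ (l ++_)))
      ≤⟨ ∑ᴸ-mono (k zero) (λ l _ → ≤-trans (*-mono-≤ (h zero l) (∑ᴮ-upper B (k ∘ suc) (H ∘ suc) (h ∘ suc) (φ ∘ (l ++_)))) (≤-reflexive (*-identityˡ _))) ⟩
    ∑ᴸ (k zero) (λ l → ∑ᴸ (∑ (k ∘ suc)) (φ ∘ (l ++_)))
      ≡⟨ sym (∑ᴸ-++ (k zero) (∑ (k ∘ suc)) φ) ⟩
    ∑ᴸ (k zero + ∑ (k ∘ suc)) φ ∎

  ∑ᴮ-find : ∀ B k H φ → ∑ᴮ B k H φ < ∑ᴮ B k H (λ _ → 1) →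
    Σ[ L ∈ (Fin B → List (Fin n)) ] (∀ i → length (L i) ≡ k i × 0 < H i (L i)) × φ (gather B L) < 1
  ∑ᴮ-find zero    k H φ lt = (λ ()) , (λ ()) , lt
  ∑ᴮ-find (suc B) k H φ lt =
    let l , len , lt₁ = ∑ᴸ-find (k zero) {λ l → H zero l * ∑ᴮ B (k ∘ suc) (H ∘ suc) (φ ∘ (l ++_))}
                          {λ l → H zero l * ∑ᴮ B (k ∘ suc) (H ∘ suc) (λ _ → 1)} lt
        L , good , lt₂ = ∑ᴮ-find B (k ∘ suc) (H ∘ suc) (φ ∘ (l ++_)) (*-cancelˡ-< (H zero l) _ _ lt₁)
    in cons l L , (λ { zero → len , pos (H zero l) lt₁ ; (suc i) → good i }) , lt₂
    where
    cons : List (Fin n) → (Fin B → List (Fin n)) → Fin (suc B) → List (Fin n)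
    cons l L zero    = l
    cons l L (suc i) = L i
    pos : ∀ h {a b} → h * a < h * b → 0 < h
    pos (suc h) _ = s≤s z≤n

  -- First moment: a random choice of the blocks has H everywhere with probability at least 1/c^B,
  -- while the expected number of sublists on which f is positive is smaller than that.
  sample : ∀ B (k : Fin B → ℕ) (H : Fin B → List (Fin n) → ℕ) (f : List (Fin n) → ℕ) {c Q A : ℕ} →
    (∀ i l → H i l ≤ 1) → (∀ i → n ^ k i ≤ c * ∑ᴸ (k i) (H i)) → (∀ s → Q * ∑ᴸ s f ≤ A * n ^ s) →
    c ^ B * (2 ^ ∑ k * A) < Q → 0 < n →
    Σ[ L ∈ (Fin B → List (Fin n)) ] (∀ i → length (L i) ≡ k i × 0 < H i (L i))
      × (∀ {l} → l ⊆ gather B L → f l ≡ 0)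
  sample B k H f {c} {Q} {A} H≤1 H-many f-few Q-big 0<n =
    let L , good , lt = ∑ᴮ-find B k H (subSum f) (*-cancelˡ-< (Q * c ^ B) _ _ (begin-strict
          Q * c ^ B * ∑ᴮ B k H (subSum f)             ≤⟨ *-monoʳ-≤ (Q * c ^ B) (∑ᴮ-upper B k H H≤1 (subSum f)) ⟩
          Q * c ^ B * ∑ᴸ (∑ k) (subSum f)             ≡⟨ rearrange Q (c ^ B) _ ⟩
          c ^ B * (Q * ∑ᴸ (∑ k) (subSum f))           ≤⟨ *-monoʳ-≤ (c ^ B) (∑ᴸ-subSum (∑ k) f Q A f-few) ⟩
          c ^ B * (2 ^ ∑ k * (A * n ^ ∑ k))           ≡⟨ rearrange′ (c ^ B) (2 ^ ∑ k) A _ ⟩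
          c ^ B * (2 ^ ∑ k * A) * n ^ ∑ k             <⟨ *-monoˡ-< (n ^ ∑ k) {{m^n≢0 n (∑ k) {{>-nonZero 0<n}}}} Q-big ⟩
          Q * n ^ ∑ k                                 ≤⟨ *-monoʳ-≤ Q (∑ᴮ-lower c B k H H-many) ⟩
          Q * (c ^ B * ∑ᴮ B k H (λ _ → 1))            ≡⟨ sym (*-assoc Q (c ^ B) _) ⟩
          Q * c ^ B * ∑ᴮ B k H (λ _ → 1)              ∎))
    in L , good , subSum≡0 f (gather B L) (n<1⇒n≡0 lt)
    where
    rearrange : ∀ q c x → q * c * x ≡ c * (q * x)
    rearrange = solve-∀
    rearrange′ : ∀ c t a x → c * (t * (a * x)) ≡ c * (t * a) * x
    rearrange′ = solve-∀

  -- The union bound sees subsequences only in the order of `z`; statements about sets of vertices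
  -- are carried to any other order by this rearrangement.
  sorted-sublist : (z l : List (Fin n)) → Unique z → Unique l → (∀ {v} → v ∈ᴸ l → v ∈ᴸ z) →
    ∃[ l′ ] l′ ⊆ z × Unique l′ × setOf l′ ≡ setOf l × length l′ ≡ length l
  sorted-sublist z l uz ul sub = l′ , filter-⊆ (_∈ᴸ? l) z , ul′ , set≡ ,
    trans (sym (Unique⇒∣setOf∣ ul′)) (trans (cong ∣_∣ set≡) (Unique⇒∣setOf∣ ul))
    where
    l′ = filter (_∈ᴸ? l) z
    ul′ : Unique l′
    ul′ = Unique.filter⁺ (_∈ᴸ? l) uz
    set≡ : setOf l′ ≡ setOf l
    set≡ = setOf-cong l′ l (λ h → proj₂ (∈-filter⁻ (_∈ᴸ? l) {xs = z} h)) (λ h → ∈-filter⁺ (_∈ᴸ? l) (sub h) h)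

  -- Repetitions are one more kind of bad sublist: they add 1 to `A`, and `Q ≤ n` makes them rare
  -- enough. The conclusion speaks of a reordering `l′` because `f` is not assumed to be symmetric.
  sample-disjoint : ∀ B (k : Fin B → ℕ) (H : Fin B → List (Fin n) → ℕ) (f : List (Fin n) → ℕ) {c Q A : ℕ} →
    (∀ i l → H i l ≤ 1) → (∀ i → n ^ k i ≤ c * ∑ᴸ (k i) (H i)) → (∀ s → Q * ∑ᴸ s f ≤ A * n ^ s) →
    c ^ B * (2 ^ ∑ k * (1 + A)) < Q → Q ≤ n →
    Σ[ L ∈ (Fin B → List (Fin n)) ] (∀ i → length (L i) ≡ k i × 0 < H i (L i) × Unique (L i))
      × (∀ {i i′} → i ≢ i′ → Disjoint (L i) (L i′))
      × (∀ l → Unique l → (∀ {v} → v ∈ᴸ l → ∃[ i ] v ∈ᴸ L i) →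
           ∃[ l′ ] Unique l′ × setOf l′ ≡ setOf l × length l′ ≡ length l × f l′ ≡ 0)
  sample-disjoint B k H f {c} {Q} {A} H≤1 H-many f-few Q-big Q≤n =
    L , (λ i → proj₁ (good i) , proj₂ (good i) , proj₁ (Unique-gather⁻ B L uz) i) , proj₂ (Unique-gather⁻ B L uz)
      , λ l ul sub → let l′ , l′⊆ , ul′ , set≡ , len≡ = sorted-sublist (gather B L) l uz ul (λ h → let i , q = sub h in ∈-gather B L i q)
                     in l′ , ul′ , set≡ , len≡ , m+n≡0⇒n≡0 (onLength 2 isDouble l′) (zero≡ l′⊆)
    where
    s = sample B k H (λ l → onLength 2 isDouble l + f l) H≤1 H-many
          (∑ᴸ-bound-+ Q 1 A (onLength 2 isDouble) f (∑ᴸ-onLength 2 Q 1 isDouble (∑ᴸ-isDouble Q≤n)) f-few)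
          Q-big (<-≤-trans (≤-<-trans z≤n Q-big) Q≤n)
    L = proj₁ s
    good = proj₁ (proj₂ s)
    zero≡ = proj₂ (proj₂ s)
    uz : Unique (gather B L)
    uz = Unique-fromPairs (gather B L) λ {v} {w} h → 𝟙≡0⇒¬ (v Fin.≟ w)
      (onLength≡0⇒ {s = 2} {isDouble} (v ∷ w ∷ []) (m+n≡0⇒m≡0 _ (zero≡ h)) refl)

-- Matching core vertices with colours and assembling copies

transpose-injective : (a b : Fin n) → Injective _≡_ _≡_ (transpose a b)
transpose-injective a b eq = trans (sym (transpose-inverse b a)) (trans (cong (transpose b a) eq) (transpose-inverse b a))

transpose-a : (a b : Fin n) → transpose a b a ≡ b
transpose-a a b with a Fin.≟ a
... | yes _  = refl
... | no a≢a = contradiction refl a≢a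

transpose-other : (a b : Fin n) {c : Fin n} → c ≢ a → c ≢ b → transpose a b c ≡ c
transpose-other a b {c} c≢a c≢b with c Fin.≟ a
... | yes c≡a = contradiction c≡a c≢a
... | no  _ with c Fin.≟ b
...   | yes c≡b = contradiction c≡b c≢b
...   | no  _   = refl

map-transpose : (σ : Fin n → Fin m) → Injective _≡_ _≡_ σ → ∀ j c xs → All (j ≢_) xs → All (c ≢_) (map σ xs) →
  map (transpose (σ j) c ∘ σ) xs ≡ map σ xs
map-transpose σ inj j c []       []        []        = refl
map-transpose σ inj j c (x ∷ xs) (j≢ ∷ js) (c≢ ∷ cs) = cong₂ _∷_
  (transpose-other (σ j) c (j≢ ∘ sym ∘ inj) (c≢ ∘ sym)) (map-transpose σ inj j c xs js cs)

-- Extends a partial bijection to a permutation by transpositions. The one that sends `σ j` to `c`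
-- leaves the earlier pairs alone, since `c` is not in `cs` and `σ j` is not an image of `js`.
match : (js cs : List (Fin m)) → Unique js → Unique cs → length js ≡ length cs →
  Σ[ σ ∈ (Fin m → Fin m) ] Injective _≡_ _≡_ σ × map σ js ≡ cs
match []       []       _         _         _  = id , id , refl
match (j ∷ js) (c ∷ cs) (j≢ ∷ uj) (c≢ ∷ uc) eq =
  let σ , inj , σjs = match js cs uj uc (ℕ.suc-injective eq)
  in transpose (σ j) c ∘ σ , inj ∘ transpose-injective (σ j) c
   , cong₂ _∷_ (transpose-a (σ j) c) (trans (map-transpose σ inj j c js j≢ (subst (All (c ≢_)) (sym σjs) c≢)) σjs)

fresh : (xs : List (Fin m)) → length xs < m → ∃[ i ] i ∉ᴸ xs
fresh {m} xs lt with Fin.any? (λ i → ¬? (i ∈ᴸ? xs))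
... | yes h = h
... | no ¬h = contradiction (≤-trans (≤-reflexive (sym (length-tabulate {n = m} id)))
  (Unique-⊆-length (allFin m) xs (Unique.allFin⁺ m) (λ {i} _ → decidable-stable (i ∈ᴸ? xs) λ i∉ → ¬h (i , i∉)))) (<⇒≱ lt)

module _ {t m : ℕ} (2+t≤m : 2 + t ≤ m) (a b : Fin m) where

  private
    rest : List (Fin m)
    rest = filter (λ i → ¬? (i ∈ᴸ? (a ∷ b ∷ []))) (allFin m)

  -- The `t` further colours of an edge covering a pair of colours `a` and `b`.
  others : List (Fin m)
  others = take t rest

  length-others : length others ≡ t
  length-others = trans (length-take t rest) (m≤n⇒m⊓n≡m (s≤s⁻¹ (s≤s⁻¹ (begin
    2 + t              ≤⟨ 2+t≤m ⟩
    m                  ≡⟨ sym (length-tabulate {n = m} id) ⟩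
    length (allFin m)  ≤⟨ Unique-⊆-length (allFin m) (a ∷ b ∷ rest) (Unique.allFin⁺ m) (λ {i} _ → all∈ i (i ∈ᴸ? (a ∷ b ∷ []))) ⟩
    2 + length rest    ∎))))
    where
    all∈ : ∀ i → Dec (i ∈ᴸ a ∷ b ∷ []) → i ∈ᴸ a ∷ b ∷ rest
    all∈ i (yes p) = ∈-++⁺ˡ p
    all∈ i (no ¬p) = ∈-++⁺ʳ (a ∷ b ∷ []) (∈-filter⁺ (λ i → ¬? (i ∈ᴸ? (a ∷ b ∷ []))) (∈-allFin i) ¬p)

  others-unique : a ≢ b → Unique (a ∷ b ∷ others)
  others-unique a≢b = (a≢b ∷ All.map (λ ∉ab eq → ∉ab (here (sym eq))) avoid) ∷ All.map (λ ∉ab eq → ∉ab (there (here (sym eq)))) avoid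
    ∷ Unique.take⁺ t (Unique.filter⁺ (λ i → ¬? (i ∈ᴸ? (a ∷ b ∷ []))) (Unique.allFin⁺ m))
    where
    avoid : All (_∉ᴸ a ∷ b ∷ []) others
    avoid = All.take⁺ t (All.all-filter (λ i → ¬? (i ∈ᴸ? (a ∷ b ∷ []))) (allFin m))

-- What the arguments below use of the extension of F, abstracted from its explicit construction.
record Extends {t p h : ℕ} (F : RGraph (2 + t) p) (H : RGraph (2 + t) h) : Set where
  field
    #pairs′   : ℕ
    lhs rhs   : Fin #pairs′ → Fin p
    lhs<rhs   : ∀ c → lhs c Fin.< rhs c
    uncovered : ∀ c → ¬ Covered F (lhs c) (rhs c)
    pair-inj  : ∀ c c′ → lhs c ≡ lhs c′ → rhs c ≡ rhs c′ → c ≡ c′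
    build     : ∀ {n} (G : RGraph (2 + t) n) (y : Fin p → Fin n) (L : Fin #pairs′ → List (Fin n)) →
      Injective _≡_ _≡_ y → (∀ c → length (L c) ≡ t) → (∀ {e} → Edge F e → Edge G (image y e)) →
      (∀ c → Edge G (setOf (y (lhs c) ∷ y (rhs c) ∷ L c))) → (∀ u c → y u ∉ᴸ L c) →
      (∀ {c c′} → c ≢ c′ → Disjoint (L c) (L c′)) → Copy H G

Ext-extends : ∀ {t p} (F : RGraph (2 + t) p) (2≤r : 2 ≤ 2 + t) → Extends F (Ext F 2≤r)
Ext-extends F 2≤r = record
  { #pairs′   = #pairs F
  ; lhs       = pairˡ F
  ; rhs       = pairʳ F
  ; lhs<rhs   = proj₁ ∘ pair-uncovered F
  ; uncovered = proj₂ ∘ pair-uncovered F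
  ; pair-inj  = pair-injective F
  ; build     = λ G y L y-inj len core cover y∉ dis → Ext-copy-lists F 2≤r G y L y-inj len core cover y∉ dis
  }

module _ {t n p m h : ℕ} {F : RGraph (2 + t) p} {H : RGraph (2 + t) h} (X : Extends F H) (G : RGraph (2 + t) n) (2+t≤m : 2 + t ≤ m)
  (y : Fin p → Fin n) (y-inj : Injective _≡_ _≡_ y) (core : ∀ {e} → Edge F e → Edge G (image y e))
  (fill : Fin (Extends.#pairs′ X) → Fin m → Fin n) (fill-inj : ∀ {c c′ i i′} → fill c i ≡ fill c′ i′ → c ≡ c′)
  (y≢fill : ∀ u c i → y u ≢ fill c i) (κ : Fin p → Fin m)
  (Sp : Fin (Extends.#pairs′ X) → Set) (Sp? : ∀ c → Dec (Sp c)) (S : Fin (Extends.#pairs′ X) → List (Fin n))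
  (S-length : ∀ c → Sp c → length (S c) ≡ t) (S-edge : ∀ c → Sp c → Edge G (setOf (y (Extends.lhs X c) ∷ y (Extends.rhs X c) ∷ S c)))
  (y∉S : ∀ c → Sp c → ∀ u → y u ∉ᴸ S c) (S-disjoint : ∀ {c c′} → Sp c → Sp c′ → c ≢ c′ → Disjoint (S c) (S c′))
  (fill∉S : ∀ c → Sp c → ∀ c′ i → fill c′ i ∉ᴸ S c) (κ≢ : ∀ c → ¬ Sp c → κ (Extends.lhs X c) ≢ κ (Extends.rhs X c))
  (fill-edge : ∀ c → ¬ Sp c → ∀ is → length is ≡ t → Unique (κ (Extends.lhs X c) ∷ κ (Extends.rhs X c) ∷ is) →
    Edge G (setOf (y (Extends.lhs X c) ∷ y (Extends.rhs X c) ∷ map (fill c) is)))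
  where

  open Extends X

  private
    os : Fin #pairs′ → List (Fin m)
    os c = others {t} 2+t≤m (κ (lhs c)) (κ (rhs c))

    L′ : ∀ c → Dec (Sp c) → List (Fin n)
    L′ c (yes _) = S c
    L′ c (no _)  = map (fill c) (os c)

    len : ∀ c d → length (L′ c d) ≡ t
    len c (yes s) = S-length c s
    len c (no _)  = trans (length-map (fill c) (os c)) (length-others 2+t≤m (κ (lhs c)) (κ (rhs c)))

    cover : ∀ c d → Edge G (setOf (y (lhs c) ∷ y (rhs c) ∷ L′ c d))
    cover c (yes s) = S-edge c s
    cover c (no ¬s) = fill-edge c ¬s (os c) (length-others 2+t≤m (κ (lhs c)) (κ (rhs c)))
      (others-unique 2+t≤m (κ (lhs c)) (κ (rhs c)) (κ≢ c ¬s))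

    y∉ : ∀ u c d → y u ∉ᴸ L′ c d
    y∉ u c (yes s) = y∉S c s u
    y∉ u c (no _) h = let i , _ , eq = ∈-map⁻ (fill c) h in y≢fill u c i eq

    dis : ∀ {c c′} → c ≢ c′ → ∀ d d′ {w} → w ∈ᴸ L′ c d → w ∉ᴸ L′ c′ d′
    dis c≢ (yes s) (yes s′) = S-disjoint s s′ c≢
    dis {c} {c′} c≢ (yes s) (no _) p q = let i , _ , eq = ∈-map⁻ (fill c′) q in fill∉S c s c′ i (subst (_∈ᴸ S c) eq p)
    dis {c} {c′} c≢ (no _) (yes s) p q = let i , _ , eq = ∈-map⁻ (fill c) p in fill∉S c′ s c i (subst (_∈ᴸ S c′) eq q)
    dis {c} {c′} c≢ (no _) (no _) p q =
      let i , _ , eq = ∈-map⁻ (fill c) p ; i′ , _ , eq′ = ∈-map⁻ (fill c′) q in c≢ (fill-inj (trans (sym eq) eq′))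

  -- The assembly common to both sampling arguments. The pairs in `Sp` come with prescribed covering
  -- edges; any other pair has two different colours and is completed by vertices of `t` further
  -- colours. Each pair `c` draws on its own row `fill c`, which keeps the blocks disjoint.
  frame-copy : Copy H G
  frame-copy = build G y (λ c → L′ c (Sp? c)) y-inj (λ c → len c (Sp? c)) core (λ c → cover c (Sp? c))
    (λ u c → y∉ u c (Sp? c)) (λ {c} {c′} c≢ → dis c≢ (Sp? c) (Sp? c′))

-- u₀ lies in at most one edge, and that edge is then u₀ together with the vertices indexed by J.
record Tip (F : RGraph (2 + k) (suc m)) : Set where
  field
    u₀        : Fin (suc m)
    J         : List (Fin m)
    J-unique  : Unique J
    J-small   : length J ≤ suc k
    edge-u₀   : ∀ {e} → Edge F e → u₀ ∈ e → length J ≡ suc k × e ≡ setOf (u₀ ∷ map (punchIn u₀) J)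
    J-covered : ∀ {i} → i ∈ᴸ J → Covered F u₀ (punchIn u₀ i)

  J-covered′ : ∀ {i} → i ∈ᴸ J → Covered F (punchIn u₀ i) u₀
  J-covered′ i∈ = let e , h , p , q = J-covered i∈ in e , h , q , p

data PunchView (u : Fin (suc m)) : Fin (suc m) → Set where
  same  : PunchView u u
  other : ∀ i → PunchView u (punchIn u i)

punchView : (u w : Fin (suc m)) → PunchView u w
punchView u w with u Fin.≟ w
... | yes refl = same
... | no u≢w   = subst (PunchView u) (Fin.punchIn-punchOut u≢w) (other (punchOut u≢w))

image-split : (f : Fin v → Fin n) {e : Subset v} {u : Fin v} → u ∈ e → image f e ≡ setOf (f u ∷ map f (elements (e - u)))
image-split f {e} {u} u∈ = trans (cong (image f) (sym (trans (cong (⁅ u ⁆ ∪_) (setOf-elements (e - u))) (⁅v⁆∪[e-v]≡e u∈))))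
  (image-setOf f (u ∷ elements (e - u)))

setOf-swap : ∀ (a b : Fin n) xs → setOf (a ∷ b ∷ xs) ≡ setOf (b ∷ a ∷ xs)
setOf-swap a b xs = setOf-↭ (swap a b (↭-refl {x = xs}))

Unique-map-on : {A C : Set} (f : A → C) {xs : List A} → (∀ {x y} → x ∈ᴸ xs → y ∈ᴸ xs → f x ≡ f y → x ≡ y) → Unique xs → Unique (map f xs)
Unique-map-on f         inj []        = []
Unique-map-on f {x ∷ xs} inj (x≢ ∷ u) = All.map⁺ (All.tabulate λ y∈ eq → All.lookup x≢ y∈ (inj (here refl) (there y∈) eq))
  ∷ Unique-map-on f (λ p q → inj (there p) (there q)) u

Unique-swap : {A : Set} {a b : A} {xs : List A} → Unique (a ∷ b ∷ xs) → Unique (b ∷ a ∷ xs)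
Unique-swap ((a≢b ∷ a≢) ∷ b≢ ∷ u) = (a≢b ∘ sym ∷ b≢) ∷ a≢ ∷ u

map-cong-∈ : {A C : Set} {f g : A → C} (xs : List A) → (∀ {x} → x ∈ᴸ xs → f x ≡ g x) → map f xs ≡ map g xs
map-cong-∈ []       h = refl
map-cong-∈ (x ∷ xs) h = cong₂ _∷_ (h (here refl)) (map-cong-∈ xs (h ∘ there))

∈-minus⁻ : {e : Subset n} {u w : Fin n} → w ∈ᴸ elements (e - u) → w ∈ e × w ≢ u
∈-minus⁻ {e = e} {u} h = p─q⊆p e ⁅ u ⁆ (∈-elements⁻ (e - u) h) , λ { refl → v∉e-v u e (∈-elements⁻ (e - u) h) }

length-minus : {e : Subset n} {u : Fin n} → u ∈ e → ∣ e ∣ ≡ suc k → length (elements (e - u)) ≡ k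
length-minus {e = e} {u} u∈ eq = trans (length-elements (e - u)) (ℕ.suc-injective (trans (∣e-v∣ u∈) eq))

setOf-∷-elements : {e : Subset n} {u : Fin n} → u ∈ e → setOf (u ∷ elements (e - u)) ≡ e
setOf-∷-elements {e = e} {u} u∈ = trans (cong (⁅ u ⁆ ∪_) (setOf-elements (e - u))) (⁅v⁆∪[e-v]≡e u∈)

-- Missing edges, and two vertices attached to the same colour

module _ {r : ℕ} (χ : Colouring n m) (G : RGraph r n) where

  missing : List (Fin n) → ℕ
  missing l = 𝟙 (rainbow? χ l ×-dec ¬? (edge? G (setOf l)))

  -- The colour `j` need not be `χ x`: the vertex is tested as if it belonged to class `j`.
  missingLink : Fin n → Fin m → List (Fin n) → ℕ
  missingLink x j l = 𝟙 (link? χ j l ×-dec ¬? (edge? G (setOf (x ∷ l))))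

  #missing : ℕ
  #missing = ∑ᴸ r missing

  #missingLink : Fin n → Fin m → ℕ
  #missingLink x j = ∑ᴸ (r ∸ 1) (missingLink x j)

  rainbow-resp : ∀ {l l′} → Unique l′ → setOf l′ ≡ setOf l → Rainbow χ l → Rainbow χ l′
  rainbow-resp {l} {l′} ul′ eq R = Transversal⇒Rainbow χ l′ ul′ (subst (Transversal χ) (sym eq) (Rainbow⇒Transversal χ l R))

  -- The sample controls only some reordering `l′` of `l`. Being an edge depends on the set alone,
  -- and so does being rainbow for lists without repetition.
  missing≡0⇒edge : ∀ {l l′} → Unique l′ → setOf l′ ≡ setOf l → length l′ ≡ r → onLength r missing l′ ≡ 0 →
    Rainbow χ l → Edge G (setOf l)
  missing≡0⇒edge {l} {l′} ul′ eq len zero≡ R = decidable-stable (edge? G (setOf l)) λ ¬e →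
    𝟙≡0⇒¬ (rainbow? χ l′ ×-dec ¬? (edge? G (setOf l′))) (onLength≡0⇒ {s = r} {missing} l′ zero≡ len)
      (rainbow-resp ul′ eq R , ¬e ∘ subst (Edge G) eq)

  missingLink≡0⇒edge : ∀ {x j l l′} → Unique l′ → setOf l′ ≡ setOf l → length l′ ≡ r ∸ 1 →
    onLength (r ∸ 1) (missingLink x j) l′ ≡ 0 → Link χ j l → Edge G (setOf (x ∷ l))
  missingLink≡0⇒edge {x} {j} {l} {l′} ul′ eq len zero≡ (j≢ ∷ R) = decidable-stable (edge? G (setOf (x ∷ l))) λ ¬e →
    𝟙≡0⇒¬ (link? χ j l′ ×-dec ¬? (edge? G (setOf (x ∷ l′)))) (onLength≡0⇒ {s = r ∸ 1} {missingLink x j} l′ zero≡ len)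
      ( All.map⁺ (All.tabulate λ v∈ → All.lookup (All.map⁻ j≢) (∈-setOf⁻ l (subst (_ ∈_) eq (∈-setOf⁺ v∈)))) ∷ rainbow-resp ul′ eq R
      , ¬e ∘ subst (λ s → Edge G (⁅ x ⁆ ∪ s)) eq)

touch : List (Fin n) → List (Fin n) → ℕ
touch W l = 𝟙 (meets? W l)

touch-bound : ∀ {Q} (W : List (Fin n)) → Q ≤ n → Q * ∑ᴸ 1 (touch W) ≤ length W * n ^ 1
touch-bound {n} {Q} W Q≤n = begin
  Q * ∑ᴸ 1 (touch W)   ≤⟨ *-monoʳ-≤ Q (≤-trans (count-meets 1 W) (≤-reflexive (*-identityʳ (length W)))) ⟩
  Q * length W         ≤⟨ *-monoˡ-≤ (length W) Q≤n ⟩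
  n * length W         ≡⟨ trans (*-comm n (length W)) (cong (length W *_) (sym (*-identityʳ n))) ⟩
  length W * n ^ 1     ∎

hasColour : Colouring n m → Fin m → List (Fin n) → ℕ
hasColour χ c (v ∷ []) = 𝟙 (χ v Fin.≟ c)
hasColour χ c _        = 0

hasColour≤1 : ∀ (χ : Colouring n m) c l → hasColour χ c l ≤ 1
hasColour≤1 χ c []          = z≤n
hasColour≤1 χ c (v ∷ [])    = 𝟙≤1 (χ v Fin.≟ c)
hasColour≤1 χ c (v ∷ _ ∷ _) = z≤n

0<hasColour⇒ : ∀ (χ : Colouring n m) c l → 0 < hasColour χ c l → ∃[ v ] l ≡ v ∷ [] × χ v ≡ c
0<hasColour⇒ χ c (v ∷ []) h = v , refl , 0<𝟙⇒ (χ v Fin.≟ c) h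

-- z lists, for each colour, one core vertex and one vertex for every uncovered pair; together with the
-- vertices of e₀ these carry a copy of the extension.
record SampleA {r : ℕ} (G : RGraph r n) (χ : Colouring n m) (K : ℕ) (j : Fin m) (w x : Fin n) (e₀ : Subset n) : Set₁ where
  field
    Z : Fin n → Set
    z : Fin (suc K) → Fin m → Fin n
    χz : ∀ β i → χ (z β i) ≡ i
    Zz : ∀ β i → Z (z β i)
    z-inj : ∀ {β i β′ i′} → z β i ≡ z β′ i′ → β ≡ β′
    Z∉e₀ : ∀ {v} → Z v → v ∉ e₀

  Att : Fin n → Fin m → Set
  Att v a = ∀ l → suc (length l) ≡ r → Link χ a l → (∀ {u} → u ∈ᴸ l → Z u) → Edge G (setOf (v ∷ l))

  field
    Z-att : ∀ {v} → Z v → Att v (χ v)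
    w-Att : Att w j
    x-Att : Att x j

module _ {t M : ℕ} (K : ℕ) (G : RGraph (2 + t) n) (χ : Colouring n (suc M)) (j : Fin (suc M)) (w x : Fin n)
  (e₀ : Subset n) (e₀-edge : Edge G e₀) where

  private
    B : ℕ
    B = suc K * suc M

    col : Fin B → Fin (suc M)
    col b = proj₂ (remQuot {suc K} (suc M) b)

    W = elements e₀

    one : ∀ {a b} → a ≤ b → a ≤ 1 * b
    one h = ≤-trans h (≤-reflexive (sym (*-identityˡ _)))

    f₄ f₃ f₂ f₁ : List (Fin n) → ℕ
    f₄ = onLength 1 (touch W)
    f₃ = onLength (1 + t) (missingLink χ G x j)
    f₂ = onLength (1 + t) (missingLink χ G w j)
    f₁ = onLength (2 + t) (missing χ G)

  module _ (L : Fin (suc K * suc M) → List (Fin n))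
    (L-colour : ∀ b → 0 < hasColour χ (proj₂ (remQuot {suc K} (suc M) b)) (L b))
    (L-disjoint : ∀ {b b′} → b ≢ b′ → Disjoint (L b) (L b′))
    (L-free : ∀ l → Unique l → (∀ {v} → v ∈ᴸ l → ∃[ b ] v ∈ᴸ L b) →
       ∃[ l′ ] Unique l′ × setOf l′ ≡ setOf l × length l′ ≡ length l
         × onLength (2 + t) (missing χ G) l′ + (onLength (1 + t) (missingLink χ G w j) l′
           + (onLength (1 + t) (missingLink χ G x j) l′ + onLength 1 (touch (elements e₀)) l′)) ≡ 0) where

    private
      Z : Fin n → Set
      Z v = ∃[ b ] v ∈ᴸ L b

      z-spec : ∀ β i → ∃[ v ] L (combine β i) ≡ v ∷ [] × χ v ≡ i
      z-spec β i = let v , eq , col = 0<hasColour⇒ χ _ (L (combine β i)) (L-colour (combine β i))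
                   in v , eq , trans col (cong proj₂ (Fin.remQuot-combine {suc K} β i))

      z : Fin (suc K) → Fin (suc M) → Fin n
      z β i = proj₁ (z-spec β i)

      z∈L : ∀ β i → z β i ∈ᴸ L (combine β i)
      z∈L β i = subst (z β i ∈ᴸ_) (sym (proj₁ (proj₂ (z-spec β i)))) (here refl)

      χz : ∀ β i → χ (z β i) ≡ i
      χz β i = proj₂ (proj₂ (z-spec β i))

      Zz : ∀ β i → Z (z β i)
      Zz β i = combine β i , z∈L β i

      z-inj : ∀ {β i β′ i′} → z β i ≡ z β′ i′ → β ≡ β′
      z-inj {β} {i} {β′} {i′} eq = Fin.combine-injectiveˡ β i β′ i′ (decidable-stable (combine β i Fin.≟ combine β′ i′)
        λ ne → L-disjoint ne (z∈L β i) (subst (_∈ᴸ L (combine β′ i′)) (sym eq) (z∈L β′ i′)))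

      Z∉e₀ : ∀ {v} → Z v → v ∉ e₀
      Z∉e₀ {v} Zv v∈ with L-free (v ∷ []) ([] ∷ []) (λ { (here refl) → Zv })
      ... | l′ , ul′ , set≡ , len≡ , zero≡ = 𝟙≡0⇒¬ (meets? W l′)
        (onLength≡0⇒ {s = 1} {touch W} l′ (m+n≡0⇒n≡0 (f₃ l′) (m+n≡0⇒n≡0 (f₂ l′) (m+n≡0⇒n≡0 (f₁ l′) zero≡))) len≡)
        (Any.map (λ { refl → ∈-setOf⁻ l′ (subst (v ∈_) (sym set≡) (∈-setOf⁺ {l = v ∷ []} (here refl))) }) (∈-elements⁺ v∈))

      Att : Fin n → Fin (suc M) → Set
      Att v a = ∀ l → length l ≡ 1 + t → Link χ a l → (∀ {u} → u ∈ᴸ l → Z u) → Edge G (setOf (v ∷ l))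

      Z-att : ∀ {v} → Z v → Att v (χ v)
      Z-att {v} Zv l len lk Zl with L-free (v ∷ l) (Rainbow⇒Unique χ (v ∷ l) lk) (λ { (here refl) → Zv ; (there p) → Zl p })
      ... | l′ , ul′ , set≡ , len≡ , zero≡ = missing≡0⇒edge χ G {v ∷ l} ul′ set≡ (trans len≡ (cong suc len)) (m+n≡0⇒m≡0 _ zero≡) lk

      w-Att : Att w j
      w-Att l len lk@(_ ∷ R) Zl with L-free l (Rainbow⇒Unique χ l R) Zl
      ... | l′ , ul′ , set≡ , len≡ , zero≡ = missingLink≡0⇒edge χ G {w} {j} {l} ul′ set≡ (trans len≡ len)
        (m+n≡0⇒m≡0 _ (m+n≡0⇒n≡0 (f₁ l′) zero≡)) lk

      x-Att : Att x j
      x-Att l len lk@(_ ∷ R) Zl with L-free l (Rainbow⇒Unique χ l R) Zl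
      ... | l′ , ul′ , set≡ , len≡ , zero≡ = missingLink≡0⇒edge χ G {x} {j} {l} ul′ set≡ (trans len≡ len)
        (m+n≡0⇒m≡0 _ (m+n≡0⇒n≡0 (f₂ l′) (m+n≡0⇒n≡0 (f₁ l′) zero≡))) lk

    fromBlocks : SampleA G χ K j w x e₀
    fromBlocks = record
      { Z = Z ; z = z ; χz = χz ; Zz = Zz ; z-inj = z-inj ; Z∉e₀ = Z∉e₀
      ; Z-att = λ Zv l len → Z-att Zv l (ℕ.suc-injective len)
      ; w-Att = λ l len → w-Att l (ℕ.suc-injective len)
      ; x-Att = λ l len → x-Att l (ℕ.suc-injective len)
      }

  -- Repetitions, missing edges and the missing links at `w` and at `x` have density at most 1/Q
  -- each, the vertices of `e₀` at most (2 + t)/Q; this gives the nested sum. Of the `suc K` rows of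
  -- vertices of all colours, row zero supplies the core and every other row fills the edge of one
  -- uncovered pair.
  sampleA : (c Q : ℕ) → c ^ (suc K * suc M) * (2 ^ ∑ {suc K * suc M} (λ _ → 1) * (1 + (1 + (1 + (1 + (2 + t)))))) < Q → Q ≤ n →
    (∀ i → n ≤ c * part χ i) → Q * #missing χ G ≤ n ^ (2 + t) →
    Q * #missingLink χ G w j ≤ n ^ (1 + t) → Q * #missingLink χ G x j ≤ n ^ (1 + t) → SampleA G χ K j w x e₀
  sampleA c Q Q-big Q≤n parts Q-missing w-att x-att =
    let L , good , dis , free = sampled in fromBlocks L (λ b → proj₁ (proj₂ (good b))) dis free
    where
    sampled = sample-disjoint B (λ _ → 1) (λ b → hasColour χ (col b)) (λ l → f₁ l + (f₂ l + (f₃ l + f₄ l)))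
      {c} {Q} {1 + (1 + (1 + (2 + t)))}
      (λ b → hasColour≤1 χ _)
      (λ b → ≤-trans (≤-reflexive (*-identityʳ n)) (parts _))
      (∑ᴸ-bound-+ Q 1 (1 + (1 + (2 + t))) f₁ (λ l → f₂ l + (f₃ l + f₄ l)) (∑ᴸ-onLength (2 + t) Q 1 (missing χ G) (one Q-missing))
        (∑ᴸ-bound-+ Q 1 (1 + (2 + t)) f₂ (λ l → f₃ l + f₄ l) (∑ᴸ-onLength (1 + t) Q 1 (missingLink χ G w j) (one w-att))
          (∑ᴸ-bound-+ Q 1 (2 + t) f₃ f₄ (∑ᴸ-onLength (1 + t) Q 1 (missingLink χ G x j) (one x-att))
            (∑ᴸ-onLength 1 Q (2 + t) (touch W) (≤-trans (touch-bound W Q≤n)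
              (≤-reflexive (cong (_* n ^ 1) (trans (length-elements e₀) (uniform G e₀-edge)))))))))
      Q-big Q≤n

module _ {t M h : ℕ} {F : RGraph (2 + t) (2 + M)} {H : RGraph (2 + t) h} (X : Extends F H) (tip : Tip F) (r≤m : 2 + t ≤ suc M)
  (G : RGraph (2 + t) n) (χ : Colouring n (suc M)) (j : Fin (suc M)) (w x : Fin n) (w≢x : w ≢ x)
  (e₀ : Subset n) (e₀-edge : Edge G e₀) (w∈ : w ∈ e₀) (x∈ : x ∈ e₀) (smp : SampleA G χ (Extends.#pairs′ X) j w x e₀)
  (q₁ : Fin (suc M)) (q₁∉J : q₁ ∉ᴸ Tip.J tip) (σ : Fin (suc M) → Fin (suc M)) (σ-inj : Injective _≡_ _≡_ σ) (σq₁ : σ q₁ ≡ j)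
  where

  private
    open Tip tip
    open Extends X
    open SampleA smp

    y₁ : ∀ i → Dec (σ i ≡ j) → Fin n
    y₁ i (yes _) = x
    y₁ i (no _)  = z zero (σ i)

    y : Fin (2 + M) → Fin n
    y = insertAt (λ i → y₁ i (σ i Fin.≟ j)) u₀ w

    κ : Fin (2 + M) → Fin (suc M)
    κ = insertAt σ u₀ j

    data At : Fin (2 + M) → Set where
      at-w : ∀ {u} → u ≡ u₀ → y u ≡ w → κ u ≡ j → At u
      at-x : ∀ {u} → u ≡ punchIn u₀ q₁ → y u ≡ x → κ u ≡ j → At u
      at-Z : ∀ {u i} → u ≡ punchIn u₀ i → y u ≡ z zero (κ u) → κ u ≡ σ i → κ u ≢ j → At u

    at : ∀ u → At u
    at u with punchView u₀ u
    ... | same = at-w refl (insertAt-lookup _ u₀ w) (insertAt-lookup σ u₀ j)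
    ... | other i = go (σ i Fin.≟ j) (insertAt-punchIn _ u₀ w i)
      where
      κ≡ = insertAt-punchIn σ u₀ j i
      go : ∀ d → y (punchIn u₀ i) ≡ y₁ i d → At (punchIn u₀ i)
      go (yes σi≡j) eq = at-x (cong (punchIn u₀) (σ-inj (trans σi≡j (sym σq₁)))) eq (trans κ≡ σi≡j)
      go (no σi≢j)  eq = at-Z {i = i} refl (trans eq (cong (z zero) (sym κ≡))) κ≡ (σi≢j ∘ trans (sym κ≡))

    y-Att : ∀ u → Att (y u) (κ u)
    y-Att u with at u
    ... | at-w _ eq κ≡     = subst₂ Att (sym eq) (sym κ≡) w-Att
    ... | at-x _ eq κ≡     = subst₂ Att (sym eq) (sym κ≡) x-Att
    ... | at-Z _ eq _ _    = subst₂ Att (sym eq) (χz zero (κ u)) (Z-att (Zz zero (κ u)))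

    y-Z : ∀ u → κ u ≢ j → Z (y u) × χ (y u) ≡ κ u
    y-Z u κ≢ with at u
    ... | at-w _ _ κ≡   = contradiction κ≡ κ≢
    ... | at-x _ _ κ≡   = contradiction κ≡ κ≢
    ... | at-Z _ eq _ _ = subst Z (sym eq) (Zz zero (κ u)) , trans (cong χ eq) (χz zero (κ u))

    κ-inj : ∀ u u′ → κ u ≢ j → κ u ≡ κ u′ → u ≡ u′
    κ-inj u u′ κ≢ eq with at u | at u′
    ... | at-w _ _ κ≡      | _                = contradiction κ≡ κ≢
    ... | at-x _ _ κ≡      | _                = contradiction κ≡ κ≢
    ... | _                | at-w _ _ κ≡      = contradiction (trans eq κ≡) κ≢
    ... | _                | at-x _ _ κ≡      = contradiction (trans eq κ≡) κ≢
    ... | at-Z refl _ a _  | at-Z refl _ b _  = cong (punchIn u₀) (σ-inj (trans (sym a) (trans eq b)))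

    yj∈e₀ : ∀ u → κ u ≡ j → y u ∈ e₀
    yj∈e₀ u κ≡ with at u
    ... | at-w _ eq _     = subst (_∈ e₀) (sym eq) w∈
    ... | at-x _ eq _     = subst (_∈ e₀) (sym eq) x∈
    ... | at-Z _ _ _ κ≢   = contradiction κ≡ κ≢

    y-inj : ∀ {u u′} → y u ≡ y u′ → u ≡ u′
    y-inj {u} {u′} eq with κ u Fin.≟ j | κ u′ Fin.≟ j
    ... | no a  | no b  = κ-inj u u′ a (trans (sym (proj₂ (y-Z u a))) (trans (cong χ eq) (proj₂ (y-Z u′ b))))
    ... | no a  | yes b = contradiction (subst (_∈ e₀) (sym eq) (yj∈e₀ u′ b)) (Z∉e₀ (proj₁ (y-Z u a)))
    ... | yes a | no b  = contradiction (subst (_∈ e₀) eq (yj∈e₀ u a)) (Z∉e₀ (proj₁ (y-Z u′ b)))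
    ... | yes a | yes b with at u | at u′
    ...   | at-w p _ _   | at-w q _ _   = trans p (sym q)
    ...   | at-x p _ _   | at-x q _ _   = trans p (sym q)
    ...   | at-w _ p _   | at-x _ q _   = contradiction (trans (sym p) (trans eq q)) w≢x
    ...   | at-x _ p _   | at-w _ q _   = contradiction (sym (trans (sym p) (trans eq q))) w≢x
    ...   | at-Z _ _ _ a′ | _           = contradiction a a′
    ...   | _            | at-Z _ _ _ b′ = contradiction b b′

    -- The vertices of `e` other than `s` avoid colour `j`, so they are sampled and have distinct
    -- colours: they form a link of `κ s`, and the attachment of `y s` gives the edge. Only an edge
    -- with two vertices of colour `j` would be out of reach.
    core-from : ∀ {e} → Edge F e → ∀ s → s ∈ e → (∀ {u} → u ∈ e → u ≢ s → κ u ≢ j) → Edge G (image y e)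
    core-from {e} h s s∈ κ≢ = subst (Edge G) (sym (image-split y s∈))
      (y-Att s (map y els) (cong suc (trans (length-map y els) (length-minus s∈ (uniform F h)))) link Zl)
      where
      els = elements (e - s)
      κ≢′ : ∀ {u} → u ∈ᴸ els → κ u ≢ j
      κ≢′ u∈ = κ≢ (proj₁ (∈-minus⁻ u∈)) (proj₂ (∈-minus⁻ {e = e} u∈))
      Zl : ∀ {v} → v ∈ᴸ map y els → Z v
      Zl v∈ = let u , u∈ , eq = ∈-map⁻ y v∈ in subst Z (sym eq) (proj₁ (y-Z u (κ≢′ u∈)))
      colours : map χ (map y els) ≡ map κ els
      colours = trans (sym (map-∘ els)) (map-cong-∈ els λ {u} u∈ → proj₂ (y-Z u (κ≢′ u∈)))
      link : Link χ (κ s) (map y els)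
      link = subst (λ cs → Unique (κ s ∷ cs)) (sym colours)
        (All.map⁺ (All.tabulate λ {u} u∈ eq → proj₂ (∈-minus⁻ {e = e} u∈) (κ-inj u s (κ≢′ u∈) (sym eq)))
        ∷ Unique-map-on κ (λ {u} {u′} u∈ _ eq → κ-inj u u′ (κ≢′ u∈) eq) (elements-unique (e - s)))

    core-any : ∀ {e} → Edge F e → u₀ ∉ e → punchIn u₀ q₁ ∉ e → Edge G (image y e)
    core-any {e} h u₀∉ u₁∉ with elements e in eq
    ... | [] = contradiction (trans (sym (uniform F h)) (trans (sym (length-elements e)) (cong length eq))) λ ()
    ... | s ∷ _ = core-from h s (∈-elements⁻ e (subst (s ∈ᴸ_) (sym eq) (here refl))) λ {u} u∈ _ → κ≢j u u∈
      where
      κ≢j : ∀ u → u ∈ e → κ u ≢ j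
      κ≢j u u∈ κ≡ with at u
      ... | at-w refl _ _   = u₀∉ u∈
      ... | at-x refl _ _   = u₁∉ u∈
      ... | at-Z _ _ _ κ≢   = κ≢ κ≡

    core : ∀ {e} → Edge F e → Edge G (image y e)
    core {e} h with u₀ ∈? e | punchIn u₀ q₁ ∈? e
    -- An edge through `u₀` consists of `u₀` and `J`, so it misses the other vertex of colour `j`,
    -- whose index `q₁` lies outside `J`.
    ... | yes u₀∈ | d       = core-from h u₀ u₀∈ κ≢j
      where
      κ≢j : ∀ {u} → u ∈ e → u ≢ u₀ → κ u ≢ j
      κ≢j {u} u∈ u≢ κ≡ with at u | edge-u₀ h u₀∈
      ... | at-w p _ _    | _ = u≢ p
      ... | at-Z _ _ _ κ≢ | _ = κ≢ κ≡
      ... | at-x refl _ _ | _ , refl with ∈-setOf⁻ (u₀ ∷ map (punchIn u₀) J) u∈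
      ...   | here eq = Fin.punchInᵢ≢i u₀ q₁ eq
      ...   | there p = let i , i∈ , eq = ∈-map⁻ (punchIn u₀) p in q₁∉J (subst (_∈ᴸ J) (sym (Fin.punchIn-injective u₀ q₁ i eq)) i∈)
    ... | no u₀∉  | yes u₁∈ = core-from h (punchIn u₀ q₁) u₁∈ κ≢j
      where
      κ≢j : ∀ {u} → u ∈ e → u ≢ punchIn u₀ q₁ → κ u ≢ j
      κ≢j {u} u∈ u≢ κ≡ with at u
      ... | at-w refl _ _ = u₀∉ u∈
      ... | at-x p _ _    = u≢ p
      ... | at-Z _ _ _ κ≢ = κ≢ κ≡
    ... | no u₀∉  | no u₁∉  = core-any h u₀∉ u₁∉

    fill : Fin #pairs′ → Fin (suc M) → Fin n
    fill c i = z (suc c) i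

    y≢fill : ∀ u c i → y u ≢ fill c i
    y≢fill u c i eq with κ u Fin.≟ j
    ... | yes a = Z∉e₀ (Zz (suc c) i) (subst (_∈ e₀) eq (yj∈e₀ u a))
    ... | no a with at u
    ...   | at-w _ _ κ≡    = a κ≡
    ...   | at-x _ _ κ≡    = a κ≡
    ...   | at-Z _ eq′ _ _ with z-inj (trans (sym eq′) eq)
    ...     | ()

    Sp : Fin #pairs′ → Set
    Sp c = κ (lhs c) ≡ κ (rhs c)

    S : List (Fin n)
    S = elements ((e₀ - w) - x)

    x∈′ : x ∈ e₀ - w
    x∈′ = x∈p∧x≢y⇒x∈p-y x∈ (w≢x ∘ sym)

    S-length : length S ≡ t
    S-length = length-minus {e = e₀ - w} x∈′ (ℕ.suc-injective (trans (∣e-v∣ w∈) (uniform G e₀-edge)))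

    S-set : setOf (w ∷ x ∷ S) ≡ e₀
    S-set = trans (cong (⁅ w ⁆ ∪_) (setOf-∷-elements x∈′)) (⁅v⁆∪[e-v]≡e w∈)

    S⁻ : ∀ {v} → v ∈ᴸ S → v ∈ e₀ × v ≢ w × v ≢ x
    S⁻ h = let a , v≢x = ∈-minus⁻ {e = e₀ - w} h
           in p─q⊆p e₀ ⁅ w ⁆ a , (λ { refl → v∉e-v w e₀ a }) , v≢x

    data Special (c : Fin #pairs′) : Set where
      wx : lhs c ≡ u₀ → rhs c ≡ punchIn u₀ q₁ → y (lhs c) ≡ w → y (rhs c) ≡ x → Special c
      xw : lhs c ≡ punchIn u₀ q₁ → rhs c ≡ u₀ → y (lhs c) ≡ x → y (rhs c) ≡ w → Special c

    pair≢ : ∀ c → lhs c ≢ rhs c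
    pair≢ c = Fin.<⇒≢ (lhs<rhs c)

    special : ∀ c → Sp c → Special c
    special c eq = go (at (lhs c)) (at (rhs c))
      where
      go : At (lhs c) → At (rhs c) → Special c
      go (at-w p a _)    (at-x q b _)    = wx p q a b
      go (at-x p a _)    (at-w q b _)    = xw p q a b
      go (at-w p _ _)    (at-w q _ _)    = contradiction (trans p (sym q)) (pair≢ c)
      go (at-x p _ _)    (at-x q _ _)    = contradiction (trans p (sym q)) (pair≢ c)
      go (at-Z _ _ _ κ≢) _               = contradiction (κ-inj _ _ κ≢ eq) (pair≢ c)
      go _               (at-Z _ _ _ κ≢) = contradiction (sym (κ-inj _ _ κ≢ (sym eq))) (pair≢ c)

    S-edge : ∀ c → Sp c → Edge G (setOf (y (lhs c) ∷ y (rhs c) ∷ S))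
    S-edge c sp with special c sp
    ... | wx _ _ a b = subst (Edge G) (sym (trans (cong₂ (λ u v → setOf (u ∷ v ∷ S)) a b) S-set)) e₀-edge
    ... | xw _ _ a b = subst (Edge G) (sym (trans (cong₂ (λ u v → setOf (u ∷ v ∷ S)) a b) (trans (setOf-swap x w S) S-set))) e₀-edge

    y∉S : ∀ c → Sp c → ∀ u → y u ∉ᴸ S
    y∉S _ _ u h with at u
    ... | at-w _ eq _    = proj₁ (proj₂ (S⁻ h)) eq
    ... | at-x _ eq _    = proj₂ (proj₂ (S⁻ h)) eq
    ... | at-Z _ eq _ κ≢ = Z∉e₀ (proj₁ (y-Z u κ≢)) (proj₁ (S⁻ h))

    -- Only the pair of `u₀` and `punchIn u₀ q₁` is special, and uncovered pairs are listed in
    -- increasing order, hence once.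
    Sp-unique : ∀ {c c′} → Sp c → Sp c′ → c ≡ c′
    Sp-unique {c} {c′} s s′ with special c s | special c′ s′
    ... | wx a b _ _ | wx a′ b′ _ _ = pair-inj c c′ (trans a (sym a′)) (trans b (sym b′))
    ... | xw a b _ _ | xw a′ b′ _ _ = pair-inj c c′ (trans a (sym a′)) (trans b (sym b′))
    ... | wx a b _ _ | xw a′ b′ _ _ = contradiction (subst₂ Fin._<_ a b (lhs<rhs c))
                                        (<⇒≯ (subst₂ Fin._<_ a′ b′ (lhs<rhs c′)))
    ... | xw a b _ _ | wx a′ b′ _ _ = contradiction (subst₂ Fin._<_ a b (lhs<rhs c))
                                        (<⇒≯ (subst₂ Fin._<_ a′ b′ (lhs<rhs c′)))

    fill-edge : ∀ c → ¬ Sp c → ∀ is → length is ≡ t → Unique (κ (lhs c) ∷ κ (rhs c) ∷ is) →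
      Edge G (setOf (y (lhs c) ∷ y (rhs c) ∷ map (fill c) is))
    fill-edge c ¬s is len u = go (κ b Fin.≟ j)
      where
      a = lhs c
      b = rhs c
      colours : map χ (map (fill c) is) ≡ is
      colours = trans (sym (map-∘ is)) (trans (map-cong-∈ is λ {i} _ → χz (suc c) i) (map-id is))
      Zl : ∀ {u′} → κ u′ ≢ j → ∀ {v} → v ∈ᴸ y u′ ∷ map (fill c) is → Z v
      Zl κ≢ (here refl) = proj₁ (y-Z _ κ≢)
      Zl κ≢ (there h)   = let i , _ , eq = ∈-map⁻ (fill c) h in subst Z (sym eq) (Zz (suc c) i)
      attach : ∀ u₁ u₂ → κ u₂ ≢ j → Unique (κ u₁ ∷ κ u₂ ∷ is) → Edge G (setOf (y u₁ ∷ y u₂ ∷ map (fill c) is))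
      attach u₁ u₂ κ≢ u = y-Att u₁ (y u₂ ∷ map (fill c) is) (cong (2 +_) (trans (length-map (fill c) is) len))
        (subst (λ cs → Unique (κ u₁ ∷ cs)) (sym (cong₂ _∷_ (proj₂ (y-Z u₂ κ≢)) colours)) u) (Zl κ≢)
      -- An endpoint of colour `j` has to be the attached vertex, because `w` and `x` are not
      -- sampled; outside `Sp` at most one endpoint has that colour.
      go : Dec (κ b ≡ j) → Edge G (setOf (y a ∷ y b ∷ map (fill c) is))
      go (no κb≢)  = attach a b κb≢ u
      go (yes κb≡) = subst (Edge G) (setOf-swap (y b) (y a) (map (fill c) is)) (attach b a (λ κa≡ → ¬s (trans κa≡ (sym κb≡))) (Unique-swap u))

  -- The tip `u₀` goes to `w` and the core vertex of index `q₁` to `x`, both with colour `j`; the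
  -- other `M` core vertices take the other `M` colours through `σ`. The only pair with equal
  -- colours is uncovered in `F` because `q₁` is outside `J`, and `e₀` covers it.
  claimA-frame : Copy H G
  claimA-frame = frame-copy X G r≤m y y-inj core fill (λ {c} {c′} eq → Fin.suc-injective (z-inj eq)) y≢fill κ
    Sp (λ c → κ (lhs c) Fin.≟ κ (rhs c)) (λ _ → S) (λ _ _ → S-length) S-edge y∉S
    (λ s s′ c≢ → contradiction (Sp-unique s s′) c≢) (λ _ _ c i h → Z∉e₀ (Zz (suc c) i) (proj₁ (S⁻ h))) (λ _ ¬s → ¬s) fill-edge

claimA : ∀ {t M h} {F : RGraph (2 + t) (2 + M)} {H : RGraph (2 + t) h} (X : Extends F H) (tip : Tip F) (r≤m : 2 + t ≤ suc M)
  (G : RGraph (2 + t) n) (χ : Colouring n (suc M)) (j : Fin (suc M)) {w x : Fin n} → w ≢ x → Covered G w x →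
  (∀ e₀ → Edge G e₀ → SampleA G χ (Extends.#pairs′ X) j w x e₀) → Copy H G
claimA X tip r≤m G χ j {w} {x} w≢x (e₀ , e₀-edge , w∈ , x∈) smp =
  -- `J` has at most r - 1 < m elements among the m indices other than the tip.
  let q₁ , q₁∉J = fresh (Tip.J tip) (≤-trans (s≤s (Tip.J-small tip)) r≤m)
      σ , σ-inj , σ≡ = match (q₁ ∷ []) (j ∷ []) ([] ∷ []) ([] ∷ []) refl
  in claimA-frame X tip r≤m G χ j w x w≢x e₀ e₀-edge w∈ x∈ (smp e₀ e₀-edge) q₁ q₁∉J σ σ-inj (∷-injectiveˡ σ≡)

-- A vertex attached to no colour

Unique-⊆-full : {xs ys : List (Fin n)} → Unique xs → (∀ {v} → v ∈ᴸ xs → v ∈ᴸ ys) → length ys ≤ length xs →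
  ∀ {v} → v ∈ᴸ ys → v ∈ᴸ xs
Unique-⊆-full {xs = xs} {ys} u sub le {v} v∈ = decidable-stable (v ∈ᴸ? xs) λ v∉ →
  <⇒≱ (s≤s le) (Unique-⊆-length (v ∷ xs) ys (∉⇒All≢ v∉ ∷ u) λ { (here refl) → v∈ ; (there p) → sub p })

∈-take : {A : Set} (k : ℕ) (xs : List A) {v : A} → v ∈ᴸ take k xs → v ∈ᴸ xs
∈-take (suc k) (x ∷ xs) (here eq) = here eq
∈-take (suc k) (x ∷ xs) (there p) = there (∈-take k xs p)

module _ {r : ℕ} (χ : Colouring n m) (G : RGraph r n) (x : Fin n) where

  hits? : ∀ c l → Dec (Edge G (setOf (x ∷ l)) × Rainbow χ l × c ∈ᴸ map χ l)
  hits? c l = edge? G (setOf (x ∷ l)) ×-dec rainbow? χ l ×-dec c ∈ᴸ? map χ l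

  hits : Fin m → List (Fin n) → ℕ
  hits c l = 𝟙 (hits? c l)

-- There is one list `ℓ` more than there are colours: `ℓ (suc c)` meets class `c` and can cover the
-- pair formed by `x` and a core vertex of that colour, while `ℓ zero` is reserved for the edge of
-- `F` at the tip.
record SampleB {r : ℕ} (G : RGraph r n) (χ : Colouring n m) (K : ℕ) (x : Fin n) : Set₁ where
  field
    Z          : Fin n → Set
    x∉Z        : ¬ Z x
    Z-edge     : ∀ l → length l ≡ r → Rainbow χ l → (∀ {u} → u ∈ᴸ l → Z u) → Edge G (setOf l)
    ℓ          : Fin (suc m) → List (Fin n)
    ℓ-length   : ∀ a → suc (length (ℓ a)) ≡ r
    ℓ-edge     : ∀ a → Edge G (setOf (x ∷ ℓ a))
    ℓ-rainbow  : ∀ a → Rainbow χ (ℓ a)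
    ℓ-colour   : ∀ c → c ∈ᴸ map χ (ℓ (suc c))
    ℓ⊆Z        : ∀ {a v} → v ∈ᴸ ℓ a → Z v
    ℓ-disjoint : ∀ {a a′} → a ≢ a′ → Disjoint (ℓ a) (ℓ a′)
    fill       : Fin K → Fin m → Fin n
    χfill      : ∀ c i → χ (fill c i) ≡ i
    Zfill      : ∀ c i → Z (fill c i)
    fill-inj   : ∀ {c i c′ i′} → fill c i ≡ fill c′ i′ → c ≡ c′
    fill∉ℓ     : ∀ c i a → fill c i ∉ᴸ ℓ a

blockLength : {A C : Set} → ℕ → A ⊎ C → ℕ
blockLength t (inj₁ _) = 1 + t
blockLength t (inj₂ _) = 1

module _ {t M : ℕ} (K : ℕ) (G : RGraph (2 + t) n) (χ : Colouring n (suc M)) (x : Fin n) where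

  -- Zero is a default for the reserved list: it lets that list share the test of the others.
  blockColour : Fin (2 + M) → Fin (suc M)
  blockColour zero    = zero
  blockColour (suc c) = c

  blockTest : Fin (2 + M) ⊎ Fin (K * suc M) → List (Fin n) → ℕ
  blockTest (inj₁ a) = hits χ G x (blockColour a)
  blockTest (inj₂ b) = hasColour χ (proj₂ (remQuot {K} (suc M) b))

  private
    f₁ f₂ : List (Fin n) → ℕ
    f₁ = onLength (2 + t) (missing χ G)
    f₂ = onLength 1 (touch (x ∷ []))

  module _ (L : Fin (2 + M + K * suc M) → List (Fin n))
    (L-good : ∀ b → length (L b) ≡ blockLength t (splitAt (2 + M) b) × 0 < blockTest (splitAt (2 + M) b) (L b))
    (L-disjoint : ∀ {b b′} → b ≢ b′ → Disjoint (L b) (L b′))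
    (L-free : ∀ l → Unique l → (∀ {v} → v ∈ᴸ l → ∃[ b ] v ∈ᴸ L b) →
       ∃[ l′ ] Unique l′ × setOf l′ ≡ setOf l × length l′ ≡ length l
         × onLength (2 + t) (missing χ G) l′ + onLength 1 (touch (x ∷ [])) l′ ≡ 0) where

    private
      ι : Fin (2 + M) → Fin (2 + M + K * suc M)
      ι a = a ↑ˡ (K * suc M)

      ψ : Fin K → Fin (suc M) → Fin (2 + M + K * suc M)
      ψ c i = (2 + M) ↑ʳ combine c i

      ι-good : ∀ a → length (L (ι a)) ≡ 1 + t × 0 < hits χ G x (blockColour a) (L (ι a))
      ι-good a = subst (λ s → length (L (ι a)) ≡ blockLength t s × 0 < blockTest s (L (ι a)))
        (Fin.splitAt-↑ˡ (2 + M) a (K * suc M)) (L-good (ι a))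

      hit : ∀ a → Edge G (setOf (x ∷ L (ι a))) × Rainbow χ (L (ι a)) × blockColour a ∈ᴸ map χ (L (ι a))
      hit a = 0<𝟙⇒ (hits? χ G x (blockColour a) (L (ι a))) (proj₂ (ι-good a))

      ψ-spec : ∀ c i → ∃[ v ] L (ψ c i) ≡ v ∷ [] × χ v ≡ i
      ψ-spec c i = let v , eq , col = 0<hasColour⇒ χ _ (L (ψ c i)) (proj₂ (subst (λ s → length (L (ψ c i)) ≡ blockLength t s × 0 < blockTest s (L (ψ c i)))
                         (Fin.splitAt-↑ʳ (2 + M) (K * suc M) (combine c i)) (L-good (ψ c i))))
                   in v , eq , trans col (cong proj₂ (Fin.remQuot-combine {K} c i))

      fill : Fin K → Fin (suc M) → Fin n
      fill c i = proj₁ (ψ-spec c i)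

      fill∈L : ∀ c i → fill c i ∈ᴸ L (ψ c i)
      fill∈L c i = subst (fill c i ∈ᴸ_) (sym (proj₁ (proj₂ (ψ-spec c i)))) (here refl)

      same-block : ∀ {b b′ v} → v ∈ᴸ L b → v ∈ᴸ L b′ → b ≡ b′
      same-block {b} {b′} p q = decidable-stable (b Fin.≟ b′) λ ne → L-disjoint ne p q

      ι≢ψ : ∀ a c i → ι a ≢ ψ c i
      ι≢ψ a c i eq with trans (sym (Fin.splitAt-↑ˡ (2 + M) a (K * suc M))) (trans (cong (splitAt (2 + M)) eq) (Fin.splitAt-↑ʳ (2 + M) (K * suc M) (combine c i)))
      ... | ()

      Z : Fin n → Set
      Z v = ∃[ b ] v ∈ᴸ L b

      x∉Z : ¬ Z x
      x∉Z Zx with L-free (x ∷ []) ([] ∷ []) (λ { (here refl) → Zx })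
      ... | l′ , ul′ , set≡ , len≡ , zero≡ = 𝟙≡0⇒¬ (meets? (x ∷ []) l′)
        (onLength≡0⇒ {s = 1} {touch (x ∷ [])} l′ (m+n≡0⇒n≡0 (f₁ l′) zero≡) len≡)
        (here (∈-setOf⁻ l′ (subst (x ∈_) (sym set≡) (∈-setOf⁺ {l = x ∷ []} (here refl)))))

      Z-edge : ∀ l → length l ≡ 2 + t → Rainbow χ l → (∀ {u} → u ∈ᴸ l → Z u) → Edge G (setOf l)
      Z-edge l len R Zl with L-free l (Rainbow⇒Unique χ l R) Zl
      ... | l′ , ul′ , set≡ , len≡ , zero≡ = missing≡0⇒edge χ G {l} ul′ set≡ (trans len≡ len) (m+n≡0⇒m≡0 _ zero≡) R

    fromBlocksB : SampleB G χ K x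
    fromBlocksB = record
      { Z = Z ; x∉Z = x∉Z ; Z-edge = Z-edge ; ℓ = L ∘ ι
      ; ℓ-length   = λ a → cong suc (proj₁ (ι-good a))
      ; ℓ-edge     = λ a → proj₁ (hit a)
      ; ℓ-rainbow  = λ a → proj₁ (proj₂ (hit a))
      ; ℓ-colour   = λ c → proj₂ (proj₂ (hit (suc c)))
      ; ℓ⊆Z        = λ {a} v∈ → ι a , v∈
      ; ℓ-disjoint = λ {a} {a′} a≢ → L-disjoint (a≢ ∘ Fin.↑ˡ-injective (K * suc M) a a′)
      ; fill       = fill
      ; χfill      = λ c i → proj₂ (proj₂ (ψ-spec c i))
      ; Zfill      = λ c i → ψ c i , fill∈L c i
      ; fill-inj   = λ {c} {i} {c′} {i′} eq → Fin.combine-injectiveˡ c i c′ i′ (Fin.↑ʳ-injective (2 + M) _ _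
                       (same-block (fill∈L c i) (subst (_∈ᴸ L (ψ c′ i′)) (sym eq) (fill∈L c′ i′))))
      ; fill∉ℓ     = λ c i a p → ι≢ψ a c i (same-block p (fill∈L c i))
      }

  -- The blocks are of two kinds, lists that extend `x` to an edge and single filler vertices; `c`
  -- bounds both densities from below. The three units in the last factor stand for repetitions,
  -- missing edges and the vertex `x`.
  sampleB : (c Q : ℕ) →
    c ^ (2 + M + K * suc M) * (2 ^ ∑ (blockLength t ∘ splitAt (2 + M) {K * suc M}) * (1 + (1 + 1))) < Q → Q ≤ n →
    (∀ i → n ≤ c * part χ i) → Q * #missing χ G ≤ n ^ (2 + t) →
    (∀ i → n ^ (1 + t) ≤ c * ∑ᴸ (1 + t) (hits χ G x i)) → SampleB G χ K x
  sampleB c Q Q-big Q≤n parts Q-missing many =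
    let L , good , dis , free = sample-disjoint (2 + M + K * suc M) (blockLength t ∘ splitAt (2 + M)) (blockTest ∘ splitAt (2 + M))
          (λ l → f₁ l + f₂ l) {c} {Q} {1 + 1} (λ b → test≤1 (splitAt (2 + M) b)) (λ b → test-many (splitAt (2 + M) b))
          (∑ᴸ-bound-+ Q 1 1 f₁ f₂
            (∑ᴸ-onLength (2 + t) Q 1 (missing χ G) (≤-trans Q-missing (≤-reflexive (sym (*-identityˡ _)))))
            (∑ᴸ-onLength 1 Q 1 (touch (x ∷ [])) (touch-bound (x ∷ []) Q≤n)))
          Q-big Q≤n
    in fromBlocksB L (λ b → proj₁ (good b) , proj₁ (proj₂ (good b))) dis free
    where
    test≤1 : ∀ s l → blockTest s l ≤ 1
    test≤1 (inj₁ a) l = 𝟙≤1 (hits? χ G x (blockColour a) l)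
    test≤1 (inj₂ b) l = hasColour≤1 χ _ l
    test-many : ∀ s → n ^ blockLength t s ≤ c * ∑ᴸ (blockLength t s) (blockTest s)
    test-many (inj₁ a) = many (blockColour a)
    test-many (inj₂ b) = ≤-trans (≤-reflexive (*-identityʳ n)) (parts _)

module _ {t M h : ℕ} {F : RGraph (2 + t) (2 + M)} {H : RGraph (2 + t) h} (X : Extends F H) (tip : Tip F) (r≤m : 2 + t ≤ suc M)
  (G : RGraph (2 + t) n) (χ : Colouring n (suc M)) (x : Fin n) (smp : SampleB G χ (Extends.#pairs′ X) x)
  (σ : Fin (suc M) → Fin (suc M)) (σ-inj : Injective _≡_ _≡_ σ)
  (y₁ : Fin (suc M) → Fin n) (χy₁ : ∀ i → χ (y₁ i) ≡ σ i)
  (y₁-J : ∀ i → i ∈ᴸ Tip.J tip → y₁ i ∈ᴸ SampleB.ℓ smp zero)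
  (y₁-other : ∀ i → i ∉ᴸ Tip.J tip → y₁ i ∈ᴸ SampleB.ℓ smp (suc (σ i)))
  where

  private
    open Tip tip
    open Extends X
    open SampleB smp

    y : Fin (2 + M) → Fin n
    y = insertAt y₁ u₀ x

    κ : Fin (2 + M) → Fin (suc M)
    -- Colour zero is a default: the pairs at `u₀` are covered by the lists `ℓ` and not by colours.
    κ = insertAt σ u₀ zero

    y-u₀ : y u₀ ≡ x
    y-u₀ = insertAt-lookup y₁ u₀ x

    y-in : ∀ i → y (punchIn u₀ i) ≡ y₁ i
    y-in = insertAt-punchIn y₁ u₀ x

    κ-in : ∀ i → κ (punchIn u₀ i) ≡ σ i
    κ-in = insertAt-punchIn σ u₀ zero

    y₁-Z : ∀ i → Z (y₁ i)
    y₁-Z i with i ∈ᴸ? J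
    ... | yes p = ℓ⊆Z (y₁-J i p)
    ... | no ¬p = ℓ⊆Z (y₁-other i ¬p)

    y-Z : ∀ {u} → u ≢ u₀ → Z (y u) × χ (y u) ≡ κ u
    y-Z {u} u≢ with punchView u₀ u
    ... | same    = contradiction refl u≢
    ... | other i = subst Z (sym (y-in i)) (y₁-Z i) , trans (cong χ (y-in i)) (trans (χy₁ i) (sym (κ-in i)))

    κ-inj : ∀ {u u′} → u ≢ u₀ → u′ ≢ u₀ → κ u ≡ κ u′ → u ≡ u′
    κ-inj {u} {u′} u≢ u′≢ eq with punchView u₀ u | punchView u₀ u′
    ... | same    | _        = contradiction refl u≢
    ... | other i | same     = contradiction refl u′≢
    ... | other i | other i′ = cong (punchIn u₀) (σ-inj (trans (sym (κ-in i)) (trans eq (κ-in i′))))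

    y-inj : ∀ {u u′} → y u ≡ y u′ → u ≡ u′
    y-inj {u} {u′} eq with u Fin.≟ u₀ | u′ Fin.≟ u₀
    ... | yes a | yes b = trans a (sym b)
    ... | yes refl | no b = contradiction (subst Z (trans (sym eq) y-u₀) (proj₁ (y-Z b))) x∉Z
    ... | no a | yes refl = contradiction (subst Z (trans eq y-u₀) (proj₁ (y-Z a))) x∉Z
    ... | no a | no b = κ-inj a b (trans (sym (proj₂ (y-Z a))) (trans (cong χ eq) (proj₂ (y-Z b))))

    core-without : ∀ {e} → Edge F e → u₀ ∉ e → Edge G (image y e)
    core-without {e} h u₀∉ = subst (Edge G) (trans (sym (image-setOf y els)) (cong (image y) (setOf-elements e)))
      (Z-edge (map y els) (trans (length-map y els) (trans (length-elements e) (uniform F h))) rb Zl)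
      where
      els = elements e
      ≢u₀ : ∀ {u} → u ∈ᴸ els → u ≢ u₀
      ≢u₀ u∈ refl = u₀∉ (∈-elements⁻ e u∈)
      Zl : ∀ {v} → v ∈ᴸ map y els → Z v
      Zl v∈ = let u , u∈ , eq = ∈-map⁻ y v∈ in subst Z (sym eq) (proj₁ (y-Z (≢u₀ u∈)))
      rb : Rainbow χ (map y els)
      rb = subst Unique (sym (trans (sym (map-∘ els)) (map-cong-∈ els λ u∈ → proj₂ (y-Z (≢u₀ u∈)))))
        (Unique-map-on κ (λ u∈ u′∈ → κ-inj (≢u₀ u∈) (≢u₀ u′∈)) (elements-unique e))

    core-with : ∀ {e} → Edge F e → u₀ ∈ e → Edge G (image y e)
    core-with h u₀∈ with edge-u₀ h u₀∈
    ... | len , refl = subst (Edge G) (sym set≡) (ℓ-edge zero)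
      where
      ys = map y₁ J
      uys : Unique ys
      uys = Unique-map-on y₁ (λ {i} {i′} _ _ eq → σ-inj (trans (sym (χy₁ i)) (trans (cong χ eq) (χy₁ i′)))) J-unique
      sub : ∀ {v} → v ∈ᴸ ys → v ∈ᴸ ℓ zero
      sub v∈ = let i , i∈ , eq = ∈-map⁻ y₁ v∈ in subst (_∈ᴸ ℓ zero) (sym eq) (y₁-J i i∈)
      -- An edge at `u₀` is given here, so `J` has r - 1 elements and their images exhaust `ℓ zero`.
      full : ∀ {v} → v ∈ᴸ ℓ zero → v ∈ᴸ ys
      full = Unique-⊆-full uys sub (≤-reflexive (trans (ℕ.suc-injective (ℓ-length zero)) (sym (trans (length-map y₁ J) len))))
      list≡ : map y (u₀ ∷ map (punchIn u₀) J) ≡ x ∷ ys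
      list≡ = cong₂ _∷_ y-u₀ (trans (sym (map-∘ J)) (map-cong-∈ J λ {i} _ → y-in i))
      set≡ : image y (setOf (u₀ ∷ map (punchIn u₀) J)) ≡ setOf (x ∷ ℓ zero)
      set≡ = trans (image-setOf y (u₀ ∷ map (punchIn u₀) J)) (trans (cong setOf list≡)
        (cong (⁅ x ⁆ ∪_) (setOf-cong ys (ℓ zero) sub full)))

    core : ∀ {e} → Edge F e → Edge G (image y e)
    core {e} h with u₀ ∈? e
    ... | yes p = core-with h p
    ... | no ¬p = core-without h ¬p

    Sp : Fin #pairs′ → Set
    Sp c = lhs c ≡ u₀ ⊎ rhs c ≡ u₀

    Sp? : ∀ c → Dec (Sp c)
    Sp? c = (lhs c Fin.≟ u₀) ⊎-dec (rhs c Fin.≟ u₀)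

    partner : ∀ {a b} → PunchView u₀ a → PunchView u₀ b → Fin (suc M)
    partner same      same      = zero
    partner same      (other i) = i
    partner (other i) _         = i

    o : Fin #pairs′ → Fin (suc M)
    o c = partner (punchView u₀ (lhs c)) (punchView u₀ (rhs c))

    data Special (c : Fin #pairs′) (i : Fin (suc M)) : Set where
      left  : lhs c ≡ u₀ → rhs c ≡ punchIn u₀ i → Special c i
      right : lhs c ≡ punchIn u₀ i → rhs c ≡ u₀ → Special c i

    special : ∀ c → Sp c → Special c (o c)
    special c sp = go (lhs<rhs c) sp refl refl (punchView u₀ (lhs c)) (punchView u₀ (rhs c))
      where
      go : ∀ {a b} → a Fin.< b → a ≡ u₀ ⊎ b ≡ u₀ → lhs c ≡ a → rhs c ≡ b → (α : PunchView u₀ a) (β : PunchView u₀ b) → Special c (partner α β)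
      go a<b _         p q same      same       = contradiction refl (Fin.<⇒≢ a<b)
      go a<b _         p q same      (other i)  = left p q
      go a<b (inj₁ eq) p q (other i) _          = contradiction eq (Fin.punchInᵢ≢i u₀ i)
      go a<b (inj₂ eq) p q (other i) _          = right p (trans q eq)

    -- The vertices of `J` are covered together with `u₀`, so the partner of `u₀` in an uncovered
    -- pair lies outside `J` and was placed on a list of its own.
    o∉J : ∀ c → Sp c → o c ∉ᴸ J
    o∉J c sp o∈ with special c sp
    ... | left a b  = uncovered c (subst₂ (Covered F) (sym a) (sym b) (J-covered o∈))
    ... | right a b = uncovered c (subst₂ (Covered F) (sym a) (sym b) (J-covered′ o∈))

    ℓ′ : Fin (suc M) → List (Fin n)
    ℓ′ i = ℓ (suc (σ i))

    S : Fin (suc M) → List (Fin n)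
    S i = elements (setOf (ℓ′ i) - y₁ i)

    S⁻ : ∀ i {v} → v ∈ᴸ S i → v ∈ᴸ ℓ′ i × v ≢ y₁ i
    S⁻ i h = let a , b = ∈-minus⁻ {e = setOf (ℓ′ i)} h in ∈-setOf⁻ (ℓ′ i) a , b

    y₁∈ : ∀ i → i ∉ᴸ J → y₁ i ∈ setOf (ℓ′ i)
    y₁∈ i i∉ = ∈-setOf⁺ (y₁-other i i∉)

    S-length : ∀ i → i ∉ᴸ J → length (S i) ≡ t
    S-length i i∉ = length-minus (y₁∈ i i∉) (trans (Unique⇒∣setOf∣ (Rainbow⇒Unique χ (ℓ′ i) (ℓ-rainbow (suc (σ i)))))
      (ℕ.suc-injective (ℓ-length (suc (σ i)))))

    S-set : ∀ i → i ∉ᴸ J → setOf (x ∷ y₁ i ∷ S i) ≡ setOf (x ∷ ℓ′ i)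
    S-set i i∉ = cong (⁅ x ⁆ ∪_) (setOf-∷-elements (y₁∈ i i∉))

    S-edge : ∀ c → Sp c → Edge G (setOf (y (lhs c) ∷ y (rhs c) ∷ S (o c)))
    S-edge c sp with special c sp
    ... | left a b  = subst (Edge G) (sym (trans
      (cong₂ (λ u v → setOf (u ∷ v ∷ S (o c))) (trans (cong y a) y-u₀) (trans (cong y b) (y-in (o c)))) (S-set (o c) (o∉J c sp)))) (ℓ-edge (suc (σ (o c))))
    ... | right a b = subst (Edge G) (sym (trans
      (cong₂ (λ u v → setOf (u ∷ v ∷ S (o c))) (trans (cong y a) (y-in (o c))) (trans (cong y b) y-u₀))
      (trans (setOf-swap (y₁ (o c)) x (S (o c))) (S-set (o c) (o∉J c sp))))) (ℓ-edge (suc (σ (o c))))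

    y₁∉S : ∀ i i′ → y₁ i′ ∉ᴸ S i
    y₁∉S i i′ h with i′ ∈ᴸ? J
    ... | yes p = ℓ-disjoint {zero} {suc (σ i)} (λ ()) (y₁-J i′ p) (proj₁ (S⁻ i h))
    ... | no ¬p with i′ Fin.≟ i
    ...   | yes refl = proj₂ (S⁻ i h) refl
    ...   | no i′≢i  = ℓ-disjoint {suc (σ i′)} {suc (σ i)} (i′≢i ∘ σ-inj ∘ Fin.suc-injective) (y₁-other i′ ¬p) (proj₁ (S⁻ i h))

    y∉S : ∀ i u → y u ∉ᴸ S i
    y∉S i u h with punchView u₀ u
    ... | same     = x∉Z (ℓ⊆Z (proj₁ (S⁻ i (subst (_∈ᴸ S i) y-u₀ h))))
    ... | other i′ = y₁∉S i i′ (subst (_∈ᴸ S i) (y-in i′) h)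

    o-inj : ∀ {c c′} → Sp c → Sp c′ → o c ≡ o c′ → c ≡ c′
    o-inj {c} {c′} s s′ eq with special c s | special c′ s′
    ... | left a b  | left a′ b′  = pair-inj c c′ (trans a (sym a′)) (trans b (trans (cong (punchIn u₀) eq) (sym b′)))
    ... | right a b | right a′ b′ = pair-inj c c′ (trans a (trans (cong (punchIn u₀) eq) (sym a′))) (trans b (sym b′))
    ... | left a b  | right a′ b′ = contradiction (subst₂ Fin._<_ a (trans b (cong (punchIn u₀) eq)) (lhs<rhs c))
                                      (<⇒≯ (subst₂ Fin._<_ a′ b′ (lhs<rhs c′)))
    ... | right a b | left a′ b′  = contradiction (subst₂ Fin._<_ (trans a (cong (punchIn u₀) eq)) b (lhs<rhs c))
                                      (<⇒≯ (subst₂ Fin._<_ a′ b′ (lhs<rhs c′)))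

    y≢fill : ∀ u c i → y u ≢ fill c i
    y≢fill u c i eq with punchView u₀ u
    ... | same     = x∉Z (subst Z (trans (sym eq) y-u₀) (Zfill c i))
    ... | other i′ with i′ ∈ᴸ? J
    ...   | yes p = fill∉ℓ c i zero (subst (_∈ᴸ ℓ zero) (trans (sym (y-in i′)) eq) (y₁-J i′ p))
    ...   | no ¬p = fill∉ℓ c i (suc (σ i′)) (subst (_∈ᴸ ℓ′ i′) (trans (sym (y-in i′)) eq) (y₁-other i′ ¬p))

    fill-edge : ∀ c → ¬ Sp c → ∀ is → length is ≡ t → Unique (κ (lhs c) ∷ κ (rhs c) ∷ is) →
      Edge G (setOf (y (lhs c) ∷ y (rhs c) ∷ map (fill c) is))
    fill-edge c ¬s is len u = Z-edge (y (lhs c) ∷ y (rhs c) ∷ map (fill c) is)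
      (cong (2 +_) (trans (length-map (fill c) is) len))
      (subst Unique (sym (cong₂ _∷_ (proj₂ (y-Z l≢)) (cong₂ _∷_ (proj₂ (y-Z r≢)) colours))) u) Zl
      where
      l≢ : lhs c ≢ u₀
      l≢ = ¬s ∘ inj₁
      r≢ : rhs c ≢ u₀
      r≢ = ¬s ∘ inj₂
      colours : map χ (map (fill c) is) ≡ is
      colours = trans (sym (map-∘ is)) (trans (map-cong-∈ is λ {i} _ → χfill c i) (map-id is))
      Zl : ∀ {v} → v ∈ᴸ y (lhs c) ∷ y (rhs c) ∷ map (fill c) is → Z v
      Zl (here refl)         = proj₁ (y-Z l≢)
      Zl (there (here refl)) = proj₁ (y-Z r≢)
      Zl (there (there p))   = let i , _ , eq = ∈-map⁻ (fill c) p in subst Z (sym eq) (Zfill c i)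

  -- The vertex `x` plays the tip. The vertices of `J` sit on `ℓ zero`, so that `x` and `ℓ zero`
  -- form the edge at the tip; every other core vertex sits on its own list, which with `x` covers
  -- its pair with the tip. All remaining edges are rainbow and sampled.
  claimB-frame : Copy H G
  claimB-frame = frame-copy X G r≤m y y-inj core fill fill-inj y≢fill κ Sp Sp? (S ∘ o)
    (λ c s → S-length (o c) (o∉J c s)) S-edge (λ c _ → y∉S (o c))
    (λ {c} {c′} s s′ c≢ p q → ℓ-disjoint {suc (σ (o c))} {suc (σ (o c′))} (c≢ ∘ o-inj s s′ ∘ σ-inj ∘ Fin.suc-injective) (proj₁ (S⁻ (o c) p)) (proj₁ (S⁻ (o c′) q)))
    (λ c _ c′ i h → fill∉ℓ c′ i (suc (σ (o c))) (proj₁ (S⁻ (o c) h)))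
    (λ c ¬s eq → Fin.<⇒≢ (lhs<rhs c) (κ-inj (¬s ∘ inj₁) (¬s ∘ inj₂) eq)) fill-edge

claimB : ∀ {t M h} {F : RGraph (2 + t) (2 + M)} {H : RGraph (2 + t) h} (X : Extends F H) (tip : Tip F) (r≤m : 2 + t ≤ suc M)
  (G : RGraph (2 + t) n) (χ : Colouring n (suc M)) (x : Fin n) → SampleB G χ (Extends.#pairs′ X) x → Copy H G
claimB {n} {t} {M} X tip r≤m G χ x smp =
  -- Giving `J` colours that occur on `ℓ zero` allows its vertices to be found there.
  let σ , σ-inj , σJ = match J (take (length J) cs) J-unique (Unique.take⁺ (length J) (ℓ-rainbow zero))
                         (sym (trans (length-take (length J) cs) (m≤n⇒m⊓n≡m len≤)))
  in claimB-frame X tip r≤m G χ x smp σ σ-inj (λ i → proj₁ (pick σ σJ i (i ∈ᴸ? J)))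
       (λ i → proj₁ (proj₂ (pick σ σJ i (i ∈ᴸ? J))))
       (λ i → pick-J σ σJ i (i ∈ᴸ? J)) (λ i → pick-other σ σJ i (i ∈ᴸ? J))
  where
  open Tip tip
  open SampleB smp
  cs = map χ (ℓ zero)
  len≤ : length J ≤ length cs
  len≤ = ≤-trans J-small (≤-reflexive (sym (trans (length-map χ (ℓ zero)) (ℕ.suc-injective (ℓ-length zero)))))
  in-ℓ₀ : ∀ σ → map σ J ≡ take (length J) cs → ∀ i → i ∈ᴸ J → σ i ∈ᴸ cs
  in-ℓ₀ σ σJ i i∈ = ∈-take (length J) cs (subst (σ i ∈ᴸ_) σJ (∈-map⁺ σ i∈))
  Where : Set → List (Fin n) → List (Fin n) → Fin n → Set
  Where A xs ys v = (A → v ∈ᴸ xs) × (¬ A → v ∈ᴸ ys)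
  pick : ∀ σ → map σ J ≡ take (length J) cs → ∀ i → Dec (i ∈ᴸ J) → ∃[ v ] χ v ≡ σ i × Where (i ∈ᴸ J) (ℓ zero) (ℓ (suc (σ i))) v
  pick σ σJ i (yes p) = let v , v∈ , eq = ∈-map⁻ χ (in-ℓ₀ σ σJ i p) in v , sym eq , (λ _ → v∈) , λ ¬p → contradiction p ¬p
  pick σ σJ i (no ¬p) = let v , v∈ , eq = ∈-map⁻ χ (ℓ-colour (σ i)) in v , sym eq , (λ p → contradiction p ¬p) , λ _ → v∈
  pick-J : ∀ σ σJ i d → i ∈ᴸ J → proj₁ (pick σ σJ i d) ∈ᴸ ℓ zero
  pick-J σ σJ i d = proj₁ (proj₂ (proj₂ (pick σ σJ i d)))
  pick-other : ∀ σ σJ i d → i ∉ᴸ J → proj₁ (pick σ σJ i d) ∈ᴸ ℓ (suc (σ i))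
  pick-other σ σJ i d = proj₂ (proj₂ (proj₂ (pick σ σJ i d)))

-- A core vertex in at most one edge

module _ {t v m : ℕ} (F : RGraph (2 + t) v) where

  -- With at most `m` vertices in `F`, the last core vertex is an added isolated one.
  tip-of-isolated : (v≤1+m : v ≤ suc m) → v ≤ m → Tip (addIsolated v≤1+m F)
  tip-of-isolated v≤1+m v≤m = record
    { u₀        = Fin.fromℕ m
    ; J         = []
    ; J-unique  = []
    ; J-small   = z≤n
    ; edge-u₀   = λ h u₀∈ → contradiction (addIsolated-edge⁻ v≤1+m F h) λ { (e₀ , _ , refl) → last∉ e₀ u₀∈ }
    ; J-covered = λ ()
    }
    where
    last∉ : ∀ e₀ → Fin.fromℕ m ∉ padRight v≤1+m outside e₀
    last∉ e₀ h with ∈-pad⁻ v≤1+m e₀ h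
    ... | u , _ , eq = <⇒≱ (Fin.toℕ<n u) (≤-trans v≤m (≤-reflexive
      (trans (sym (Fin.toℕ-fromℕ m)) (trans (cong toℕ (sym eq)) (Fin.toℕ-inject≤ u v≤1+m)))))

module _ {t m : ℕ} (F : RGraph (2 + t) (suc m)) (v≤1+m : suc m ≤ suc m) (u : Fin (suc m)) where

  private
    incident : List (Subset (suc m))
    incident = filter (u ∈?_) (edges F)

    u₀ = inject≤ u v≤1+m

  tip-of-single : ∀ e* → incident ≡ e* ∷ [] → Tip (addIsolated v≤1+m F)
  tip-of-single e* eq = record
    { u₀        = u₀
    ; J         = J
    ; J-unique  = J-unique
    ; J-small   = ≤-reflexive J-length
    ; edge-u₀   = λ h u₀∈ → J-length , edge≡ h u₀∈
    ; J-covered = λ {i} i∈ → e′ , addIsolated-edge⁺ v≤1+m F e*-edge , u₀∈e′ , proj₂ (∈-filter⁻ (λ i → punchIn u₀ i ∈? e′) {xs = allFin m} i∈)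
    }
    where
    e′ = padRight v≤1+m outside e*
    e*∈ : e* ∈ᴸ incident
    e*∈ = subst (e* ∈ᴸ_) (sym eq) (here refl)
    e*-edge : Edge F e*
    e*-edge = ∈-edges⁻ F (proj₁ (∈-filter⁻ (u ∈?_) {xs = edges F} e*∈))
    u₀∈e′ : u₀ ∈ e′
    u₀∈e′ = ∈-pad⁺ v≤1+m (proj₂ (∈-filter⁻ (u ∈?_) {xs = edges F} e*∈))
    J = filter (λ i → punchIn u₀ i ∈? e′) (allFin m)
    J-unique : Unique J
    J-unique = Unique.filter⁺ (λ i → punchIn u₀ i ∈? e′) (Unique.allFin⁺ m)
    set≡ : setOf (u₀ ∷ map (punchIn u₀) J) ≡ e′
    set≡ = ext fwd (λ {w} → bwd (punchView u₀ w))
      where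
      fwd : ∀ {w} → w ∈ setOf (u₀ ∷ map (punchIn u₀) J) → w ∈ e′
      fwd h with ∈-setOf⁻ (u₀ ∷ map (punchIn u₀) J) h
      ... | here refl = u₀∈e′
      ... | there p with ∈-map⁻ (punchIn u₀) p
      ...   | i , i∈ , refl = proj₂ (∈-filter⁻ (λ i → punchIn u₀ i ∈? e′) {xs = allFin m} i∈)
      bwd : ∀ {w} → PunchView u₀ w → w ∈ e′ → w ∈ setOf (u₀ ∷ map (punchIn u₀) J)
      bwd same      h = ∈-setOf⁺ {l = u₀ ∷ map (punchIn u₀) J} (here refl)
      bwd (other i) h = ∈-setOf⁺ {l = u₀ ∷ map (punchIn u₀) J} (there (∈-map⁺ (punchIn u₀) (∈-filter⁺ (λ i → punchIn u₀ i ∈? e′) (∈-allFin i) h)))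
    list-unique : Unique (u₀ ∷ map (punchIn u₀) J)
    list-unique = All.map⁺ (All.tabulate λ {i} _ → Fin.punchInᵢ≢i u₀ i ∘ sym) ∷ Unique.map⁺ (Fin.punchIn-injective u₀ _ _) J-unique
    J-length : length J ≡ suc t
    J-length = ℕ.suc-injective (trans (cong suc (sym (length-map (punchIn u₀) J)))
      (trans (sym (Unique⇒∣setOf∣ list-unique)) (trans (cong ∣_∣ set≡) (uniform (addIsolated v≤1+m F) (addIsolated-edge⁺ v≤1+m F e*-edge)))))
    edge≡ : ∀ {e} → Edge (addIsolated v≤1+m F) e → u₀ ∈ e → e ≡ setOf (u₀ ∷ map (punchIn u₀) J)
    edge≡ h u₀∈ with addIsolated-edge⁻ v≤1+m F h
    ... | e₀ , h₀ , refl with ∈-pad⁻ v≤1+m e₀ u₀∈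
    ...   | u′ , u′∈ , eq′ with Fin.inject≤-injective v≤1+m v≤1+m u′ u eq′
    ...     | refl with subst (e₀ ∈ᴸ_) eq (∈-filter⁺ (u ∈?_) (∈-edges⁺ F h₀) u′∈)
    ...       | here refl = sym set≡

  tip-of-degree-1 : degree F u ≡ 1 → Tip (addIsolated v≤1+m F)
  tip-of-degree-1 = go incident refl
    where
    go : ∀ es → incident ≡ es → length es ≡ 1 → Tip (addIsolated v≤1+m F)
    go (e* ∷ []) eq _ = tip-of-single e* eq

tip : ∀ {t v m} (F : RGraph (2 + t) v) (v≤1+m : v ≤ suc m) → (v ≤ m) ⊎ ((v ≡ suc m) × (∃[ u ] (degree F u ≡ 1))) →
  Tip (addIsolated v≤1+m F)
tip F v≤1+m (inj₁ v≤m)              = tip-of-isolated F v≤1+m v≤m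
tip F v≤1+m (inj₂ (refl , u , deg)) = tip-of-degree-1 F v≤1+m u deg

-- Falling factorials and powers

E-ones : ∀ n k → E {n} (λ _ → 1) k ≡ n C k
E-ones n k = ≤-antisym
  (≤-trans (E-upper {n} k (λ _ → 1) λ _ → ≤-refl) (≤-reflexive (trans (cong ((n C k) *_) (^-zeroˡ k)) (*-identityʳ _))))
  (≤-trans (≤-reflexive (sym (trans (cong ((n C k) *_) (^-zeroˡ k)) (*-identityʳ _)))) (E-lower {n} k (λ _ → 1) λ _ → ≤-refl))

-- This is `E-∑` at the all-ones vector, where the elementary symmetric functions are binomial
-- coefficients.
falling-suc : ∀ n k → suc k ! * (suc n C suc k) ≡ suc n * (k ! * (n C k))
falling-suc n k = begin-equality
  suc k * k ! * (suc n C suc k)     ≡⟨ rearrange (suc k) (k !) _ ⟩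
  k ! * (suc k * (suc n C suc k))   ≡⟨ cong (λ x → k ! * (suc k * x)) (sym (E-ones (suc n) (suc k))) ⟩
  k ! * (suc k * E {suc n} (λ _ → 1) (suc k)) ≡⟨ cong (k ! *_) (E-∑ {n} (λ _ → 1) k) ⟩
  k ! * ∑ (λ (i : Fin (suc n)) → 1 * E {n} (λ _ → 1) k) ≡⟨ cong (k ! *_) (trans (∑-const (suc n) _) (cong (suc n *_) (trans (*-identityˡ _) (E-ones n k)))) ⟩
  k ! * (suc n * (n C k))           ≡⟨ rearrange′ (k !) (suc n) _ ⟩
  suc n * (k ! * (n C k))           ∎
  where
  rearrange : ∀ a b c → a * b * c ≡ b * (a * c)
  rearrange = solve-∀
  rearrange′ : ∀ a b c → a * (b * c) ≡ b * (a * c)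
  rearrange′ = solve-∀

falling-upper : ∀ n k → k ! * (n C k) ≤ n ^ k
falling-upper n       zero    = ≤-refl
falling-upper zero    (suc k) = ≤-reflexive (*-zeroʳ (suc k !))
falling-upper (suc n) (suc k) = begin
  suc k ! * (suc n C suc k)  ≡⟨ falling-suc n k ⟩
  suc n * (k ! * (n C k))    ≤⟨ *-monoʳ-≤ (suc n) (falling-upper n k) ⟩
  suc n * n ^ k              ≤⟨ *-monoʳ-≤ (suc n) (^-monoˡ-≤ k (n≤1+n n)) ⟩
  suc n * suc n ^ k          ∎

falling-lower : ∀ n k → (n ∸ k) ^ k ≤ k ! * (n C k)
falling-lower n       zero    = ≤-refl
falling-lower zero    (suc k) = z≤n
falling-lower (suc n) (suc k) = begin
  (n ∸ k) * (n ∸ k) ^ k      ≤⟨ *-mono-≤ (≤-trans (m∸n≤m n k) (n≤1+n n)) (falling-lower n k) ⟩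
  suc n * (k ! * (n C k))    ≡⟨ sym (falling-suc n k) ⟩
  suc k ! * (suc n C suc k)  ∎

falling≡P : ∀ {n k} → k ≤ n → k ! * (n C k) ≡ n Comb.P k
falling≡P {n} {k} k≤n = trans (cong (k ! *_) (nCk≡nPk/k! k≤n))
  (m*[n/m]≡n {{k !≢0}} (subst (k ! ∣_) (sym P≡P′) (k!∣nP′k k≤n)))
  where
  P≡P′ : n Comb.P k ≡ n Comb.P′ k
  P≡P′ with k ≤ᵇ n in eq
  ... | true  = refl
  ... | false = contradiction (subst T eq (≤⇒≤ᵇ k≤n)) id

C-pos : ∀ {n k} → k ≤ n → 0 < n C k
C-pos {n}     {zero}  _         = s≤s z≤n
C-pos {suc n} {suc k} (s≤s k≤n) = ≤-trans (C-pos k≤n) (≤-trans (m≤m+n _ _) (≤-reflexive (nCk+nC[k+1]≡[n+1]C[k+1] n k)))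

-- Bernoulli's inequality without division: it turns the shifts caused by floors and falling
-- factorials into error terms of lower order.
bernoulli : ∀ n m k → n ^ k ≤ (n ∸ m) ^ k + k * m * n ^ (k ∸ 1)
bernoulli n m zero    = ≤-refl
bernoulli n m (suc k) = begin
  n * n ^ k                                            ≤⟨ *-monoˡ-≤ (n ^ k) (≤-trans (m≤n+m∸n n m) (≤-reflexive (+-comm m (n ∸ m)))) ⟩
  (n ∸ m + m) * n ^ k                                  ≡⟨ *-distribʳ-+ (n ^ k) (n ∸ m) m ⟩
  (n ∸ m) * n ^ k + m * n ^ k                          ≤⟨ +-monoˡ-≤ (m * n ^ k) (*-monoʳ-≤ (n ∸ m) (bernoulli n m k)) ⟩
  (n ∸ m) * ((n ∸ m) ^ k + k * m * n ^ (k ∸ 1)) + m * n ^ k ≡⟨ cong (_+ m * n ^ k) (*-distribˡ-+ (n ∸ m) ((n ∸ m) ^ k) _) ⟩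
  (n ∸ m) * (n ∸ m) ^ k + (n ∸ m) * (k * m * n ^ (k ∸ 1)) + m * n ^ k ≤⟨ +-monoˡ-≤ (m * n ^ k) (+-monoʳ-≤ ((n ∸ m) * (n ∸ m) ^ k) (lower k)) ⟩
  (n ∸ m) * (n ∸ m) ^ k + k * m * n ^ k + m * n ^ k    ≡⟨ rearrange ((n ∸ m) * (n ∸ m) ^ k) k m (n ^ k) ⟩
  (n ∸ m) * (n ∸ m) ^ k + (m + k * m) * n ^ k          ∎
  where
  rearrange : ∀ a k m x → a + k * m * x + m * x ≡ a + (m + k * m) * x
  rearrange = solve-∀
  swap* : ∀ n a x → n * (a * x) ≡ a * (n * x)
  swap* = solve-∀
  lower : ∀ k → (n ∸ m) * (k * m * n ^ (k ∸ 1)) ≤ k * m * n ^ k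
  lower zero    = ≤-reflexive (*-zeroʳ (n ∸ m))
  lower (suc k) = ≤-trans (*-monoˡ-≤ (suc k * m * n ^ k) (m∸n≤m n m)) (≤-reflexive (swap* n (suc k * m) (n ^ k)))

-- From stability to a colouring with few edges that are not rainbow

ι : ℕ → ℚ
ι n = ℤ.+ n ℚ./ 1

private
  ι≃ : ∀ n → ℚ.toℚᵘ (ι n) ℚᵘ.≃ ℚᵘ.mkℚᵘ (ℤ.+ n) 0
  ι≃ n = ℚ.toℚᵘ-fromℚᵘ (ℚᵘ.mkℚᵘ (ℤ.+ n) 0)

/-*-ι : ∀ z b → (z ℚ./ suc b) ℚ.* ι (suc b) ≡ z ℚ./ 1
/-*-ι z b = ℚ.toℚᵘ-injective (ℚᵘ.≃-trans (ℚ.toℚᵘ-homo-* (z ℚ./ suc b) (ι (suc b)))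
  (ℚᵘ.≃-trans (ℚᵘ.*-cong (ℚ.toℚᵘ-fromℚᵘ (ℚᵘ.mkℚᵘ z b)) (ι≃ (suc b)))
  (ℚᵘ.≃-trans (ℚᵘ.*≡* (trans (ℤ.*-identityʳ _) (cong (λ x → z ℤ.* (ℤ.+ x)) (sym (*-identityʳ (suc b))))))
  (ℚᵘ.≃-sym (ℚ.toℚᵘ-fromℚᵘ (ℚᵘ.mkℚᵘ z 0))))))

ι-+ : ∀ a b → ι (a + b) ≡ ι a ℚ.+ ι b
ι-+ a b = ℚ.toℚᵘ-injective (ℚᵘ.≃-trans (ι≃ (a + b)) (ℚᵘ.≃-sym (ℚᵘ.≃-trans (ℚ.toℚᵘ-homo-+ (ι a) (ι b))
  (ℚᵘ.≃-trans (ℚᵘ.+-cong (ι≃ a) (ι≃ b)) (ℚᵘ.*≡* (cong (ℤ._* ℤ.1ℤ) (trans (cong₂ ℤ._+_ (ℤ.*-identityʳ (ℤ.+ a)) (ℤ.*-identityʳ (ℤ.+ b))) (sym (ℤ.pos-+ a b)))))))))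

ι-* : ∀ a b → ι (a * b) ≡ ι a ℚ.* ι b
ι-* a b = ℚ.toℚᵘ-injective (ℚᵘ.≃-trans (ι≃ (a * b)) (ℚᵘ.≃-sym (ℚᵘ.≃-trans (ℚ.toℚᵘ-homo-* (ι a) (ι b))
  (ℚᵘ.≃-trans (ℚᵘ.*-cong (ι≃ a) (ι≃ b)) (ℚᵘ.*≡* (cong (ℤ._* ℤ.1ℤ) (sym (ℤ.pos-* a b))))))))

/1-mono : ∀ {a b} → a ℤ.≤ b → a ℚ./ 1 ℚ.≤ b ℚ./ 1
/1-mono {a} {b} h = ℚ.toℚᵘ-cancel-≤ (ℚᵘ.≤-respˡ-≃ (ℚᵘ.≃-sym (ℚ.toℚᵘ-fromℚᵘ (ℚᵘ.mkℚᵘ a 0)))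
  (ℚᵘ.≤-respʳ-≃ (ℚᵘ.≃-sym (ℚ.toℚᵘ-fromℚᵘ (ℚᵘ.mkℚᵘ b 0))) (ℚᵘ.*≤* (ℤ.*-monoʳ-≤-nonNeg ℤ.1ℤ h))))

ι-mono : ∀ {a b} → a ≤ b → ι a ℚ.≤ ι b
ι-mono h = /1-mono (ℤ.+≤+ h)

ι-nonNeg : ∀ a → ℚ.NonNegative (ι a)
ι-nonNeg a = ℚ.nonNegative {ι a} (ι-mono {0} {a} z≤n)

ι-pos : ∀ a → ℚ.Positive (ι (suc a))
ι-pos a = ℚ.positive {ι (suc a)} (ℚ.<-≤-trans {0ℚ} {1ℚ} {ι (suc a)} (ℚ.positive⁻¹ 1ℚ) (ι-mono {1} {suc a} (s≤s z≤n)))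

-- A positive rational times its denominator is its numerator, which is at least 1.
archimedean : ∀ η → 0ℚ ℚ.< η → ∃[ q ] ι 1 ℚ.≤ η ℚ.* ι (suc q)
archimedean η@(mkℚ _ _ _) 0<η = ℚ.denominator-1 η , ℚ.≤-trans (/1-mono (num (ℚ.↥ η) (ℚ.positive 0<η)))
  (ℚ.≤-reflexive (trans (sym (/-*-ι (ℚ.↥ η) (ℚ.denominator-1 η))) (cong (ℚ._* ι (suc (ℚ.denominator-1 η))) (ℚ.↥p/↧p≡p η))))
  where
  num : ∀ z → ℤ.Positive z → ℤ.+ 1 ℤ.≤ z
  num (ℤ.+ suc k) _ = ℤ.+≤+ (s≤s z≤n)

-- With b and q for the two successors, the hypothesis is (a/b - 1/q) B + 1 ≤ s with denominators
-- cleared, and δ is at least 1/q. The summand 1 provides the gap required by the strict order of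
-- the reals.
density-ℚ : ∀ a b q B s (δ : ℚ) → ι 1 ℚ.≤ δ ℚ.* ι (suc q) → a * suc q * B + suc b * suc q ≤ s * (suc b * suc q) + suc b * B →
  ((ℤ.+ a ℚ./ suc b) ℚ.- δ) ℚ.* ι B ℚ.+ 1ℚ ℚ.≤ ι s
density-ℚ a b q B s δ δ≥ h = ℚ.*-cancelʳ-≤-pos (ι (suc b) ℚ.* ι (suc q)) {{ℚ.pos*pos⇒pos (ι (suc b)) {{ι-pos b}} (ι (suc q)) {{ι-pos q}}}} (ℚ.≤-trans
  (ℚ.≤-reflexive (trans
    (solve 5 (λ d δ B β κ → ((d :- δ) :* B :+ con 1ℚ) :* (β :* κ) := (d :* β) :* κ :* B :+ β :* κ :- (δ :* κ) :* (β :* B)) refl d δ (ι B) β κ)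
    (cong (λ x → x ℚ.* κ ℚ.* ι B ℚ.+ β ℚ.* κ ℚ.- (δ ℚ.* κ) ℚ.* (β ℚ.* ι B)) (/-*-ι (ℤ.+ a) b))))
  (ℚ.≤-trans
    (ℚ.+-mono-≤ (ℚ.≤-trans (ℚ.≤-reflexive (sym left≡)) (ℚ.≤-trans (ι-mono {a * suc q * B + suc b * suc q} {s * (suc b * suc q) + suc b * B} h) (ℚ.≤-reflexive right≡)))
      (ℚ.neg-antimono-≤ (ℚ.*-monoʳ-≤-nonNeg (β ℚ.* ι B) {{subst ℚ.NonNegative (ι-* (suc b) B) (ι-nonNeg (suc b * B))}} δ≥)))
    (ℚ.≤-reflexive (solve 4 (λ s β κ B → s :* (β :* κ) :+ β :* B :- con 1ℚ :* (β :* B) := s :* (β :* κ)) refl (ι s) β κ (ι B)))))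
  where
  open ℚSolver.+-*-Solver
  d = ℤ.+ a ℚ./ suc b
  β = ι (suc b)
  κ = ι (suc q)
  left≡ : ι (a * suc q * B + suc b * suc q) ≡ ι a ℚ.* κ ℚ.* ι B ℚ.+ β ℚ.* κ
  left≡ = trans (ι-+ (a * suc q * B) (suc b * suc q)) (cong₂ ℚ._+_ (trans (ι-* (a * suc q) B) (cong (ℚ._* ι B) (ι-* a (suc q)))) (ι-* (suc b) (suc q)))
  right≡ : ι (s * (suc b * suc q) + suc b * B) ≡ ι s ℚ.* (β ℚ.* κ) ℚ.+ β ℚ.* ι B
  right≡ = trans (ι-+ (s * (suc b * suc q)) (suc b * B)) (cong₂ ℚ._+_ (trans (ι-* s (suc b * suc q)) (cong (ι s ℚ.*_) (ι-* (suc b) (suc q)))) (ι-* (suc b) B))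

-- The real order is a negation: if the integer inequality failed, the two sides would differ by at
-- least `1 / suc q`, which is a witness of the opposite strict inequality.
≤ℝ⇒≤ : ∀ q s n → fromℕ s ≤ℝ fromℚ (ℤ.+ 1 ℚ./ suc q) *ℝ fromℕ n → suc q * s ≤ n
≤ℝ⇒≤ q s n h = ≮⇒≥ λ n<qs → h (ε , ℚ.positive⁻¹ ε {{ε-pos}} , 0 , λ _ _ →
  ℚ.*-cancelʳ-≤-pos (ι (suc q)) {{ι-pos q}} (ℚ.≤-trans (ℚ.≤-reflexive (lhs≡ n)) (ℚ.≤-trans (ι-mono {n + 1} {suc q * s} (≤-trans (≤-reflexive (+-comm n 1)) n<qs))
    (ℚ.≤-reflexive (trans (ι-* (suc q) s) (ℚ.*-comm (ι (suc q)) (ι s)))))))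
  where
  open ℚSolver.+-*-Solver
  ε = ℤ.+ 1 ℚ./ suc q
  ε-pos : ℚ.Positive ε
  ε-pos = ℚ.normalize-pos 1 (suc q)
  lhs≡ : ∀ n → (ε ℚ.* ι n ℚ.+ ε) ℚ.* ι (suc q) ≡ ι (n + 1)
  lhs≡ n = trans (solve 3 (λ ε n q → (ε :* n :+ ε) :* q := (ε :* q) :* n :+ ε :* q) refl ε (ι n) (ι (suc q)))
    (trans (cong (λ x → x ℚ.* ι n ℚ.+ x) (/-*-ι (ℤ.+ 1) q)) (trans (cong (ℚ._+ ι 1) (ℚ.*-identityˡ (ι n))) (sym (ι-+ n 1))))

*-^ : ∀ a b k → (a * b) ^ k ≡ a ^ k * b ^ k
*-^ a b zero    = refl
*-^ a b (suc k) = trans (cong (a * b *_) (*-^ a b k)) (rearrange a b (a ^ k) (b ^ k))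
  where
  rearrange : ∀ a b x y → a * b * (x * y) ≡ a * x * (b * y)
  rearrange = solve-∀

-- A lower bound for the ordered degree of the last vertex of the Turán graph on `n` vertices: among
-- the first `n ∸ 1` vertices every class has at least `(n ∸ 1) / suc M`.
minDegree : ℕ → ℕ → ℕ → ℕ
minDegree M d n = d ! * (M C d) * ((n ∸ 1) / suc M) ^ d

minDegree-lower : ∀ M d n → d ! * (M C d) * (n ∸ suc M) ^ d ≤ suc M ^ d * minDegree M d n
minDegree-lower M d n = begin
  d ! * (M C d) * (n ∸ suc M) ^ d          ≤⟨ *-monoʳ-≤ (d ! * (M C d)) (^-monoˡ-≤ d step) ⟩
  d ! * (M C d) * (suc M * q) ^ d          ≡⟨ cong (d ! * (M C d) *_) (*-^ (suc M) q d) ⟩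
  d ! * (M C d) * (suc M ^ d * q ^ d)      ≡⟨ rearrange (d ! * (M C d)) (suc M ^ d) (q ^ d) ⟩
  suc M ^ d * (d ! * (M C d) * q ^ d)      ∎
  where
  q = (n ∸ 1) / suc M
  rearrange : ∀ a b c → a * (b * c) ≡ b * (a * c)
  rearrange = solve-∀
  step : n ∸ suc M ≤ suc M * q
  step = begin
    n ∸ suc M                           ≡⟨ sym (∸-+-assoc n 1 M) ⟩
    n ∸ 1 ∸ M                           ≡⟨ cong (_∸ M) (m≡m%n+[m/n]*n (n ∸ 1) (suc M)) ⟩
    (n ∸ 1) % suc M + q * suc M ∸ M     ≤⟨ ∸-monoˡ-≤ M (+-monoˡ-≤ (q * suc M) (s≤s⁻¹ (m%n<n (n ∸ 1) (suc M)))) ⟩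
    M + q * suc M ∸ M                   ≡⟨ m+n∸m≡n M (q * suc M) ⟩
    q * suc M                           ≡⟨ *-comm q (suc M) ⟩
    suc M * q                           ∎

-- x is at least A n^d / m^d up to a lower-order term.
minDegree-★ : ∀ M t n x q → minDegree M (1 + t) n ≤ x → q * ((1 + t) ! * (M C (1 + t)) * ((1 + t) * suc M)) ≤ n →
  q * ((1 + t) ! * (M C (1 + t))) * n ^ (1 + t) ≤ q * (suc M ^ (1 + t) * x) + n ^ (1 + t)
minDegree-★ M t n x q h big = begin
  q * A * n ^ d                                  ≤⟨ *-monoʳ-≤ (q * A) (bernoulli n (suc M) d) ⟩
  q * A * ((n ∸ suc M) ^ d + d * suc M * n ^ t)  ≡⟨ rearrange q A ((n ∸ suc M) ^ d) (d * suc M) (n ^ t) ⟩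
  q * (A * (n ∸ suc M) ^ d) + q * (A * (d * suc M)) * n ^ t
    ≤⟨ +-mono-≤ (*-monoʳ-≤ q (≤-trans (minDegree-lower M d n) (*-monoʳ-≤ (suc M ^ d) h))) (*-monoˡ-≤ (n ^ t) big) ⟩
  q * (suc M ^ d * x) + n * n ^ t                ∎
  where
  d = 1 + t
  A = d ! * (M C d)
  rearrange : ∀ q a x c y → q * a * (x + c * y) ≡ q * (a * x) + q * (a * c) * y
  rearrange = solve-∀

turán-P : ∀ M t → 2 + t ≤ suc M → suc M Comb.P (2 + t) ≡ suc M * ((1 + t) ! * (M C (1 + t)))
turán-P M t r≤m = trans (sym (falling≡P r≤m)) (falling-suc M (1 + t))

-- Every quantity is multiplied out, so that the density bound is an inequality between natural numbers.
density-ℕ : ∀ M t (r≤m : 2 + t ≤ suc M) B₁ q n s → 0 < n →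
  n * minDegree M (1 + t) n ≤ (2 + t) ! * s + B₁ * n ^ (1 + t) →
  let a = suc M Comb.P (2 + t) ; b = suc M ^ (2 + t) in
  q * b * B₁ + a * q * ((1 + t) * suc M) + (2 + t) ! * (b * q) + b * ((2 + t) * (2 + t)) ≤ n →
  a * q * (n C (2 + t)) + b * q ≤ s * (b * q) + b * (n C (2 + t))
density-ℕ M t r≤m B₁ q n s 0<n deg big = *-cancelˡ-≤ ((2 + t) !) {{(2 + t) !≢0}} (begin
  ρ * (a * q * B + b * q)
    ≡⟨ rearrange₁ ρ (a * q) B (b * q) ⟩
  a * q * (ρ * B) + ρ * (b * q)
    ≤⟨ +-monoˡ-≤ (ρ * (b * q)) (*-monoʳ-≤ (a * q) (falling-upper n (2 + t))) ⟩
  a * q * n ^ (2 + t) + ρ * (b * q)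
    ≤⟨ +-mono-≤ part₁ (≤-trans (≤-reflexive (sym (*-identityʳ _))) (*-monoʳ-≤ (ρ * (b * q)) (m^n>0 n {{>-nonZero 0<n}} d))) ⟩
  q * (b * (ρ * s)) + (q * b * B₁ + a * q * (d * m′)) * n ^ d + ρ * (b * q) * n ^ d
    ≡⟨ rearrange₂ (q * (b * (ρ * s))) (q * b * B₁ + a * q * (d * m′)) (ρ * (b * q)) (n ^ d) ⟩
  q * (b * (ρ * s)) + (q * b * B₁ + a * q * (d * m′) + ρ * (b * q)) * n ^ d
    ≤⟨ +-monoʳ-≤ (q * (b * (ρ * s))) (+-cancelʳ-≤ (b * (r′ * r′) * n ^ d) _ _ part₂) ⟩
  q * (b * (ρ * s)) + b * (n ∸ r′) ^ r′
    ≤⟨ +-monoʳ-≤ (q * (b * (ρ * s))) (*-monoʳ-≤ b (falling-lower n r′)) ⟩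
  q * (b * (ρ * s)) + b * (ρ * B)
    ≡⟨ rearrange₃ q b ρ s B ⟩
  ρ * (s * (b * q) + b * B) ∎)
  where
  r′ = 2 + t
  d = 1 + t
  m′ = suc M
  ρ = r′ !
  a = m′ Comb.P r′
  b = m′ ^ r′
  B = n C r′
  A = d ! * (M C d)
  rearrange₁ : ∀ ρ aq B bq → ρ * (aq * B + bq) ≡ aq * (ρ * B) + ρ * bq
  rearrange₁ = solve-∀
  rearrange₂ : ∀ x y z w → x + y * w + z * w ≡ x + (y + z) * w
  rearrange₂ = solve-∀
  rearrange₃ : ∀ q b ρ s B → q * (b * (ρ * s)) + b * (ρ * B) ≡ ρ * (s * (b * q) + b * B)
  rearrange₃ = solve-∀
  part₁ : a * q * n ^ r′ ≤ q * (b * (ρ * s)) + (q * b * B₁ + a * q * (d * m′)) * n ^ d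
  part₁ = begin
    a * q * (n * n ^ d)
      ≤⟨ *-monoʳ-≤ (a * q) (*-monoʳ-≤ n (bernoulli n m′ d)) ⟩
    a * q * (n * ((n ∸ m′) ^ d + d * m′ * n ^ t))
      ≡⟨ cong (λ x → x * q * (n * ((n ∸ m′) ^ d + d * m′ * n ^ t))) (turán-P M t r≤m) ⟩
    m′ * A * q * (n * ((n ∸ m′) ^ d + d * m′ * n ^ t))
      ≡⟨ eq₁ m′ A q n ((n ∸ m′) ^ d) (d * m′) (n ^ t) ⟩
    q * m′ * n * (A * (n ∸ m′) ^ d) + m′ * A * q * (d * m′) * (n * n ^ t)
      ≤⟨ +-monoˡ-≤ _ (*-monoʳ-≤ (q * m′ * n) (minDegree-lower M d n)) ⟩
    q * m′ * n * (m′ ^ d * minDegree M d n) + m′ * A * q * (d * m′) * n ^ d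
      ≡⟨ cong₂ _+_ (eq₂ q m′ n (m′ ^ d) (minDegree M d n)) (cong (λ x → x * q * (d * m′) * n ^ d) (sym (turán-P M t r≤m))) ⟩
    q * b * (n * minDegree M d n) + a * q * (d * m′) * n ^ d
      ≤⟨ +-monoˡ-≤ _ (*-monoʳ-≤ (q * b) deg) ⟩
    q * b * (ρ * s + B₁ * n ^ d) + a * q * (d * m′) * n ^ d
      ≡⟨ eq₃ q b (ρ * s) B₁ (n ^ d) (a * q * (d * m′)) ⟩
    q * (b * (ρ * s)) + (q * b * B₁ + a * q * (d * m′)) * n ^ d ∎
    where
    eq₁ : ∀ m′ A q n x c y → m′ * A * q * (n * (x + c * y)) ≡ q * m′ * n * (A * x) + m′ * A * q * c * (n * y)
    eq₁ = solve-∀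
    eq₂ : ∀ q m′ n x y → q * m′ * n * (x * y) ≡ q * (m′ * x) * (n * y)
    eq₂ = solve-∀
    eq₃ : ∀ q b x c y z → q * b * (x + c * y) + z * y ≡ q * (b * x) + (q * b * c + z) * y
    eq₃ = solve-∀
  -- All terms of order `n ^ d` are collected in `n * n ^ d` by `big`; its last summand pays for
  -- replacing `n ^ r′` by `(n ∸ r′) ^ r′`.
  part₂ : (q * b * B₁ + a * q * (d * m′) + ρ * (b * q)) * n ^ d + b * (r′ * r′) * n ^ d ≤ b * (n ∸ r′) ^ r′ + b * (r′ * r′) * n ^ d
  part₂ = begin
    (q * b * B₁ + a * q * (d * m′) + ρ * (b * q)) * n ^ d + b * (r′ * r′) * n ^ d
      ≡⟨ sym (*-distribʳ-+ (n ^ d) (q * b * B₁ + a * q * (d * m′) + ρ * (b * q)) (b * (r′ * r′))) ⟩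
    (q * b * B₁ + a * q * (d * m′) + ρ * (b * q) + b * (r′ * r′)) * n ^ d
      ≤⟨ *-monoˡ-≤ (n ^ d) big ⟩
    n * n ^ d
      ≤⟨ ≤-trans (≤-reflexive (sym (*-identityˡ _))) (*-monoˡ-≤ (n * n ^ d) (m^n>0 m′ r′)) ⟩
    b * n ^ r′
      ≤⟨ *-monoʳ-≤ b (bernoulli n r′ r′) ⟩
    b * ((n ∸ r′) ^ r′ + r′ * r′ * n ^ d)
      ≡⟨ eq b ((n ∸ r′) ^ r′) (r′ * r′) (n ^ d) ⟩
    b * (n ∸ r′) ^ r′ + b * (r′ * r′) * n ^ d ∎
    where
    eq : ∀ b x c y → b * (x + c * y) ≡ b * x + b * c * y
    eq = solve-∀

deg : ∀ {t} → RGraph (2 + t) n → Fin n → ℕ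
deg {t = t} G x = ∑ᴸ (1 + t) ([ G ]ᴱ ∘ (x ∷_))

bad : RGraph r n → Colouring n m → List (Fin n) → ℕ
bad G χ l = 𝟙 (edge? G (setOf l) ×-dec ¬? (rainbow? χ l))

-- A non-rainbow edge of `G` is either lost on the way to `G′` or meets `S`. By the last two
-- hypotheses each kind accounts for at most a 1/(2q) fraction of all lists.
clean-colouring : ∀ {t q} (G G′ : RGraph (2 + t) n) → G′ ⊑ G → (S : Subset n) (χ : Colouring n m) →
  (∀ {e} → Edge (deleteVertices G′ S) e → Transversal χ e) → ∀ B₁ → D G ≤ D G′ + B₁ * n ^ (1 + t) →
  (q + q) * B₁ ≤ n → (q + q) * (∣ S ∣ * (2 + t)) ≤ n → q * ∑ᴸ (2 + t) (bad G χ) ≤ n ^ (2 + t)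
clean-colouring {n} {t = t} {q} G G′ sub S χ trv B₁ loss q₁ q₂ = *-cancelˡ-≤ 2 (begin
  2 * (q * ∑ᴸ r′ (bad G χ))
    ≤⟨ *-monoʳ-≤ 2 (*-monoʳ-≤ q (+-cancelʳ-≤ (D G′) _ _ bound)) ⟩
  2 * (q * (B₁ * n ^ d + ∣ S ∣ * r′ * n ^ d))
    ≡⟨ eq q B₁ (n ^ d) (∣ S ∣ * r′) ⟩
  (q + q) * B₁ * n ^ d + (q + q) * (∣ S ∣ * r′) * n ^ d
    ≤⟨ +-mono-≤ (*-monoˡ-≤ (n ^ d) q₁) (*-monoˡ-≤ (n ^ d) q₂) ⟩
  n * n ^ d + n * n ^ d
    ≡⟨ cong (n * n ^ d +_) (sym (+-identityʳ _)) ⟩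
  2 * n ^ r′ ∎)
  where
  r′ = 2 + t
  d = 1 + t
  eq : ∀ q b x c → 2 * (q * (b * x + c * x)) ≡ (q + q) * b * x + (q + q) * c * x
  eq = solve-∀
  W = elements S
  good : ∀ l → length l ≡ r′ → Edge G′ (setOf l) → ¬ Meets W l → Rainbow χ l
  good l len h ¬m = Transversal⇒Rainbow χ l (edge⇒Unique G′ l len h)
    (trv (Bool.T-∧ .Equivalence.from (h , fromWitness {a? = setOf l ⊆? ∁ S} avoid)))
    where
    avoid : ∀ {v} → v ∈ setOf l → v ∈ ∁ S
    avoid {v} v∈ = x∉p⇒x∈∁p λ v∈S → ¬m (Any.map (λ { refl → ∈-setOf⁻ l v∈ }) (∈-elements⁺ v∈S))
  point : ∀ l → length l ≡ r′ → bad G χ l + [ G′ ]ᴱ l ≤ [ G ]ᴱ l + 𝟙 (meets? W l)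
  point l len = go (rainbow? χ l) (edge? G (setOf l)) (edge? G′ (setOf l)) (meets? W l) id id sub (good l len)
    where
    go : ∀ {R′ E₁ E₂ T : Set} (ρ : Dec R′) (g : Dec E₁) (g′ : Dec E₂) (τ : Dec T) → (R′ → R′) → (E₁ → E₁) → (E₂ → E₁) → (E₂ → ¬ T → R′) →
      𝟙 (g ×-dec ¬? ρ) + 𝟙 g′ ≤ 𝟙 g + 𝟙 τ
    go ρ       (no ¬g) (yes g′) τ        _ _ s h = contradiction (s g′) ¬g
    go ρ       (no ¬g) (no _)   τ        _ _ s h = z≤n
    go (yes _) (yes _) g′       τ        _ _ s h = ≤-trans (𝟙≤1 g′) (m≤m+n 1 _)
    go (no ¬ρ) (yes _) (no _)   τ        _ _ s h = m≤m+n 1 _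
    go (no ¬ρ) (yes _) (yes g′) (yes _)  _ _ s h = ≤-refl
    go (no ¬ρ) (yes _) (yes g′) (no ¬τ)  _ _ s h = contradiction (h g′ ¬τ) ¬ρ
  bound : ∑ᴸ r′ (bad G χ) + D G′ ≤ B₁ * n ^ d + ∣ S ∣ * r′ * n ^ d + D G′
  bound = begin
    ∑ᴸ r′ (bad G χ) + D G′                   ≡⟨ sym (∑ᴸ-+ r′ (bad G χ) [ G′ ]ᴱ) ⟩
    ∑ᴸ r′ (λ l → bad G χ l + [ G′ ]ᴱ l)      ≤⟨ ∑ᴸ-mono r′ point ⟩
    ∑ᴸ r′ (λ l → [ G ]ᴱ l + 𝟙 (meets? W l))  ≡⟨ ∑ᴸ-+ r′ [ G ]ᴱ (λ l → 𝟙 (meets? W l)) ⟩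
    D G + ∑ᴸ r′ (λ l → 𝟙 (meets? W l))       ≤⟨ +-mono-≤ loss (≤-trans (count-meets r′ W) (≤-reflexive (trans (sym (*-assoc (length W) r′ _)) (cong (λ x → x * r′ * n ^ d) (length-elements S))))) ⟩
    D G′ + B₁ * n ^ d + ∣ S ∣ * r′ * n ^ d   ≡⟨ eq′ (D G′) (B₁ * n ^ d) _ ⟩
    B₁ * n ^ d + ∣ S ∣ * r′ * n ^ d + D G′   ∎
    where
    eq′ : ∀ a b c → a + b + c ≡ b + c + a
    eq′ = solve-∀

Copy-mono : ∀ {t h} {H : RGraph (2 + t) h} {G′ G : RGraph (2 + t) n} → G′ ⊑ G → Copy H G′ → Copy H G
Copy-mono sub c = record { embed = embed c ; injective = injective c ; preserves = λ h → sub (preserves c h) }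

module _ {t v M : ℕ} (F : RGraph (2 + t) v) (v≤p : v ≤ suc (suc M)) (2≤r : 2 ≤ 2 + t) (r≤m : 2 + t ≤ suc M) (st : Stable F (suc M)) where

  private
    loss : ℕ
    loss = (2 + t) * ((1 + t) * ((2 + M + #pairs (addIsolated v≤p F) * t) * t))

    -- n² light pairs, each destroying at most (2 + t) (1 + t) T edges, T = s t n^(t-1).
    total-loss : ∀ n s → n * n * ((2 + t) * ((1 + t) * (s * (t * n ^ (t ∸ 1))))) ≤ (2 + t) * ((1 + t) * (s * t)) * n ^ (1 + t)
    total-loss n s = go t
      where
      eq : ∀ n a b s t x → n * n * (a * (b * (s * (t * x)))) ≡ a * (b * (s * t)) * (n * (n * x))
      eq = solve-∀
      go : ∀ t → n * n * ((2 + t) * ((1 + t) * (s * (t * n ^ (t ∸ 1))))) ≤ (2 + t) * ((1 + t) * (s * t)) * n ^ (1 + t)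
      go zero    = ≤-trans (≤-reflexive (trans (cong (λ x → n * n * (2 * (1 * x))) (*-zeroʳ s)) (*-zeroʳ (n * n)))) z≤n
      go (suc t) = ≤-reflexive (eq n (3 + t) (2 + t) s (suc t) (n ^ t))

    K-free : ∀ {n} (G G′ : RGraph (2 + t) n) → G′ ⊑ G →
      Clean ((2 + M + #pairs (addIsolated v≤p F) * t) * (t * n ^ (t ∸ 1))) G′ →
      Free (Ext (addIsolated v≤p F) 2≤r) G → KFree F (suc (suc M)) G′
    K-free G G′ sub cl free H inK c = free (Copy-mono {G′ = G′} {G} sub (Core⇒Copy (addIsolated v≤p F) 2≤r G′ cl (InK⇒Core v≤p F inK c)))

  degree-sum : ∀ {n} (G : RGraph (2 + t) n) x → (∀ v → x ≤ deg G v) → n * x ≤ D G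
  degree-sum {n} G x h = ≤-trans (≤-reflexive (sym (∑-const n x))) (∑-mono h)

  stable⇒colouring : ∀ q → ∃[ N ] (∀ {n} → N ≤ n → (G : RGraph (2 + t) n) → Free (Ext (addIsolated v≤p F) 2≤r) G →
    (∀ x → minDegree M (1 + t) n ≤ deg G x) →
    Σ[ χ ∈ Colouring n (suc M) ] q * ∑ᴸ (2 + t) (bad G χ) ≤ n ^ (2 + t))
  stable⇒colouring q = N , λ {n} N≤n G free degs → result n N≤n G free degs (clean _ (n * n) G (≤-trans (∑-mono λ u → ∑-bound λ w → 𝟙≤1 (0 <? codegree G u w)) (≤-reflexive (trans (∑-const n (n * 1)) (cong (n *_) (*-identityʳ n))))))
    where
    ε : ℚ
    -- At most `(2 + t) * n ^ (1 + t)` lists pass through a given vertex of `S`, and together these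
    -- may use up half of the allowed fraction 1/q.
    ε = ℤ.+ 1 ℚ./ suc ((q + q) * (2 + t))
    ε-pos : ℚ.Positive ε
    ε-pos = ℚ.normalize-pos 1 (suc ((q + q) * (2 + t)))
    0<ε : 0ℝ <ℝ fromℚ ε
    0<ε = ε , ℚ.positive⁻¹ ε {{ε-pos}} , 0 , λ _ _ → ℚ.≤-reflexive (ℚ.+-identityˡ ε)
    st-ε = Stable.stable st (fromℚ ε) 0<ε
    δ₁ : ℝ
    δ₁ = proj₁ st-ε
    -- Positivity of the real `δ₁` supplies a rational `η` that its sequence reaches from index `N₀`
    -- on.
    η = proj₁ (proj₁ (proj₂ st-ε))
    0<η = proj₁ (proj₂ (proj₁ (proj₂ st-ε)))
    N₀ = proj₁ (proj₂ (proj₂ (proj₁ (proj₂ st-ε))))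
    η≤ = proj₂ (proj₂ (proj₂ (proj₁ (proj₂ st-ε))))
    n₁ = proj₁ (proj₂ (proj₂ st-ε))
    use = proj₂ (proj₂ (proj₂ st-ε))
    κ = proj₁ (archimedean η 0<η)
    κ-good = proj₂ (archimedean η 0<η)
    a = suc M Comb.P (2 + t)
    b = suc M ^ (2 + t)
    N₂ : ℕ
    N₂ = suc κ * b * loss + a * suc κ * ((1 + t) * suc M) + (2 + t) ! * (b * suc κ) + b * ((2 + t) * (2 + t))
    N : ℕ
    N = suc (n₁ + N₂ + (q + q) * loss)
    δ₁≥ : ∀ i → N₀ ≤ i → ι 1 ℚ.≤ seq δ₁ i ℚ.* ι (suc κ)
    δ₁≥ i le = ℚ.≤-trans κ-good (ℚ.*-monoʳ-≤-nonNeg (ι (suc κ)) {{ι-nonNeg (suc κ)}}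
      (ℚ.≤-trans (ℚ.≤-reflexive (sym (ℚ.+-identityˡ η))) (η≤ i le)))
    dense : ∀ n s → a * suc κ * (n C (2 + t)) + b * suc κ ≤ s * (b * suc κ) + b * (n C (2 + t)) →
      (turánDensity (2 + t) (suc M) -ℝ δ₁) *ℝ fromℕ (n C (2 + t)) <ℝ fromℕ s
    dense n s h = 1ℚ , ℚ.positive⁻¹ 1ℚ , N₀ , λ i le → bound b {{m^n≢0 (suc M) (2 + t)}} (m^n>0 (suc M) (2 + t)) h i le
      where
      -- The power `suc M ^ (2 + t)` is abstracted so that it can be matched as a successor, the
      -- form in which `density-ℚ` has its denominator.
      bound : ∀ b .{{_ : NonZero b}} → 0 < b → a * suc κ * (n C (2 + t)) + b * suc κ ≤ s * (b * suc κ) + b * (n C (2 + t)) →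
        ∀ i → N₀ ≤ i → ((ℤ.+ a ℚ./ b) ℚ.- seq δ₁ i) ℚ.* ι (n C (2 + t)) ℚ.+ 1ℚ ℚ.≤ ι s
      bound (suc b′) _ h i le = density-ℚ a b′ κ (n C (2 + t)) s (seq δ₁ i) (δ₁≥ i le) h
    result : ∀ n → N ≤ n → (G : RGraph (2 + t) n) → Free (Ext (addIsolated v≤p F) 2≤r) G → (∀ x → minDegree M (1 + t) n ≤ deg G x) →
      let T = (2 + M + #pairs (addIsolated v≤p F) * t) * (t * n ^ (t ∸ 1)) in
      (Σ[ G′ ∈ RGraph (2 + t) n ] G′ ⊑ G × Clean T G′ × D G ≤ D G′ + n * n * ((2 + t) * ((1 + t) * T))) →
      Σ[ χ ∈ Colouring n (suc M) ] q * ∑ᴸ (2 + t) (bad G χ) ≤ n ^ (2 + t)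
    result n N≤n G free degs (G′ , sub , cl , lossG) = colour (use
        (≤-trans (≤-trans (m≤m+n n₁ N₂) (≤-trans (m≤m+n (n₁ + N₂) _) (n≤1+n _))) N≤n) G′ (K-free G G′ sub cl free)
        (dense n (size G′) (density-ℕ M t r≤m loss (suc κ) n (size G′) (≤-trans (s≤s z≤n) N≤n)
          (≤-trans (degree-sum G _ degs) (subst (λ x → D G ≤ x + loss * n ^ (1 + t)) (D≡r!*size G′) lossG′))
          (≤-trans (≤-trans (m≤n+m N₂ n₁) (≤-trans (m≤m+n (n₁ + N₂) _) (n≤1+n _))) N≤n))))
      where
      lossG′ : D G ≤ D G′ + loss * n ^ (1 + t)
      lossG′ = ≤-trans lossG (+-monoʳ-≤ (D G′) (total-loss n (2 + M + #pairs (addIsolated v≤p F) * t)))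
      colour : (Σ[ S ∈ Subset n ] fromℕ ∣ S ∣ ≤ℝ fromℚ ε *ℝ fromℕ n × Partite (suc M) (deleteVertices G′ S)) →
        Σ[ χ ∈ Colouring n (suc M) ] q * ∑ᴸ (2 + t) (bad G χ) ≤ n ^ (2 + t)
      colour (S , small , χ , trv) = χ , clean-colouring {q = q} G G′ sub S χ trv loss lossG′
        (≤-trans (≤-trans (m≤n+m _ (n₁ + N₂)) (n≤1+n _)) N≤n)
        (≤-trans (≤-trans (≤-reflexive (eq (q + q) ∣ S ∣ (2 + t))) (m≤n+m _ ∣ S ∣)) (≤ℝ⇒≤ ((q + q) * (2 + t)) ∣ S ∣ n small))
        where
        eq : ∀ q s r → q * (s * r) ≡ q * r * s
        eq = solve-∀

-- Almost all vertices miss few rainbow links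

∑ˡ-tabulate : ∀ {A : Set} (f : A → ℕ) (g : Fin n → A) → ∑ˡ f (List.tabulate g) ≡ ∑ (f ∘ g)
∑ˡ-tabulate {zero}  f g = refl
∑ˡ-tabulate {suc n} f g = cong (f (g zero) +_) (∑ˡ-tabulate f (g ∘ suc))

-- With m = M + 1: a class larger than n/m + n/Q leaves the other M classes an average of at most (1
-- - 1/Q) n/m. Rounding that average up to `b` costs M, which the difference between n/(QM) and
-- n/(Qm) absorbs.
part-excess : ∀ M Q b a n → 0 < M → M * b + a ≤ n + M → (Q + suc M) * n < Q * suc M * a → Q * suc M * M ≤ n →
  Q * suc M * b + n ≤ Q * n
part-excess M Q b a n 0<M h₁ h₂ h₃ = *-cancelˡ-≤ M {{>-nonZero 0<M}} (+-cancelʳ-≤ (Q * n + n) _ _ (begin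
  M * (Q * suc M * b + n) + (Q * n + n)             ≡⟨ eq₁ M Q b n ⟩
  Q * suc M * (M * b) + (Q + suc M) * n             ≤⟨ +-monoʳ-≤ (Q * suc M * (M * b)) (<⇒≤ h₂) ⟩
  Q * suc M * (M * b) + Q * suc M * a               ≡⟨ sym (*-distribˡ-+ (Q * suc M) (M * b) a) ⟩
  Q * suc M * (M * b + a)                           ≤⟨ *-monoʳ-≤ (Q * suc M) h₁ ⟩
  Q * suc M * (n + M)                               ≡⟨ *-distribˡ-+ (Q * suc M) n M ⟩
  Q * suc M * n + Q * suc M * M                     ≤⟨ +-monoʳ-≤ (Q * suc M * n) h₃ ⟩
  Q * suc M * n + n                                 ≡⟨ eq₂ Q M n ⟩
  M * (Q * n) + (Q * n + n)                         ∎))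
  where
  eq₁ : ∀ M Q b n → M * (Q * suc M * b + n) + (Q * n + n) ≡ Q * suc M * (M * b) + (Q + suc M) * n
  eq₁ = solve-∀
  eq₂ : ∀ Q M n → Q * suc M * n + n ≡ M * (Q * n) + (Q * n + n)
  eq₂ = solve-∀

-- If b is at most (1 - 1/Q) n/m, then A b^d is below A (n/m)^d by at least the factor 1 - 1/Q,
-- since a number in [0, 1] is at least its d-th power.
power-gap : ∀ t m Q b n A f → Q * m * b + n ≤ Q * n → f ≤ A * b ^ (1 + t) →
  Q * (m ^ (1 + t) * f) + A * n ^ (1 + t) ≤ Q * A * n ^ (1 + t)
power-gap t m zero    b zero    A f h f≤ = ≤-reflexive (*-zeroʳ A)
power-gap t m zero    b (suc n) A f () f≤
power-gap t m (suc Q) b n A f h f≤ = begin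
  suc Q * (m ^ d * f) + A * n ^ d           ≤⟨ +-monoˡ-≤ (A * n ^ d) (*-monoʳ-≤ (suc Q) (*-monoʳ-≤ (m ^ d) f≤)) ⟩
  suc Q * (m ^ d * (A * b ^ d)) + A * n ^ d ≡⟨ cong (_+ A * n ^ d) (eq₁ (suc Q) (m ^ d) A (b ^ d)) ⟩
  A * (suc Q * (m ^ d * b ^ d)) + A * n ^ d ≤⟨ +-monoˡ-≤ (A * n ^ d) (*-monoʳ-≤ A key) ⟩
  A * (Q * n ^ d) + A * n ^ d               ≡⟨ eq₂ A Q (n ^ d) ⟩
  suc Q * A * n ^ d                         ∎
  where
  d = 1 + t
  eq₁ : ∀ q x a y → q * (x * (a * y)) ≡ a * (q * (x * y))
  eq₁ = solve-∀
  eq₂ : ∀ a q x → a * (q * x) + a * x ≡ suc q * a * x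
  eq₂ = solve-∀
  eq₃ : ∀ x q z → x * (q * z) ≡ q * x * z
  eq₃ = solve-∀
  eq₄ : ∀ x q z → q * x * z ≡ x * (q * z)
  eq₄ = solve-∀
  key : suc Q * (m ^ d * b ^ d) ≤ Q * n ^ d
  key = *-cancelˡ-≤ (suc Q ^ t) {{m^n≢0 (suc Q) t}} (begin
    suc Q ^ t * (suc Q * (m ^ d * b ^ d)) ≡⟨ eq₃ (suc Q ^ t) (suc Q) (m ^ d * b ^ d) ⟩
    suc Q ^ d * (m ^ d * b ^ d)           ≡⟨ sym (trans (*-^ (suc Q * m) b d) (trans (cong (_* b ^ d) (*-^ (suc Q) m d)) (*-assoc (suc Q ^ d) (m ^ d) (b ^ d)))) ⟩
    (suc Q * m * b) ^ d                   ≤⟨ ^-monoˡ-≤ d (+-cancelʳ-≤ n _ _ (≤-trans h (≤-reflexive (+-comm n (Q * n))))) ⟩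
    (Q * n) ^ d                           ≡⟨ *-^ Q n d ⟩
    Q * Q ^ t * n ^ d                     ≤⟨ *-monoˡ-≤ (n ^ d) (*-monoʳ-≤ Q (^-monoˡ-≤ t (n≤1+n Q))) ⟩
    Q * suc Q ^ t * n ^ d                 ≡⟨ eq₄ (suc Q ^ t) Q (n ^ d) ⟩
    suc Q ^ t * (Q * n ^ d)               ∎)

-- In units of `X`, the degree bound and the non-rainbow edges lose at most 1/(3Q) each, whereas the
-- gap is A/Q, at least 1/Q.
gap-absurd : ∀ Q A L X δ β f Q₂ → 0 < A → 0 < X → 3 * Q * A * X ≤ 3 * Q * (L * δ) + X → δ ≤ β + f → Q₂ * β ≤ X → 3 * (Q * L) ≤ Q₂ →
  Q * (L * f) + A * X ≤ Q * A * X → P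
gap-absurd Q A L X δ β f Q₂ 0<A 0<X h₁ h₂ h₃ h₄ h₅ = contradiction (+-cancelʳ-≤ (3 * (Q * (L * f))) _ _ (begin
  3 * X + 3 * (Q * (L * f))                ≤⟨ +-monoˡ-≤ _ (*-monoʳ-≤ 3 (m≤n*m X A {{>-nonZero 0<A}})) ⟩
  3 * (A * X) + 3 * (Q * (L * f))          ≡⟨ eq₁ (A * X) (Q * (L * f)) ⟩
  3 * (Q * (L * f) + A * X)                ≤⟨ *-monoʳ-≤ 3 h₅ ⟩
  3 * (Q * A * X)                          ≡⟨ eq₂ Q A X ⟩
  3 * Q * A * X                            ≤⟨ h₁ ⟩
  3 * Q * (L * δ) + X                      ≤⟨ +-monoˡ-≤ X (*-monoʳ-≤ (3 * Q) (*-monoʳ-≤ L h₂)) ⟩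
  3 * Q * (L * (β + f)) + X                ≡⟨ eq₃ Q L β f X ⟩
  3 * (Q * L) * β + 3 * (Q * (L * f)) + X  ≤⟨ +-monoˡ-≤ X (+-monoˡ-≤ _ (≤-trans (*-monoˡ-≤ β h₄) h₃)) ⟩
  X + 3 * (Q * (L * f)) + X                ≡⟨ eq₄ X (3 * (Q * (L * f))) ⟩
  2 * X + 3 * (Q * (L * f))                ∎)) (<⇒≱ (*-monoˡ-< X {{>-nonZero 0<X}} {2} {3} ≤-refl))
  where
  eq₁ : ∀ x y → 3 * x + 3 * y ≡ 3 * (y + x)
  eq₁ = solve-∀
  eq₂ : ∀ Q A X → 3 * (Q * A * X) ≡ 3 * Q * A * X
  eq₂ = solve-∀
  eq₃ : ∀ Q L β f X → 3 * Q * (L * (β + f)) + X ≡ 3 * (Q * L) * β + 3 * (Q * (L * f)) + X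
  eq₃ = solve-∀
  eq₄ : ∀ X y → X + y + X ≡ 2 * X + y
  eq₄ = solve-∀

module _ (t m A Q₄ : ℕ) where

  -- The first summand is `A` times the Bernoulli error in `power-upper`; the second provides the
  -- lower bound on the scale that `part-deficit` requires.
  slack : ℕ
  slack = A * ((1 + t) * m * 2 ^ t) + 2 * ((m ∸ 1) * m)

  scale : ℕ
  scale = Q₄ * slack

-- With Q the scale and c = d m 2^t, Bernoulli and m ≤ Q give (1 + m/Q)^d ≤ 1 + c/Q; as the slack is
-- at least A c, the error A c/Q is at most 1/Q₄.
power-upper : ∀ t m A Q₄ b n f → 0 < Q₄ → 0 < slack t m A Q₄ → m ≤ scale t m A Q₄ →
  scale t m A Q₄ * m * b ≤ (scale t m A Q₄ + m) * n → f ≤ A * b ^ (1 + t) →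
  Q₄ * (m ^ (1 + t) * f) ≤ Q₄ * A * n ^ (1 + t) + n ^ (1 + t)
power-upper t m A Q₄ b n f 0<Q₄ 0<W m≤Q h f≤ = *-cancelˡ-≤ W {{>-nonZero 0<W}} (begin
  W * (Q₄ * (m ^ d * f))              ≤⟨ *-monoʳ-≤ W (*-monoʳ-≤ Q₄ (*-monoʳ-≤ (m ^ d) f≤)) ⟩
  W * (Q₄ * (m ^ d * (A * b ^ d)))    ≡⟨ eq₁ W Q₄ (m ^ d) A (b ^ d) ⟩
  A * (Q₅ * (m ^ d * b ^ d))           ≤⟨ *-monoʳ-≤ A key ⟩
  A * ((Q₅ + c) * n ^ d)               ≡⟨ eq₂ A Q₄ W c (n ^ d) ⟩
  W * (Q₄ * A * n ^ d) + A * c * n ^ d ≤⟨ +-monoʳ-≤ (W * (Q₄ * A * n ^ d)) (*-monoˡ-≤ (n ^ d) (m≤m+n (A * c) _)) ⟩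
  W * (Q₄ * A * n ^ d) + W * n ^ d    ≡⟨ sym (*-distribˡ-+ W (Q₄ * A * n ^ d) (n ^ d)) ⟩
  W * (Q₄ * A * n ^ d + n ^ d)        ∎)
  where
  d = 1 + t
  W = slack t m A Q₄
  Q₅ = scale t m A Q₄
  c = (1 + t) * m * 2 ^ t
  0<Q₅ : 0 < Q₅
  0<Q₅ = *-mono-≤ 0<Q₄ 0<W
  eq₁ : ∀ W q x A y → W * (q * (x * (A * y))) ≡ A * (q * W * (x * y))
  eq₁ = solve-∀
  eq₂ : ∀ A q W c x → A * ((q * W + c) * x) ≡ W * (q * A * x) + A * c * x
  eq₂ = solve-∀
  eq₃ : ∀ x q z → x * (q * z) ≡ q * x * z
  eq₃ = solve-∀
  eq₄ : ∀ q x e T → q * x + e * (T * x) ≡ x * (q + e * T)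
  eq₄ = solve-∀
  key : Q₅ * (m ^ d * b ^ d) ≤ (Q₅ + c) * n ^ d
  key = *-cancelˡ-≤ (Q₅ ^ t) {{m^n≢0 Q₅ t {{>-nonZero 0<Q₅}}}} (begin
    Q₅ ^ t * (Q₅ * (m ^ d * b ^ d))  ≡⟨ eq₃ (Q₅ ^ t) Q₅ (m ^ d * b ^ d) ⟩
    Q₅ ^ d * (m ^ d * b ^ d)        ≡⟨ sym (trans (*-^ (Q₅ * m) b d) (trans (cong (_* b ^ d) (*-^ Q₅ m d)) (*-assoc (Q₅ ^ d) (m ^ d) (b ^ d)))) ⟩
    (Q₅ * m * b) ^ d                ≤⟨ ^-monoˡ-≤ d h ⟩
    ((Q₅ + m) * n) ^ d              ≡⟨ *-^ (Q₅ + m) n d ⟩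
    (Q₅ + m) ^ d * n ^ d            ≤⟨ *-monoˡ-≤ (n ^ d) (begin
        (Q₅ + m) ^ d                            ≤⟨ bernoulli (Q₅ + m) m d ⟩
        (Q₅ + m ∸ m) ^ d + d * m * (Q₅ + m) ^ t  ≤⟨ +-mono-≤ (≤-reflexive (cong (_^ d) (m+n∸n≡m Q₅ m))) (*-monoʳ-≤ (d * m)
            (≤-trans (^-monoˡ-≤ t (≤-trans (+-monoʳ-≤ Q₅ m≤Q) (≤-reflexive (cong (Q₅ +_) (sym (+-identityʳ Q₅)))))) (≤-reflexive (*-^ 2 Q₅ t)))) ⟩
        Q₅ * Q₅ ^ t + d * m * (2 ^ t * Q₅ ^ t)    ≡⟨ eq₄ Q₅ (Q₅ ^ t) (d * m) (2 ^ t) ⟩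
        Q₅ ^ t * (Q₅ + c)                        ∎) ⟩
    Q₅ ^ t * (Q₅ + c) * n ^ d        ≡⟨ *-assoc (Q₅ ^ t) (Q₅ + c) (n ^ d) ⟩
    Q₅ ^ t * ((Q₅ + c) * n ^ d)      ∎)

-- With m = M + 1: if the other M classes hold at most n/m + n/Q each, then n/m - M n/Q is left, at
-- least half of n/m once 2 M m ≤ Q.
part-deficit : ∀ M Q a n → 0 < Q → 2 * (M * suc M) ≤ Q → Q * suc M * n ≤ Q * suc M * a + M * ((Q + suc M) * n) → n ≤ 2 * suc M * a
part-deficit M Q a n 0<Q h₁ h₂ = *-cancelˡ-≤ Q {{>-nonZero 0<Q}} (+-cancelʳ-≤ (Q * n) _ _ (begin
  Q * n + Q * n                                     ≤⟨ +-cancelʳ-≤ (2 * (M * (Q * n))) _ _ double ⟩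
  Q * (2 * suc M * a) + 2 * (M * suc M) * n         ≤⟨ +-monoʳ-≤ (Q * (2 * suc M * a)) (*-monoˡ-≤ n h₁) ⟩
  Q * (2 * suc M * a) + Q * n                       ∎))
  where
  eq₁ : ∀ Q M n → Q * n + Q * n + 2 * (M * (Q * n)) ≡ 2 * (Q * suc M * n)
  eq₁ = solve-∀
  eq₂ : ∀ Q M a n → 2 * (Q * suc M * a + M * ((Q + suc M) * n)) ≡ Q * (2 * suc M * a) + 2 * (M * suc M) * n + 2 * (M * (Q * n))
  eq₂ = solve-∀
  double : Q * n + Q * n + 2 * (M * (Q * n)) ≤ Q * (2 * suc M * a) + 2 * (M * suc M) * n + 2 * (M * (Q * n))
  double = ≤-trans (≤-reflexive (eq₁ Q M n)) (≤-trans (*-monoʳ-≤ 2 h₂) (≤-reflexive (eq₂ Q M a n)))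

∑-others≤ : (j : Fin (suc m)) (f : Fin (suc m) → ℕ) {b : ℕ} → (∀ i → f i ≤ b) → ∑ f ≤ f j + m * b
∑-others≤ j f h = ≤-trans (≤-reflexive (∑-punchIn j f)) (+-monoʳ-≤ (f j) (∑-bound (h ∘ punchIn j)))

module Analysis {t M n : ℕ} (G : RGraph (2 + t) n) (χ : Colouring n (suc M)) (0<M : 0 < M) (0<n : 0 < n) (0<A : 0 < (1 + t) ! * (M C (1 + t)))
  (Q₂ Q₃ : ℕ) (few-bad : Q₂ * Q₃ * ∑ᴸ (2 + t) (bad G χ) ≤ n ^ (2 + t))
  (large-degree : ∀ q x → q * ((1 + t) ! * (M C (1 + t)) * ((1 + t) * suc M)) ≤ n →
     q * ((1 + t) ! * (M C (1 + t))) * n ^ (1 + t) ≤ q * (suc M ^ (1 + t) * deg G x) + n ^ (1 + t)) where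

  private
    d = 1 + t
    m′ = suc M
    A = d ! * (M C d)
    L = m′ ^ d
    X = n ^ d

    0<X : 0 < X
    0<X = m^n>0 n {{>-nonZero 0<n}} d

    0<L : 0 < L
    0<L = m^n>0 m′ d

  β : Fin n → ℕ
  β y = ∑ᴸ d (bad G χ ∘ (y ∷_))

  Ok : Fin n → Set
  Ok y = Q₂ * β y ≤ X

  ok? : ∀ y → Dec (Ok y)
  ok? y = Q₂ * β y ≤? X

  W : List (Fin n)
  W = filter (¬? ∘ ok?) (allFin n)

  ∈W : ∀ {y} → ¬ Ok y → y ∈ᴸ W
  ∈W ¬ok = ∈-filter⁺ (¬? ∘ ok?) (∈-allFin _) ¬ok

  length-W : length W ≡ ∑ (λ y → 𝟙 (¬? (ok? y)))
  length-W = trans (length-filter (¬? ∘ ok?) (allFin n)) (∑ˡ-tabulate (𝟙 ∘ ¬? ∘ ok?) id)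

  -- Markov's inequality: `β` exceeds X/Q₂ on `W`, and its total is at most n X/(Q₂ Q₃).
  few-W : Q₃ * length W ≤ n
  few-W = *-cancelʳ-≤ _ _ X {{>-nonZero 0<X}} (begin
    Q₃ * length W * X                          ≡⟨ cong (λ w → Q₃ * w * X) length-W ⟩
    Q₃ * ∑ (λ y → 𝟙 (¬? (ok? y))) * X          ≡⟨ eq₁ Q₃ _ X ⟩
    Q₃ * (X * ∑ (λ y → 𝟙 (¬? (ok? y))))        ≡⟨ cong (Q₃ *_) (sym (∑-* X λ y → 𝟙 (¬? (ok? y)))) ⟩
    Q₃ * ∑ (λ y → X * 𝟙 (¬? (ok? y)))          ≤⟨ *-monoʳ-≤ Q₃ (∑-mono λ y → markov y (ok? y)) ⟩
    Q₃ * ∑ (λ y → Q₂ * β y)                    ≡⟨ cong (Q₃ *_) (∑-* Q₂ β) ⟩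
    Q₃ * (Q₂ * ∑ β)                            ≡⟨ eq₂ Q₃ Q₂ _ ⟩
    Q₂ * Q₃ * ∑ β                              ≤⟨ few-bad ⟩
    n * X                                      ∎)
    where
    eq₁ : ∀ a b c → a * b * c ≡ a * (c * b)
    eq₁ = solve-∀
    eq₂ : ∀ a b c → a * (b * c) ≡ b * a * c
    eq₂ = solve-∀
    markov : ∀ y (o : Dec (Ok y)) → X * 𝟙 (¬? o) ≤ Q₂ * β y
    markov y (yes _) = ≤-trans (≤-reflexive (*-zeroʳ X)) z≤n
    markov y (no ¬o) = ≤-trans (≤-reflexive (*-identityʳ X)) (<⇒≤ (≰⇒> ¬o))

  links : Fin m′ → ℕ
  links j = ∑ᴸ d (𝟙 ∘ link? χ j)

  links-upper : ∀ j b → E (part χ ∘ punchIn j) d ≤ (M C d) * b ^ d → links j ≤ A * b ^ d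
  links-upper j b h = ≤-trans (≤-reflexive (count-link χ d j)) (≤-trans (*-monoʳ-≤ (d !) h) (≤-reflexive (sym (*-assoc (d !) (M C d) (b ^ d)))))

  -- Maclaurin: for given total size, the product sums are largest when the parts are equal.
  links-maclaurin : ∀ j b → n ≤ M * b + part χ j → links j ≤ A * b ^ d
  links-maclaurin j b h = links-upper j b (≤-trans (E-balanced-max (part χ ∘ punchIn j) (λ _ → b) (λ _ → ≤-refl , n≤1+n b)
    (+-cancelˡ-≤ (part χ j) _ _ (begin
      part χ j + ∑ (part χ ∘ punchIn j) ≡⟨ sym (∑-punchIn j (part χ)) ⟩
      ∑ (part χ)                        ≡⟨ ∑-part χ ⟩
      n                                 ≤⟨ h ⟩
      M * b + part χ j                  ≡⟨ +-comm (M * b) (part χ j) ⟩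
      part χ j + M * b                  ≡⟨ cong (part χ j +_) (sym (∑-const M b)) ⟩
      part χ j + ∑ {M} (λ _ → b)        ∎)) d) (E-upper {M} d (λ _ → b) λ _ → ≤-refl))

  miss : Fin n → Fin m′ → ℕ
  miss = #missingLink χ G

  -- A link list of `χ y` is either missing or extends `y` to an edge, and a list that extends `y`
  -- to an edge without being such a link is bad.
  miss+deg : ∀ y → miss y (χ y) + deg G y ≤ β y + links (χ y)
  miss+deg y = begin
    miss y (χ y) + deg G y ≡⟨ sym (∑ᴸ-+ d (missingLink χ G y (χ y)) ([ G ]ᴱ ∘ (y ∷_))) ⟩
    ∑ᴸ d (λ l → missingLink χ G y (χ y) l + [ G ]ᴱ (y ∷ l)) ≤⟨ ∑ᴸ-mono d (λ l _ → go (link? χ (χ y) l) (edge? G (setOf (y ∷ l)))) ⟩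
    ∑ᴸ d (λ l → bad G χ (y ∷ l) + 𝟙 (link? χ (χ y) l)) ≡⟨ ∑ᴸ-+ d (bad G χ ∘ (y ∷_)) (𝟙 ∘ link? χ (χ y)) ⟩
    β y + links (χ y) ∎
    where
    go : ∀ {A B : Set} (λ? : Dec A) (e? : Dec B) → 𝟙 (λ? ×-dec ¬? e?) + 𝟙 e? ≤ 𝟙 (e? ×-dec ¬? λ?) + 𝟙 λ?
    go (yes _) (yes _) = ≤-refl
    go (yes _) (no _)  = ≤-refl
    go (no _)  (yes _) = ≤-refl
    go (no _)  (no _)  = ≤-refl

  -- What precision 1/q costs. The classes must be balanced to the finer scale `Q₅`, so that the
  -- products of d class sizes, and with them the links, still have error at most 1/q.
  record Level (q : ℕ) : Set where
    private Q₅ = scale t m′ A q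
    field
      positive : 0 < q
      Q₂-large : 3 * (Q₅ * L) ≤ Q₂
      Q₃-large : m′ ≤ Q₃
      n-large₁ : Q₅ * m′ * M ≤ n
      n-large₂ : 3 * Q₅ * (A * (d * m′)) ≤ n

  module _ {q : ℕ} (lv : Level q) where

    open Level lv

    private
      Q₅ = scale t m′ A q

      2Mm≤slack : 2 * (M * m′) ≤ slack t m′ A q
      2Mm≤slack = m≤n+m (2 * (M * m′)) (A * (d * m′ * 2 ^ t))

      0<slack : 0 < slack t m′ A q
      0<slack = ≤-trans (*-mono-≤ {1} {2} (s≤s z≤n) (*-mono-≤ 0<M (s≤s {0} {M} z≤n))) 2Mm≤slack

      0<Q₅ : 0 < Q₅
      0<Q₅ = *-mono-≤ positive 0<slack

      2Mm≤Q₅ : 2 * (M * m′) ≤ Q₅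
      2Mm≤Q₅ = ≤-trans 2Mm≤slack (m≤n*m _ q {{>-nonZero positive}})

      m≤Q₅ : m′ ≤ Q₅
      m≤Q₅ = ≤-trans (≤-trans (m≤n*m m′ M {{>-nonZero 0<M}}) (m≤n*m (M * m′) 2)) 2Mm≤Q₅

    -- The links of a vertex lie outside its class. If the class is too large, Maclaurin leaves too
    -- few of them for the degree of an `Ok` vertex in it; if it has no such vertex, it is contained
    -- in the small set `W`.
    part-upper : ∀ j → Q₅ * m′ * part χ j ≤ (Q₅ + m′) * n
    part-upper j = ≮⇒≥ λ big → case (Fin.any? (λ y → (χ y Fin.≟ j) ×-dec ok? y)) big
      where
      a≤n : part χ j ≤ n
      a≤n = ≤-trans (term≤∑ (part χ) j) (≤-reflexive (∑-part χ))
      case : Dec (∃[ y ] χ y ≡ j × Ok y) → ¬ ((Q₅ + m′) * n < Q₅ * m′ * part χ j)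
      case (yes (y , refl , ok)) big = gap-absurd Q₅ A L X (deg G y) (β y) (links j) Q₂ 0<A 0<X
        (large-degree (3 * Q₅) y n-large₂) (m+n≤o⇒n≤o (miss y j) (miss+deg y)) ok Q₂-large
        (power-gap t m′ Q₅ b′ n A (links j) (part-excess M Q₅ b′ (part χ j) n 0<M upper big n-large₁) (links-maclaurin j b′ lower))
        where
        instance
          M≢0 : NonZero M
          M≢0 = >-nonZero 0<M
        x = n ∸ part χ j
        -- The average of the other classes raised to an integer; this adds at most `M` to their
        -- total, which `n-large₁` absorbs.
        b′ = suc (x / M)
        x≡ : x ≡ x % M + x / M * M
        x≡ = m≡m%n+[m/n]*n x M
        lower : n ≤ M * b′ + part χ j
        lower = begin
          n                            ≡⟨ sym (m∸n+n≡m a≤n) ⟩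
          x + part χ j                 ≤⟨ +-monoˡ-≤ (part χ j) (begin
              x                        ≡⟨ x≡ ⟩
              x % M + x / M * M        ≤⟨ +-monoˡ-≤ (x / M * M) (<⇒≤ (m%n<n x M)) ⟩
              suc (x / M) * M          ≡⟨ *-comm b′ M ⟩
              M * b′                   ∎) ⟩
          M * b′ + part χ j            ∎
        upper : M * b′ + part χ j ≤ n + M
        upper = begin
          M * b′ + part χ j            ≡⟨ cong (_+ part χ j) (trans (*-comm M b′) (+-comm M (x / M * M))) ⟩
          x / M * M + M + part χ j     ≤⟨ +-monoˡ-≤ (part χ j) (+-monoˡ-≤ M (m/n*n≤m x M)) ⟩
          x + M + part χ j             ≡⟨ eq x M (part χ j) ⟩
          x + part χ j + M             ≡⟨ cong (_+ M) (m∸n+n≡m a≤n) ⟩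
          n + M                        ∎
          where
          eq : ∀ a b c → a + b + c ≡ a + c + b
          eq = solve-∀
      case (no none) big = <⇒≱ big (begin
        Q₅ * m′ * part χ j     ≤⟨ *-monoʳ-≤ (Q₅ * m′) all-W ⟩
        Q₅ * m′ * length W     ≡⟨ *-assoc Q₅ m′ _ ⟩
        Q₅ * (m′ * length W)   ≤⟨ *-monoʳ-≤ Q₅ (≤-trans (*-monoˡ-≤ (length W) Q₃-large) few-W) ⟩
        Q₅ * n                 ≤⟨ *-monoˡ-≤ n (m≤m+n Q₅ m′) ⟩
        (Q₅ + m′) * n          ∎)
        where
        all-W : part χ j ≤ length W
        all-W = ≤-trans (∑-mono λ y → 𝟙-mono (χ y Fin.≟ j) (¬? (ok? y)) λ eq ok → none (y , eq , ok)) (≤-reflexive (sym length-W))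

    part-lower : ∀ j → n ≤ 2 * m′ * part χ j
    part-lower j = part-deficit M Q₅ (part χ j) n 0<Q₅ 2Mm≤Q₅ (begin
      Q₅ * m′ * n                                      ≡⟨ cong (Q₅ * m′ *_) (sym (∑-part χ)) ⟩
      Q₅ * m′ * ∑ (part χ)                             ≡⟨ sym (∑-* (Q₅ * m′) (part χ)) ⟩
      ∑ (λ i → Q₅ * m′ * part χ i)                     ≤⟨ ∑-others≤ j (λ i → Q₅ * m′ * part χ i) part-upper ⟩
      Q₅ * m′ * part χ j + M * ((Q₅ + m′) * n)         ∎)

    links-bound : ∀ j → q * (L * links j) ≤ q * A * X + X
    links-bound j = power-upper t m′ A q b n (links j) positive 0<slack m≤Q₅
      (≤-trans (≤-reflexive (*-comm (Q₅ * m′) b)) (m/n*n≤m ((Q₅ + m′) * n) (Q₅ * m′)))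
      (links-upper j b (E-upper d (part χ ∘ punchIn j) λ i → part≤b (punchIn j i)))
      where
      instance
        Qm≢0 : NonZero (Q₅ * m′)
        Qm≢0 = >-nonZero (*-mono-≤ 0<Q₅ (s≤s {0} {M} z≤n))
      b = ((Q₅ + m′) * n) / (Q₅ * m′)
      part≤b : ∀ i → part χ i ≤ b
      part≤b i = begin
        part χ i                              ≡⟨ sym (m*n/n≡m (part χ i) (Q₅ * m′)) ⟩
        (part χ i * (Q₅ * m′)) / (Q₅ * m′)    ≤⟨ /-monoˡ-≤ (Q₅ * m′) (≤-trans (≤-reflexive (*-comm (part χ i) (Q₅ * m′))) (part-upper i)) ⟩
        b                                     ∎

    -- After scaling by `L`, the links `f` exceed the leading term `A * X` by at most X/q and the
    -- degree `δ` falls short of it by at most X/q; the exceptional lists `α` add `a`.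
    miss-bound : ∀ {μ δ α f a : ℕ} → μ + δ ≤ α + f → q * (L * f) ≤ q * A * X + X → q * A * X ≤ q * (L * δ) + X → q * (L * α) ≤ a →
      q * μ ≤ a + 2 * X
    miss-bound {μ} {δ} {α} {f} {a} h₁ h₂ h₃ h₄ = ≤-trans (*-monoʳ-≤ q (m≤n*m μ L {{>-nonZero 0<L}})) (+-cancelʳ-≤ (q * (L * δ) + q * A * X) _ _ (begin
      q * (L * μ) + (q * (L * δ) + q * A * X)        ≡⟨ eq₁ q L μ δ (q * A * X) ⟩
      q * (L * (μ + δ)) + q * A * X                  ≤⟨ +-mono-≤ (*-monoʳ-≤ q (*-monoʳ-≤ L h₁)) h₃ ⟩
      q * (L * (α + f)) + (q * (L * δ) + X)          ≡⟨ eq₂ q L α f (q * (L * δ) + X) ⟩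
      q * (L * α) + q * (L * f) + (q * (L * δ) + X)  ≤⟨ +-monoˡ-≤ _ (+-mono-≤ h₄ h₂) ⟩
      a + (q * A * X + X) + (q * (L * δ) + X)        ≡⟨ eq₃ a (q * A * X) X (q * (L * δ)) ⟩
      a + 2 * X + (q * (L * δ) + q * A * X)          ∎))
      where
      eq₁ : ∀ q L μ δ z → q * (L * μ) + (q * (L * δ) + z) ≡ q * (L * (μ + δ)) + z
      eq₁ = solve-∀
      eq₂ : ∀ q L α f z → q * (L * (α + f)) + z ≡ q * (L * α) + q * (L * f) + z
      eq₂ = solve-∀
      eq₃ : ∀ a x X y → a + (x + X) + (y + X) ≡ a + 2 * X + (y + x)
      eq₃ = solve-∀

    module _ (q-large : q * (A * (d * m′)) ≤ n) where

      ok-miss : q * L ≤ Q₂ → ∀ y → Ok y → q * miss y (χ y) ≤ 3 * X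
      ok-miss h y ok = miss-bound (miss+deg y) (links-bound (χ y)) (large-degree q y q-large)
        (≤-trans (≤-reflexive (sym (*-assoc q L (β y)))) (≤-trans (*-monoˡ-≤ (β y) h) ok))

      -- An edge at `x` that avoids `W` is rainbow outside `x`, and unless it meets class `j` it is
      -- a link of `j`. So almost the whole degree of `x` is spent on links of `j`, which leaves few
      -- of them missing.
      few-hits : q * L * d ≤ Q₃ → ∀ x → (∀ l → length l ≡ d → Edge G (setOf (x ∷ l)) → ¬ Meets W l → Rainbow χ l) →
        ∀ j → q * L * ∑ᴸ d (hits χ G x j) ≤ X → q * miss x j ≤ 4 * X
      few-hits h x rb j few = ≤-trans (miss-bound {a = 2 * X} bound (links-bound j) (large-degree q x q-large) (begin
        q * (L * (length W * (d * n ^ t) + ∑ᴸ d (hits χ G x j)))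
          ≡⟨ eq q L (length W) d (n ^ t) _ ⟩
        q * L * d * length W * n ^ t + q * L * ∑ᴸ d (hits χ G x j)
          ≤⟨ +-mono-≤ (*-monoˡ-≤ (n ^ t) (≤-trans (*-monoˡ-≤ (length W) h) few-W)) few ⟩
        n * n ^ t + X ≡⟨ cong (X +_) (sym (+-identityʳ X)) ⟩
        2 * X ∎)) (≤-reflexive (eq′ X))
        where
        eq : ∀ q L w d x z → q * (L * (w * (d * x) + z)) ≡ q * L * d * w * x + q * L * z
        eq = solve-∀
        eq′ : ∀ X → 2 * X + 2 * X ≡ 4 * X
        eq′ = solve-∀
        point : ∀ l → length l ≡ d → missingLink χ G x j l + [ G ]ᴱ (x ∷ l) ≤ (𝟙 (meets? W l) + hits χ G x j l) + 𝟙 (link? χ j l)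
        point l len = go (link? χ j l) (edge? G (setOf (x ∷ l))) (meets? W l) (rainbow? χ l) (j ∈ᴸ? map χ l)
          (rb l len) (λ R j∉ → ∉⇒All≢ j∉ ∷ R)
          where
          go : ∀ {A B C D E : Set} (λ? : Dec A) (e? : Dec B) (w? : Dec C) (r? : Dec D) (c? : Dec E) → (B → ¬ C → D) → (D → ¬ E → A) →
            𝟙 (λ? ×-dec ¬? e?) + 𝟙 e? ≤ (𝟙 w? + 𝟙 (e? ×-dec r? ×-dec c?)) + 𝟙 λ?
          go (yes _) (yes _) w? r? c? _ _ = m≤n+m 1 _
          go (yes _) (no _)  w? r? c? _ _ = m≤n+m 1 _
          go (no _)  (no _)  w? r? c? _ _ = z≤n
          go (no _)  (yes _) (yes _) r? c? _ _ = s≤s z≤n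
          go (no _)  (yes _) (no _) (yes _) (yes _) _ _ = ≤-refl
          go (no ¬a) (yes _) (no _) (yes r) (no ¬c) _ k = contradiction (k r ¬c) ¬a
          go (no _)  (yes e) (no ¬w) (no ¬r) c? k _ = contradiction (k e ¬w) ¬r
        bound : miss x j + deg G x ≤ (length W * (d * n ^ t) + ∑ᴸ d (hits χ G x j)) + links j
        bound = begin
          miss x j + deg G x ≡⟨ sym (∑ᴸ-+ d (missingLink χ G x j) ([ G ]ᴱ ∘ (x ∷_))) ⟩
          ∑ᴸ d (λ l → missingLink χ G x j l + [ G ]ᴱ (x ∷ l)) ≤⟨ ∑ᴸ-mono d point ⟩
          ∑ᴸ d (λ l → (𝟙 (meets? W l) + hits χ G x j l) + 𝟙 (link? χ j l)) ≡⟨ ∑ᴸ-+ d (λ l → 𝟙 (meets? W l) + hits χ G x j l) (𝟙 ∘ link? χ j) ⟩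
          ∑ᴸ d (λ l → 𝟙 (meets? W l) + hits χ G x j l) + links j ≡⟨ cong (_+ links j) (∑ᴸ-+ d (λ l → 𝟙 (meets? W l)) (hits χ G x j)) ⟩
          ∑ᴸ d (λ l → 𝟙 (meets? W l)) + ∑ᴸ d (hits χ G x j) + links j ≤⟨ +-monoˡ-≤ (links j) (+-monoˡ-≤ _ (count-meets d W)) ⟩
          length W * (d * n ^ t) + ∑ᴸ d (hits χ G x j) + links j ∎

  -- A vertex of `W` may miss all of its links, at most `X`, but `W` has at most n/Q₃ vertices.
  total-missing : ∀ q → q ≤ Q₃ → (∀ y → Ok y → q * miss y (χ y) ≤ X) → q * #missing χ G ≤ 2 * n ^ (2 + t)
  total-missing q q≤Q₃ h = begin
    q * ∑ (λ y → miss y (χ y))               ≡⟨ sym (∑-* q λ y → miss y (χ y)) ⟩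
    ∑ (λ y → q * miss y (χ y))               ≤⟨ ∑-mono (λ y → point y (ok? y)) ⟩
    ∑ (λ y → X + (q * X) * 𝟙 (¬? (ok? y)))   ≡⟨ trans (∑-+ (λ _ → X) λ y → (q * X) * 𝟙 (¬? (ok? y))) (cong₂ _+_ (∑-const n X) (trans (∑-* (q * X) λ y → 𝟙 (¬? (ok? y))) (cong (q * X *_) (sym length-W)))) ⟩
    n * X + q * X * length W                 ≡⟨ cong (n * X +_) (eq q X (length W)) ⟩
    n * X + q * length W * X                 ≤⟨ +-monoʳ-≤ (n * X) (*-monoˡ-≤ X (≤-trans (*-monoˡ-≤ (length W) q≤Q₃) few-W)) ⟩
    n * X + n * X                            ≡⟨ cong (n * X +_) (sym (+-identityʳ (n * X))) ⟩
    2 * n ^ (2 + t)                          ∎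
    where
    eq : ∀ q x w → q * x * w ≡ q * w * x
    eq = solve-∀
    point : ∀ y (o : Dec (Ok y)) → q * miss y (χ y) ≤ X + (q * X) * 𝟙 (¬? o)
    point y (yes o) = ≤-trans (h y o) (m≤m+n X _)
    point y (no _)  = ≤-trans (*-monoʳ-≤ q (≤-trans (∑ᴸ-mono d λ l _ → 𝟙≤1 (link? χ (χ y) l ×-dec ¬? (edge? G (setOf (y ∷ l)))))
      (≤-reflexive (trans (∑ᴸ-const {n} d 1) (*-identityʳ X))))) (≤-trans (≤-reflexive (sym (*-identityʳ (q * X)))) (m≤n+m _ X))

-- The Turán number

-- Applied once with the colouring from stability, to the part of an edge that avoids `W`, and once
-- with the attached colours, to whole edges.
edge-rainbow : (G : RGraph r n) (Att : Fin m → Fin n → Set) → (∀ j {u w} → u ≢ w → Covered G u w → Att j u → Att j w → Q) → ¬ Q →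
  (κ : Fin n → Fin m) → ∀ {e l} → Edge G e → Unique l → (∀ {u} → u ∈ᴸ l → u ∈ e) → (∀ {u} → u ∈ᴸ l → Att (κ u) u) → Rainbow κ l
edge-rainbow G Att clash ¬q κ {e} h ul ⊆e att = Unique-map-on κ (λ {u} {w} u∈ w∈ eq → decidable-stable (u Fin.≟ w) λ u≢w →
  ¬q (clash (κ u) u≢w (e , h , ⊆e u∈ , ⊆e w∈) (att u∈) (subst (λ j → Att j w) (sym eq) (att w∈)))) ul

-- QA and QB are what the two sampling arguments require; the others are chosen larger and larger from them.
record Constants (t M K : ℕ) : Set where
  private
    d = 1 + t
    m′ = suc M
    A = d ! * (M C d)
    L = m′ ^ d
    s : ℕ → ℕ
    s = scale t m′ A
  field
    QA QB cB qa qb Q₆ Q₂ Q₃ N₁ : ℕ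
    QA-large : (2 * m′) ^ (suc K * m′) * (2 ^ ∑ {suc K * m′} (λ _ → 1) * (1 + (1 + (1 + (1 + (2 + t)))))) < QA
    QB-large : cB ^ (2 + M + K * m′) * (2 ^ ∑ (blockLength t ∘ splitAt (2 + M) {K * m′}) * (1 + (1 + 1))) < QB
    cB₁ : 2 * m′ ≤ cB
    cB₂ : qa * L ≤ cB
    qa≡ : qa ≡ 4 * QA
    Q₆≡ : Q₆ ≡ 2 * (QA + QB)
    qb≡ : qb ≡ 3 * Q₆
    Q₂a : 3 * (s qa * L) ≤ Q₂
    Q₂b : 3 * (s qb * L) ≤ Q₂
    Q₂c : qb * L ≤ Q₂
    Q₃a : m′ ≤ Q₃
    Q₃b : Q₆ ≤ Q₃
    Q₃c : qa * L * d ≤ Q₃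
    N-QA : QA ≤ N₁
    N-QB : QB ≤ N₁
    Na₁ : s qa * m′ * M ≤ N₁
    Na₂ : 3 * s qa * (A * (d * m′)) ≤ N₁
    Na₃ : qa * (A * (d * m′)) ≤ N₁
    Nb₁ : s qb * m′ * M ≤ N₁
    Nb₂ : 3 * s qb * (A * (d * m′)) ≤ N₁
    Nb₃ : qb * (A * (d * m′)) ≤ N₁

private
  ≤₁ : ∀ a b {c} → a + b ≤ c → a ≤ c
  ≤₁ a b = m+n≤o⇒m≤o a

  ≤₂ : ∀ a b {c} → a + b ≤ c → b ≤ c
  ≤₂ a b = m+n≤o⇒n≤o a

  module _ (t M K : ℕ) where

    private
      d = 1 + t
      m′ = suc M
      A = d ! * (M C d)
      L = m′ ^ d
      s : ℕ → ℕ
      s = scale t m′ A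

    -- The factors 4, 3 and 2 in the last equations cancel those in the conclusions of `few-hits`,
    -- `ok-miss` and `total-missing`.
    constants-from : ∀ QA QB cB qa qb Q₆ → (2 * m′) ^ (suc K * m′) * (2 ^ ∑ {suc K * m′} (λ _ → 1) * (1 + (1 + (1 + (1 + (2 + t)))))) < QA →
      cB ^ (2 + M + K * m′) * (2 ^ ∑ (blockLength t ∘ splitAt (2 + M) {K * m′}) * (1 + (1 + 1))) < QB →
      2 * m′ + qa * L ≤ cB → qa ≡ 4 * QA → Q₆ ≡ 2 * (QA + QB) → qb ≡ 3 * Q₆ → Constants t M K
    constants-from QA QB cB qa qb Q₆ A-large B-large cB≥ qa≡ Q₆≡ qb≡ = record
      { QA = QA ; QB = QB ; cB = cB ; qa = qa ; qb = qb ; Q₆ = Q₆ ; Q₂ = a₁ + (a₂ + a₃) ; Q₃ = m′ + (Q₆ + b₁)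
      ; N₁ = QA + (QB + (c₁ + (c₂ + (c₃ + (c₄ + (c₅ + c₆))))))
      ; QA-large = A-large ; QB-large = B-large
      ; cB₁ = ≤₁ (2 * m′) (qa * L) cB≥ ; cB₂ = ≤₂ (2 * m′) (qa * L) cB≥
      ; qa≡ = qa≡ ; Q₆≡ = Q₆≡ ; qb≡ = qb≡
      ; Q₂a = ≤₁ a₁ _ ≤-refl ; Q₂b = ≤₁ a₂ a₃ (≤₂ a₁ _ ≤-refl) ; Q₂c = ≤₂ a₂ a₃ (≤₂ a₁ _ ≤-refl)
      ; Q₃a = ≤₁ m′ _ ≤-refl ; Q₃b = ≤₁ Q₆ b₁ (≤₂ m′ _ ≤-refl) ; Q₃c = ≤₂ Q₆ b₁ (≤₂ m′ _ ≤-refl)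
      ; N-QA = ≤₁ QA _ ≤-refl ; N-QB = ≤₁ QB _ r₁
      ; Na₁ = ≤₁ c₁ _ r₂ ; Na₂ = ≤₁ c₂ _ r₃ ; Na₃ = ≤₁ c₃ _ r₄ ; Nb₁ = ≤₁ c₄ _ r₅ ; Nb₂ = ≤₁ c₅ c₆ r₆ ; Nb₃ = ≤₂ c₅ c₆ r₆
      }
      where
      a₁ = 3 * (s qa * L)
      a₂ = 3 * (s qb * L)
      a₃ = qb * L
      b₁ = qa * L * d
      c₁ = s qa * m′ * M
      c₂ = 3 * s qa * (A * (d * m′))
      c₃ = qa * (A * (d * m′))
      c₄ = s qb * m′ * M
      c₅ = 3 * s qb * (A * (d * m′))
      c₆ = qb * (A * (d * m′))
      r₁ = ≤₂ QA _ ≤-refl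
      r₂ = ≤₂ QB _ r₁
      r₃ = ≤₂ c₁ _ r₂
      r₄ = ≤₂ c₂ _ r₃
      r₅ = ≤₂ c₃ _ r₄
      r₆ = ≤₂ c₄ _ r₅

    constants : Constants t M K
    -- The holes are solved by `≤-refl`: `QA` and `QB` become the successors of their bounds. `cB`
    -- is fixed from `QA` alone, because the bound for `QB` is a multiple of a power of it.
    constants = withQA _ ≤-refl
      where
      withQB : ∀ QA → _ → ∀ QB cB → _ → _ → Constants t M K
      withQB QA hA QB cB hB hc = constants-from QA QB cB (4 * QA) (3 * (2 * (QA + QB))) (2 * (QA + QB)) hA hB hc refl refl refl
      withQA : ∀ QA → _ → Constants t M K
      withQA QA hA = withQB QA hA _ (2 * m′ + 4 * QA * L) ≤-refl ≤-refl

module _ {t M h : ℕ} {F : RGraph (2 + t) (2 + M)} {H : RGraph (2 + t) h} (X : Extends F H) (tip : Tip F) (r≤m : 2 + t ≤ suc M) where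

  private
    K = Extends.#pairs′ X
    d = 1 + t
    m′ = suc M
    A = d ! * (M C d)
    L = m′ ^ d

    0<M : 0 < M
    0<M = ≤-trans (s≤s z≤n) (s≤s⁻¹ r≤m)

    0<A : 0 < A
    0<A = *-mono-≤ (1≤n! d) (C-pos (s≤s⁻¹ r≤m))

    module _ (κ : Constants t M K) {n : ℕ} (N₁≤n : Constants.N₁ κ ≤ n) (0<n : 0 < n) (G : RGraph (2 + t) n) (free : Free H G)
      (degs : ∀ x → minDegree M d n ≤ deg G x) (χ : Colouring n m′)
      (few-bad : Constants.Q₂ κ * Constants.Q₃ κ * ∑ᴸ (2 + t) (bad G χ) ≤ n ^ (2 + t)) where

      open Constants κ
      open Analysis G χ 0<M 0<n 0<A Q₂ Q₃ few-bad (λ q x → minDegree-★ M t n (deg G x) q (degs x))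

      up : ∀ {x} → x ≤ N₁ → x ≤ n
      up le = ≤-trans le N₁≤n

      0<QA : 0 < QA
      0<QA = ≤-<-trans z≤n QA-large

      level-a : Level qa
      level-a = record
        { positive = subst (0 <_) (sym qa≡) (*-mono-≤ {1} {4} (s≤s z≤n) 0<QA) ; Q₂-large = Q₂a ; Q₃-large = Q₃a
        ; n-large₁ = up Na₁ ; n-large₂ = up Na₂ }

      level-b : Level qb
      level-b = record
        { positive = subst (0 <_) (sym (trans qb≡ (cong (3 *_) Q₆≡))) (*-mono-≤ {1} {3} (s≤s z≤n) (*-mono-≤ {1} {2} (s≤s z≤n) (≤-trans 0<QA (m≤m+n QA QB))))
        ; Q₂-large = Q₂b ; Q₃-large = Q₃a ; n-large₁ = up Nb₁ ; n-large₂ = up Nb₂ }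

      ok-Q₆ : ∀ y → Ok y → Q₆ * miss y (χ y) ≤ n ^ d
      ok-Q₆ y ok = *-cancelˡ-≤ 3 (≤-trans (≤-reflexive (trans (sym (*-assoc 3 Q₆ (miss y (χ y)))) (cong (_* miss y (χ y)) (sym qb≡))))
        (ok-miss level-b (up Nb₃) Q₂c y ok))

      few-missing : (QA + QB) * #missing χ G ≤ n ^ (2 + t)
      few-missing = *-cancelˡ-≤ 2 (≤-trans (≤-reflexive (trans (sym (*-assoc 2 (QA + QB) (#missing χ G))) (cong (_* #missing χ G) (sym Q₆≡))))
        (total-missing Q₆ Q₃b ok-Q₆))

      QA≤Q₆ : QA ≤ Q₆
      QA≤Q₆ = ≤-trans (m≤m+n QA QB) (≤-trans (m≤m+n (QA + QB) _) (≤-reflexive (sym Q₆≡)))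

      Att : Fin m′ → Fin n → Set
      Att j x = QA * miss x j ≤ n ^ d

      ok-Att : ∀ {y} → Ok y → Att (χ y) y
      ok-Att {y} ok = ≤-trans (*-monoˡ-≤ (miss y (χ y)) QA≤Q₆) (ok-Q₆ y ok)

      clash : ∀ j {u w} → u ≢ w → Covered G u w → Att j u → Att j w → Copy H G
      clash j {u} {w} u≢w cov au aw = claimA X tip r≤m G χ j u≢w cov λ e₀ h →
        sampleA K G χ j u w e₀ h (2 * m′) QA QA-large (up N-QA) (part-lower level-a)
          (≤-trans (*-monoˡ-≤ (#missing χ G) (m≤m+n QA QB)) few-missing) au aw

      -- The vertex `x` itself may be exceptional: only the other vertices need to be outside `W`,
      -- where each is attached to its own colour.
      ok-rainbow : ∀ x l → length l ≡ d → Edge G (setOf (x ∷ l)) → ¬ Meets W l → Rainbow χ l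
      ok-rainbow x l len h ¬m with edge⇒Unique G (x ∷ l) (cong suc len) h
      ... | _ ∷ ul = edge-rainbow G Att clash free χ h ul (λ u∈ → ∈-setOf⁺ {l = x ∷ l} (there u∈))
        λ {u} u∈ → ok-Att (decidable-stable (ok? u) λ ¬ok → ¬m (Any.map (λ { refl → u∈ }) (∈W ¬ok)))

      -- The contrapositive of `few-hits`: if few edges at `x` met class `j`, then `x` would be
      -- attached to `j`.
      hits-many : ∀ x → (∀ j → ¬ Att j x) → ∀ j → n ^ d ≤ cB * ∑ᴸ d (hits χ G x j)
      hits-many x none j = ≤-trans (<⇒≤ (≰⇒> λ few → none j (*-cancelˡ-≤ 4 (≤-trans
        (≤-reflexive (trans (sym (*-assoc 4 QA (miss x j))) (cong (_* miss x j) (sym qa≡))))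
        (few-hits level-a (up Na₃) Q₃c x (ok-rainbow x) j few)))))
        (*-monoˡ-≤ (∑ᴸ d (hits χ G x j)) cB₂)

      attach : ∀ x → ∃[ j ] Att j x
      attach x = decidable-stable (Fin.any? λ j → QA * miss x j ≤? n ^ d) λ none → free (claimB X tip r≤m G χ x
        (sampleB K G χ x cB QB QB-large (up N-QB) (λ i → ≤-trans (part-lower level-a i) (*-monoˡ-≤ (part χ i) cB₁))
          (≤-trans (*-monoˡ-≤ (#missing χ G) (m≤n+m QB QA)) few-missing) (hits-many x λ j a → none (j , a))))

      dense-bound : D G ≤ D (turánGraph (2 + t) n m′)
      dense-bound = D≤turán G (proj₁ ∘ attach) λ l len h → edge-rainbow G Att clash free (proj₁ ∘ attach) h
        (edge⇒Unique G l len h) ∈-setOf⁺ (λ {u} _ → proj₂ (attach u))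

  large-minDegree : (∀ q → ∃[ N ] (∀ {n} → N ≤ n → (G : RGraph (2 + t) n) → Free H G → (∀ x → minDegree M d n ≤ deg G x) →
      Σ[ χ ∈ Colouring n m′ ] q * ∑ᴸ (2 + t) (bad G χ) ≤ n ^ (2 + t))) →
    ∃[ N ] (∀ {n} → N ≤ n → (G : RGraph (2 + t) n) → Free H G → (∀ x → minDegree M d n ≤ deg G x) → D G ≤ D (turánGraph (2 + t) n m′))
  large-minDegree colour = N , λ {n} N≤n G free degs →
      let χ , few-bad = proj₂ (colour (Q₂ κ * Q₃ κ)) (m+n≤o⇒m≤o N₀ (≤-trans (n≤1+n _) N≤n)) G free degs
      in dense-bound κ (m+n≤o⇒n≤o N₀ (≤-trans (n≤1+n _) N≤n)) (≤-trans (s≤s z≤n) N≤n) G free degs χ few-bad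
    where
    open Constants
    κ = constants t M K
    N₀ = proj₁ (colour (Q₂ κ * Q₃ κ))
    N = suc (N₀ + N₁ κ)

-- Deleting a vertex of degree below the increment of the Turán numbers improves the excess, which is bounded at the start.
module _ {t M h : ℕ} {H : RGraph (2 + t) h} (N₀ : ℕ)
  (large : ∀ {n} → N₀ ≤ n → (G : RGraph (2 + t) n) → Free H G → (∀ x → minDegree M (1 + t) n ≤ deg G x) → D G ≤ D (turánGraph (2 + t) n (suc M))) where

  private
    r′ = 2 + t

    excess : ℕ
    excess = N₀ ^ r′

    ∸-step : ∀ {a b} c k → suc a ≤ b + (c ∸ k) → a ≤ b + (c ∸ suc k)
    ∸-step {a} {b} c k h with c ∸ k in eq
    ... | zero  = ≤-trans (<⇒≤ (≤-trans h (≤-reflexive (+-identityʳ b)))) (m≤m+n b _)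
    ... | suc x = ≤-trans (s≤s⁻¹ (≤-trans h (≤-reflexive (+-suc b x)))) (≤-reflexive (cong (b +_) (trans (cong pred (sym eq)) (pred[m∸n]≡m∸[1+n] c k))))

    delete : (G : RGraph r′ (suc n)) (u : Fin (suc n)) → D G ≤ D (pullback (punchIn u) (Fin.punchIn-injective u _ _) G) + r′ * deg G u
    delete G u = ≤-trans (∑ᴸ-delete r′ u [ G ]ᴱ ([]ᴱ-sym G)) (+-monoˡ-≤ (r′ * deg G u)
      (≤-reflexive (∑ᴸ-cong r′ λ l _ → cong (λ e → 𝟙 (edge? G e)) (sym (image-setOf (punchIn u) l)))))

  private
    minDegree-step : ∀ n → D (turánGraph r′ n (suc M)) + r′ * minDegree M (1 + t) (suc n) ≤ D (turánGraph r′ (suc n) (suc M))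
    minDegree-step n = D-turán-suc n M (1 + t)

    -- A degree short of `μ` by one falls short by `r′` ordered edges, more than the single unit by
    -- which the allowance shrinks.
    improve : ∀ {a g T₀ T₁ δ μ} c k → a ≤ g + r′ * δ → g ≤ T₀ + (c ∸ k) → suc δ ≤ μ → T₀ + r′ * μ ≤ T₁ → a ≤ T₁ + (c ∸ suc k)
    improve {a} {g} {T₀} {T₁} {δ} {μ} c k h₁ h₂ h₃ h₄ = ∸-step c k (begin
      suc a                              ≤⟨ s≤s (≤-trans h₁ (+-monoˡ-≤ (r′ * δ) h₂)) ⟩
      suc (T₀ + (c ∸ k) + r′ * δ)        ≡⟨ eq T₀ (c ∸ k) (r′ * δ) ⟩
      T₀ + suc (r′ * δ) + (c ∸ k)        ≤⟨ +-monoˡ-≤ (c ∸ k) (+-monoʳ-≤ T₀ (begin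
          suc (r′ * δ)                   ≤⟨ +-monoˡ-≤ (r′ * δ) (s≤s {0} {suc t} z≤n) ⟩
          r′ + r′ * δ                    ≡⟨ sym (*-suc r′ δ) ⟩
          r′ * suc δ                     ≤⟨ *-monoʳ-≤ r′ h₃ ⟩
          r′ * μ                         ∎)) ⟩
      T₀ + r′ * μ + (c ∸ k)              ≤⟨ +-monoˡ-≤ (c ∸ k) h₄ ⟩
      T₁ + (c ∸ k)                       ∎)
      where
      eq : ∀ a b c → suc (a + b + c) ≡ a + suc c + b
      eq = solve-∀

  -- The allowance `excess ∸ k` starts at the number of all lists on `N₀` vertices and falls by one
  -- per vertex, so it is used up after `excess` further vertices.
  excess-bound : ∀ k (G : RGraph r′ (k + N₀)) → Free H G → D G ≤ D (turánGraph r′ (k + N₀) (suc M)) + (excess ∸ k)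
  excess-bound zero G free = ≤-trans (≤-trans (∑ᴸ-mono r′ λ l _ → 𝟙≤1 (edge? G (setOf l)))
    (≤-reflexive (trans (∑ᴸ-const {N₀} r′ 1) (*-identityʳ excess)))) (m≤n+m excess _)
  excess-bound (suc k) G free = go (Fin.any? λ u → suc (deg G u) ≤? minDegree M (1 + t) (suc k + N₀))
    where
    go : Dec (∃[ u ] suc (deg G u) ≤ minDegree M (1 + t) (suc k + N₀)) → D G ≤ D (turánGraph r′ (suc k + N₀) (suc M)) + (excess ∸ suc k)
    go (no none)         = ≤-trans (large (m≤n+m N₀ (suc k)) G free λ x → ≮⇒≥ λ lt → none (x , lt)) (m≤m+n _ _)
    go (yes (u , small)) = improve {a = D G} {T₀ = D (turánGraph r′ (k + N₀) (suc M))} {T₁ = D (turánGraph r′ (suc k + N₀) (suc M))} excess k (delete G u)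
      (excess-bound k (pullback (punchIn u) (Fin.punchIn-injective u _ _) G) (free ∘ copy-pullback (punchIn u) (Fin.punchIn-injective u _ _) G))
      small (minDegree-step (k + N₀))

  turán-bound : ∀ n → excess + N₀ ≤ n → (G : RGraph r′ n) → Free H G → size G ≤ size (turánGraph r′ n (suc M))
  turán-bound n le G free = *-cancelˡ-≤ (r′ !) {{r′ !≢0}} (subst₂ _≤_ (D≡r!*size G) (D≡r!*size (turánGraph r′ n (suc M))) (go (n ∸ N₀) (m∸n+n≡m (m+n≤o⇒n≤o excess le)) G free))
    where
    go : ∀ k → k + N₀ ≡ n → (G : RGraph r′ n) → Free H G → D G ≤ D (turánGraph r′ n (suc M))
    go k refl G free = ≤-trans (excess-bound k G free) (≤-reflexive (trans (cong (D (turánGraph r′ (k + N₀) (suc M)) +_) (m≤n⇒m∸n≡0 (+-cancelʳ-≤ N₀ excess k le))) (+-identityʳ _)))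

turán-number : ∀ {t v M} (2≤r : 2 ≤ 2 + t) (F : RGraph (2 + t) v) (v≤2+M : v ≤ suc (suc M)) →
  ∃[ N ] (∀ {n} → N ≤ n → (G : RGraph (2 + t) n) → Free (Ext (addIsolated v≤2+M F) 2≤r) G →
    (∀ x → minDegree M (1 + t) n ≤ deg G x) → D G ≤ D (turánGraph (2 + t) n (suc M))) →
  ∃[ n₂ ] (∀ n → n₂ ≤ n → IsTuránNumber n (extension 2≤r v≤2+M F) (size (turánGraph (2 + t) n (suc M))))
turán-number {t} {M = M} 2≤r F v≤2+M (N , large) = N ^ (2 + t) + N , λ n n≥ →
  (turánGraph (2 + t) n (suc M) , partite-Ext-free (addIsolated v≤2+M F) {2≤r = 2≤r} (residue n M) ≤-refl , refl) , turán-bound N large n n≥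

module _ {t v M : ℕ} (2≤r : 2 ≤ 2 + t) (r≤m : 2 + t ≤ suc M) (F : RGraph (2 + t) v) (v≤2+M : v ≤ suc (suc M))
  (shape : (v ≤ suc M) ⊎ ((v ≡ suc (suc M)) × (∃[ u ] (degree F u ≡ 1)))) (st : Stable F (suc M)) where

  private
    X : Extends (addIsolated v≤2+M F) (Ext (addIsolated v≤2+M F) 2≤r)
    X = Ext-extends (addIsolated v≤2+M F) 2≤r

    tp : Tip (addIsolated v≤2+M F)
    tp = tip F v≤2+M shape

    coloured = stable⇒colouring F v≤2+M 2≤r r≤m st

    large = large-minDegree X tp r≤m coloured

  extension-turán-number : ∃[ n₂ ] (∀ n → n₂ ≤ n → IsTuránNumber n (extension 2≤r v≤2+M F) (size (turánGraph (2 + t) n (suc M))))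
  extension-turán-number = turán-number 2≤r F v≤2+M large

-- The equations keep r in the form 2 + t, in which the extension has been studied above.
turán-number-≡ : ∀ {r m v t M : ℕ} .{{_ : NonZero m}} → r ≡ 2 + t → m ≡ suc M → (2≤r : 2 ≤ r) → r ≤ m →
    (F : RGraph r v) (v≤1+m : v ≤ suc m) →
    (v ≤ m) ⊎ ((v ≡ suc m) × (∃[ u ] (degree F u ≡ 1))) →
    Stable F m →
    ∃[ n₂ ] (∀ n → n₂ ≤ n →
    IsTuránNumber n (extension 2≤r v≤1+m F) (size (turánGraph r n m)))
turán-number-≡ refl refl 2≤r r≤m F v≤1+m shape st = extension-turán-number 2≤r r≤m F v≤1+m shape st

theorem6p3 : ∀ {r m v : ℕ} .{{_ : NonZero m}} (2≤r : 2 ≤ r) → r ≤ m →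
    (F : RGraph r v) (v≤1+m : v ≤ suc m) →
    (v ≤ m) ⊎ ((v ≡ suc m) × (∃[ u ] (degree F u ≡ 1))) →
    Stable F m →
    ∃[ n₂ ] (∀ n → n₂ ≤ n →
    IsTuránNumber n (extension 2≤r v≤1+m F) (size (turánGraph r n m)))
theorem6p3 {zero}        {m}     ()
theorem6p3 {suc zero}    {m}     (s≤s ())
theorem6p3 {suc (suc t)} {zero}  2≤r ()
theorem6p3 {suc (suc t)} {suc M} = turán-number-≡ refl refl
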